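{- Consider any instance of the online allocation model with full compatibility in which each bonus function $f_i$ is nonnegative, nondecreasing, and discrete concave on $\{0,1,\dots,b_i\}$. For $\alpha>1$ and $\theta\in[1,1+\alpha]$ define $$H_\alpha(\theta)=(\theta-1)^2\min\left\{\frac1{\alpha^2},\frac1{\theta^2}\right\}+\frac{\alpha^2-(\theta-1)^2}{(1+\alpha)^2\theta^2},\qquad c_{\det}(\alpha)=\min_{\theta\in[1,1+\alpha]}H_\alpha(\theta).$$ Then for every $\alpha>1$ (such that $\alpha S$ and $(1+\alpha)S$ are integers at every phase start, e.g. $\alpha$ an integer), the Intermediate Target Repair algorithm $\pi$ with multiplier $\alpha$ satisfies, for every realized arrival count $\ell$, $$\mathrm{Rev}^\pi(\ell)\ \ge\ c_{\det}(\alpha)\,U(\ell).$$ For $\alpha=2$ this gives $c_{\det}(2)=0.2466\ldots$. Optimizing over $\alpha$ gives $\sup_{\alpha>1}c_{\det}(\alpha)=0.2467\ldots$, at $\alpha\approx 1.9232$. Consequently, the algorithm (with $\alpha=2$) achieves $$\mathbb E[\mathrm{Rev}^\pi(L)]\ \ge\ 0.2466\,\mathbb E[U(L)]\ \ge\ 0.2466\,\mathrm{OPT}_{\mathrm{on}}.$$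
   Context: Model. An instance consists of products $\mathcal I=\{1,\dots,m\}$, capacities $b_i\in\mathbb Z_+$, base rewards $r_i\ge 0$, bonus functions $f_i:\mathbb Z_+\to\mathbb R_+$, nonnegative and nondecreasing with $f_i(0)=0$, a horizon of $T$ periods and arrival probabilities $p_1,\dots,p_T\in[0,1]$. In period $t$ a customer arrives with probability $p_t$, independently across periods; $L$ is the total number of arrivals. Each arriving customer must be immediately and irrevocably assigned to a product with remaining capacity or rejected; every customer may be assigned to every product (full compatibility). The $k$-th sale of product $i$ yields reward $r_i+f_i(k)$; $R_i(n)=n r_i+\sum_{k=1}^n f_i(k)$, $R_i(0)=0$, and $V(\boldsymbol x)=\sum_{i}R_i(x_i)$. An online algorithm knows the instance parameters, but its decisions depend only on arrivals observed so far, its past decisions and independent internal randomization; $\mathrm{OPT}_{\mathrm{on}}=\sup_\pi\mathbb E[\mathrm{Rev}^\pi]$ over all online algorithms. $C=\sum_i b_i$. Offline benchmark: $U(\ell)=\max\{V(\boldsymbol x): \boldsymbol x\in\mathbb Z_+^m,\ x_i\le b_i\ \forall i,\ \sum_i x_i\le \ell\}$. Discrete concavity of $f_i$ on $\{0,\dots,b_i\}$: $f_i(k+1)-f_i(k)\le f_i(k)-f_i(k-1)$ for $k=1,\dots,b_i-1$. Repair orders. For a feasible allocation $\boldsymbol s$ and $\boldsymbol d\in\mathbb Z_+^m$ with $d_i\le b_i-s_i$ and $D=\|\boldsymbol d\|_1$, a repair order is a sequence $\eta=(\eta_1,\dots,\eta_D)$ of products containing exactly $d_i$ copies of each $i$;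 its prefix increment is $d^{(h)}_i=|\{\tau\le h:\eta_\tau=i\}|$. Call $\eta$ prefix-robust if $V(\boldsymbol s+\boldsymbol d^{(h)})-V(\boldsymbol s)\ge (h/D)^2\,(V(\boldsymbol s+\boldsymbol d)-V(\boldsymbol s))$ for all $h=0,\dots,D$ (if $D=0$ the order is empty). Under the discrete concavity assumption a prefix-robust order always exists. Intermediate Target Repair with multiplier $\alpha>1$. Start with $\boldsymbol s=\boldsymbol 0$. Assign the first arrival to some $i^\star\in\arg\max_{i:b_i>0}R_i(1)$ and set $s_{i^\star}=1$. While $\|\boldsymbol s\|_1<C$, run a phase: set $S=\|\boldsymbol s\|_1$, $M=\min\{(1+\alpha)S,C\}$, $K=\min\{\alpha S,C\}$; compute $\boldsymbol x^K\in\arg\max\{V(\boldsymbol x):0\le x_i\le b_i,\ \boldsymbol x\in\mathbb Z_+^m,\ \|\boldsymbol x\|_1=K\}$; set $d_i=(x^K_i-s_i)^+$, $D=\|\boldsymbol d\|_1$, and choose a prefix-robust repair order $\eta$ for $\boldsymbol d$ from $\boldsymbol s$. Until $\|\boldsymbol s\|_1=M$, assign the $h$-th arrival of the phase to $\eta_h$ if $h\le D$, and otherwise to any product with remaining capacity, updating $\boldsymbol s$ after each assignment. The algorithm stops when arrivals stop; once all products are full, further customers are rejected. The algorithm is in normalized integral form: $\alpha S$ and $(1+\alpha)S$ are integers at every phase start (automatic for integer $\alpha$). $\mathrm{Rev}^\pi(\ell)$ denotes its total reward when exactly $\ell$ customers arrive. -}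

module Defs where

open import Level using (0ℓ)
open import Algebra.Bundles using (CommutativeRing; Semiring)
open import Data.Bool.Base using (Bool; true; false)
open import Data.Fin.Base using (Fin; toℕ)
open import Data.Fin.Properties using (_≟_)
open import Data.List.Base as List using (List; []; _∷_; _++_; [_]; length; map; filter; take; upTo; cartesianProductWith)
open import Data.Nat.Base as ℕ using (ℕ; zero; suc; _∸_)
import Data.Nat.Properties as ℕₚ
open import Data.Product using (∃; ∃-syntax; _×_; _,_)
open import Data.Vec.Base as Vec using (Vec; []; _∷_)
import Data.Vec.Functional as Vector
open Vector using (Vector)
open import Relation.Binary.Bundles using (TotalOrder)
open import Relation.Binary.Core using (Rel)
open import Relation.Binary.Structures using (IsTotalOrder)
open import Relation.Binary.PropositionalEquality using (_≡_)
open import Relation.Nullary.Negation using (¬_)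
import Algebra.Construct.NaturalChoice.Min as Min
import Algebra.Definitions.RawMonoid as RawMonoidDefs
import Algebra.Definitions.RawSemiring as RawSemiringDefs
import Data.List.Extrema as Extrema
import Relation.Binary.Construct.NonStrictToStrict as ToStrict

-- A Dedekind-complete totally ordered field (up to setoid equality); classically
-- this determines the real numbers up to isomorphism.  As usual, the inverse is a
-- total operation whose value at 0 is unconstrained.
record RealField : Set₁ where
  field
    commutativeRing : CommutativeRing 0ℓ 0ℓ

  open CommutativeRing commutativeRing public

  infix 4 _≤_ _<_
  infix 9 _⁻¹

  field
    _≤_           : Rel Carrier 0ℓ
    isTotalOrder  : IsTotalOrder _≈_ _≤_
    +-monoʳ-≤     : ∀ x {y z} → y ≤ z → x + y ≤ x + z
    *-nonNegative : ∀ {x y} → 0# ≤ x → 0# ≤ y → 0# ≤ x * y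
    0≉1           : ¬ (0# ≈ 1#)
    _⁻¹           : Carrier → Carrier
    ⁻¹-cong       : ∀ {x y} → x ≈ y → x ⁻¹ ≈ y ⁻¹
    *-inverseʳ    : ∀ {x} → ¬ (x ≈ 0#) → x * x ⁻¹ ≈ 1#

  UpperBound : (Carrier → Set) → Carrier → Set
  UpperBound P u = ∀ x → P x → x ≤ u

  IsSupremum : (Carrier → Set) → Carrier → Set
  IsSupremum P s = UpperBound P s × (∀ u → UpperBound P u → s ≤ u)

  field
    complete : ∀ (P : Carrier → Set) → ∃ P → ∃ (UpperBound P) → ∃ (IsSupremum P)

  totalOrder : TotalOrder 0ℓ 0ℓ 0ℓ
  totalOrder = record { isTotalOrder = isTotalOrder }

  _<_ : Rel Carrier 0ℓ
  _<_ = ToStrict._<_ _≈_ _≤_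

  open Min totalOrder public using (_⊓_)
  open RawSemiringDefs (Semiring.rawSemiring semiring) public using (_^_; sum) renaming (_×_ to _·_)

  infixl 7 _/_
  _/_ : Carrier → Carrier → Carrier
  x / y = x * y ⁻¹

  fromℕ : ℕ → Carrier
  fromℕ n = n · 1#

  -- n / 10ᵏ, so that 0.2466 is decimal 2466 4
  decimal : ℕ → ℕ → Carrier
  decimal n k = fromℕ n / (fromℕ 10 ^ k)

  IsMinimumOn : (Carrier → Carrier) → (lo hi : Carrier) → Carrier → Set
  IsMinimumOn h lo hi v =
    (∃[ x ] lo ≤ x × x ≤ hi × v ≈ h x) ×
    (∀ x → lo ≤ x → x ≤ hi → v ≤ h x)

module OnlineAllocation (ℝ : RealField) where

  open RealField ℝ

  Allocation : ℕ → Set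
  Allocation m = Vector ℕ m

  ∥_∥₁ : ∀ {m} → Allocation m → ℕ
  ∥ x ∥₁ = RawMonoidDefs.sum ℕ.+-0-rawMonoid x

  infixl 6 _⊕_
  _⊕_ : ∀ {m} → Allocation m → Allocation m → Allocation m
  (x ⊕ y) i = x i ℕ.+ y i

  count : ∀ {m} → List (Fin m) → Allocation m
  count η i = length (filter (i ≟_) η)

  grid : ∀ {m} → Allocation m → List (Allocation m)
  grid {zero}  b = [ Vector.[] ]
  grid {suc m} b = cartesianProductWith Vector._∷_ (upTo (suc (Vector.head b))) (grid (Vector.tail b))

  record Instance : Set where
    field
      m            : ℕ
      b            : Allocation m
      r            : Fin m → Carrier
      f            : Fin m → ℕ → Carrier
      T            : ℕ
      p            : Vec Carrier T
      r-nonneg     : ∀ i → 0# ≤ r i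
      f-nonneg     : ∀ i k → 0# ≤ f i k
      f-monotone   : ∀ i {j k} → j ℕ.≤ k → f i j ≤ f i k
      f-zero       : ∀ i → f i 0 ≈ 0#
      p-nonneg     : ∀ t → 0# ≤ Vec.lookup p t
      p-≤1         : ∀ t → Vec.lookup p t ≤ 1#

    C : ℕ
    C = ∥ b ∥₁

    R : Fin m → ℕ → Carrier
    R i n = n · r i + sum {n} (λ k → f i (suc (toℕ k)))

    V : Allocation m → Carrier
    V x = sum (λ i → R i (x i))

    Feasible : Allocation m → Set
    Feasible x = ∀ i → x i ℕ.≤ b i

    -- grid b lists all x with x i ≤ b i for every i; the zero allocation, always
    -- feasible, seeds the maximum.
    U : ℕ → Carrier
    U ℓ = Extrema.max totalOrder (V (λ _ → 0))
            (map V (filter (λ x → ∥ x ∥₁ ℕₚ.≤? ℓ) (grid b)))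

    -- The second difference centred at k = suc j, so 1 ≤ k ≤ b i - 1.
    DiscreteConcave : Set
    DiscreteConcave = ∀ i j → suc (suc j) ℕ.≤ b i →
      f i (suc (suc j)) - f i (suc j) ≤ f i (suc j) - f i j

  module _ (I : Instance) where
    open Instance I

    record PrefixRobust (s d : Allocation m) (η : List (Fin m)) : Set where
      D : ℕ
      D = ∥ d ∥₁
      field
        copies : ∀ i → count η i ≡ d i
        robust : ∀ h → h ℕ.≤ D →
          (fromℕ h / fromℕ D) ^ 2 * (V (s ⊕ d) - V s) ≤ V (s ⊕ count (take h η)) - V s

    IsTarget : ℕ → Allocation m → Set
    IsTarget K x = Feasible x × ∥ x ∥₁ ≡ K ×
      (∀ y → Feasible y → ∥ y ∥₁ ≡ K → V y ≤ V x)

    -- Phases α s σ: starting a phase from s, the algorithm may assign the subsequent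
    -- arrivals, one by one, to the products listed in σ.  The naturals αS and [1+α]S
    -- express the normalized integral form.  As ∥ s ∥₁ + D ≤ M always holds, a phase
    -- consists of all of η followed by a filler ζ; the final feasibility condition says
    -- that each assigned product had remaining capacity.
    data Phases (α : Carrier) (s : Allocation m) : List (Fin m) → Set where
      full  : ∥ s ∥₁ ≡ C → Phases α s []
      phase : ∥ s ∥₁ ℕ.< C →
              (αS [1+α]S : ℕ) →
              fromℕ αS ≈ α * fromℕ ∥ s ∥₁ →
              fromℕ [1+α]S ≈ (1# + α) * fromℕ ∥ s ∥₁ →
              (xᴷ : Allocation m) → IsTarget (αS ℕ.⊓ C) xᴷ →
              (η : List (Fin m)) → PrefixRobust s (λ i → xᴷ i ∸ s i) η →
              (ζ : List (Fin m)) →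
              ∥ s ⊕ count (η ++ ζ) ∥₁ ≡ [1+α]S ℕ.⊓ C →
              Feasible (s ⊕ count (η ++ ζ)) →
              (σ : List (Fin m)) → Phases α (s ⊕ count (η ++ ζ)) σ →
              Phases α s ((η ++ ζ) ++ σ)

    -- σ is the sequence of assignments made by some execution of Intermediate Target
    -- Repair with multiplier α (for some resolution of its free choices) when the
    -- arrivals do not stop early; arrivals beyond the end of σ are rejected.
    data IntermediateTargetRepair (α : Carrier) : List (Fin m) → Set where
      no-capacity   : C ≡ 0 → IntermediateTargetRepair α []
      first-arrival : (i⋆ : Fin m) → 0 ℕ.< b i⋆ →
                      (∀ i → 0 ℕ.< b i → R i 1 ≤ R i⋆ 1) →
                      (σ : List (Fin m)) → Phases α (count [ i⋆ ]) σ →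
                      IntermediateTargetRepair α (i⋆ ∷ σ)

    Rev : List (Fin m) → ℕ → Carrier
    Rev σ ℓ = V (count (take ℓ σ))

    data Event : Set where
      noArrival : Event
      rejected  : Event
      sold      : Fin m → Event

    -- most recent period first
    History : Set
    History = List Event

    sales : History → Allocation m
    sales []              = λ _ → 0
    sales (noArrival ∷ h) = sales h
    sales (rejected ∷ h)  = sales h
    sales (sold i ∷ h)    = sales h ⊕ count [ i ]

    -- An online algorithm, given by the conditional distribution of its decision on an
    -- arriving customer given the arrivals and decisions of the earlier periods.  Every
    -- randomized algorithm, whatever its internal random seed, has this form, because
    -- there are finitely many decisions per period and its past decisions are recorded.
    record OnlineAlgorithm : Set where
      field
        reject        : History → Carrier
        sell          : History → Fin m → Carrier
        reject-nonneg : ∀ h → 0# ≤ reject h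
        sell-nonneg   : ∀ h i → 0# ≤ sell h i
        total         : ∀ h → reject h + sum (sell h) ≈ 1#
        capacity      : ∀ h i → b i ℕ.≤ sales h i → sell h i ≈ 0#

      -- Reward on a given arrival pattern, averaged over the internal randomization.
      revenue : ∀ {n} → History → Vec Bool n → Carrier
      revenue h []          = V (sales h)
      revenue h (false ∷ ω) = revenue (noArrival ∷ h) ω
      revenue h (true ∷ ω)  =
        reject h * revenue (rejected ∷ h) ω +
        sum (λ i → sell h i * revenue (sold i ∷ h) ω)

  arrivals : ∀ {n} → Vec Bool n → ℕ
  arrivals []          = 0
  arrivals (true ∷ ω)  = suc (arrivals ω)
  arrivals (false ∷ ω) = arrivals ω

  -- Expectation when period t has an arrival (true) with probability p t, independently.
  𝔼 : ∀ {n} → Vec Carrier n → (Vec Bool n → Carrier) → Carrier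
  𝔼 []      X = X []
  𝔼 (p ∷ ps) X = p * 𝔼 ps (λ ω → X (true ∷ ω)) + (1# - p) * 𝔼 ps (λ ω → X (false ∷ ω))

  IsOPTon : Instance → Carrier → Set
  IsOPTon I = IsSupremum λ v → ∃[ π ] v ≈ 𝔼 (Instance.p I) (OnlineAlgorithm.revenue {I} π [])

  H : Carrier → Carrier → Carrier
  H α θ = (θ - 1#) ^ 2 * ((1# / α ^ 2) ⊓ (1# / θ ^ 2)) +
          (α ^ 2 - (θ - 1#) ^ 2) / ((1# + α) ^ 2 * θ ^ 2)

  IsCdet : Carrier → Carrier → Set
  IsCdet α = IsMinimumOn (H α) 1# (1# + α)

{-# OPTIONS --safe #-}

-- Concavity gives (k + 1) f(k) ≤ 2 (f(1) + … + f(k)), so averaging over the units of an optimal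
-- allocation of size n finds one whose removal costs at most the fraction 2 / (n + 1); hence
-- n² U(k) ≥ k² U(n) for k ≤ n.  A phase starting from s with S units ends above the target of
-- size K = min (α S , C), so (1 + α)² V(s) ≥ α² U(S) at every phase start.  After h arrivals,
-- with θ = (S + h) / S, prefix-robustness and D ≤ α S make the reward at least the mixture of
-- V(s) and U(K) with weight (θ - 1)² / α², and the two bounds on U turn this into H α θ · U(S + h).
--
-- c_det is attained by continuity of H.  Its numerical values reduce to polynomial inequalities:
-- H α₀ ≥ v₀ at one α₀, whereas H at an affine function of α is at most v₀ for every α outside the
-- stated interval around α₀.  Within the interval c_det, an infimum of continuous functions of α,
-- attains its maximum.
--
-- An online algorithm never beats U on any sequence of arrivals, which bounds its expectation.

module Submission where

open import Defs
open import Level using (0ℓ)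
open import Algebra.Bundles using (CommutativeRing; RawRing)
open import Axiom.ExcludedMiddle using (ExcludedMiddle)
open import Data.Bool.Base using (Bool; true; false)
open import Data.Fin.Base as Fin using (Fin; zero; suc; toℕ)
import Data.Fin.Properties as Finₚ
open import Data.Integer.Base as ℤ using (ℤ; +_; -[1+_])
import Data.Integer.Properties as ℤₚ
open import Data.List.Base as List using (List; []; _∷_; _++_; [_]; length; filter; take; upTo)
open import Data.List.Membership.Propositional using (_∈_)
open import Data.List.Membership.Propositional.Properties using (∈-cartesianProductWith⁺; ∈-cartesianProductWith⁻; ∈-upTo⁺; ∈-upTo⁻; ∈-map⁺; ∈-map⁻; ∈-filter⁺; ∈-filter⁻)
import Data.List.Properties as Listₚ
open import Data.List.Relation.Unary.Any using (here)
import Data.List.Relation.Unary.All as All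
import Data.List.Extrema as Extrema
open import Data.Maybe.Base using (Maybe; just; nothing)
open import Data.Nat.Base as ℕ using (ℕ; zero; suc; _∸_)
import Data.Nat.Properties as ℕₚ
open import Data.Product using (∃; ∃-syntax; _×_; _,_; proj₁; proj₂)
open import Data.Sum.Base using (_⊎_; inj₁; inj₂; [_,_]′)
open import Data.Unit.Base using (⊤; tt)
open import Data.Vec.Base as Vec using (Vec; []; _∷_)
import Data.Vec.Functional as Vector
open import Function.Base using (_∘_; id; const)
open import Relation.Binary.Bundles using (TotalOrder)
open import Relation.Binary.PropositionalEquality as ≡ using (_≡_)
open import Relation.Binary.Structures using (IsTotalOrder)
open import Relation.Nullary using (¬_; yes; no)
open import Relation.Nullary.Negation using (contradiction)
import Algebra.Construct.NaturalChoice.Min as Min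
import Algebra.Properties.Ring as RingProperties
import Algebra.Properties.Semiring.Mult as SemiringMult
import Algebra.Properties.Semiring.Exp as SemiringExp
import Algebra.Properties.Semiring.Sum as SemiringSum
import Algebra.Properties.CommutativeMonoid.Sum as CommutativeMonoidSum
import Algebra.Solver.Ring as RingSolver
open import Algebra.Solver.Ring.AlmostCommutativeRing using (fromCommutativeRing; _-Raw-AlmostCommutative⟶_)
import Relation.Binary.Construct.NonStrictToStrict as ToStrict
import Relation.Binary.Properties.TotalOrder as TotalOrderProperties
import Relation.Binary.Reasoning.PartialOrder as PartialOrderReasoning
import Relation.Binary.Reasoning.Setoid as SetoidReasoning

-- The minimum in `H` records where the arrivals stop relative to the target. Up to size α S, or if
-- the target is capped by C, the benchmark is at most U(K); past α S it may have grown by (θ / α)²,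
-- which turns the weight (θ - 1)² / α² into (θ - 1)² / θ².
--
-- Locating the maximiser of c_det to four decimals is the delicate numerical claim. At a smooth
-- maximum a shift of α by about 10⁻⁵ is felt only at second order, so `v₀` must carry many digits,
-- and so must every certificate that compares `H` with it. All of these are integer polynomial
-- identities, and the ring solver is set up for large coefficients from the start.
--
-- Excluded middle is tied to completeness: a supremum of an arbitrary predicate comes without
-- members close to it, and attainment of an infimum has to be decided. It also makes c_det a
-- function of α alone.

-- Integers in the field and a ring solver with integer coefficients.

module OrderedField (ℝ : RealField) where

  open RealField ℝ public hiding (zero)
  open RingProperties ring using (-0#≈0#; -‿involutive; -‿+-comm; -‿distribˡ-*; -‿distribʳ-*)
  open SemiringMult semiring using (×-homo-+; ×1-homo-*)
  open SetoidReasoning setoid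

  -- Numerals from 2 on do not reduce, so that comparing large coefficients never
  -- unfolds them into unary sums.
  abstract
    numeral : ℕ → Carrier
    numeral n = fromℕ (suc (suc n))

    numeral≈fromℕ : ∀ n → numeral n ≈ fromℕ (suc (suc n))
    numeral≈fromℕ n = refl

  -- The values 0, 1 and -1 have clauses of their own so that `con (+ 0)` and `con (+ 1)` denote
  -- `0#` and `1#` definitionally; `fromℕ 1` would be `1# + 0#`.
  fromℤ : ℤ → Carrier
  fromℤ (+ 0)             = 0#
  fromℤ (+ 1)             = 1#
  fromℤ (+ suc (suc n))   = numeral n
  fromℤ -[1+ 0 ]          = - 1#
  fromℤ -[1+ suc n ]      = - numeral n

  fromℤ-pos : ∀ n → fromℤ (+ n) ≈ fromℕ n
  fromℤ-pos 0             = refl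
  fromℤ-pos 1             = sym (+-identityʳ 1#)
  fromℤ-pos (suc (suc n)) = numeral≈fromℕ n

  fromℤ-neg : ∀ n → fromℤ (ℤ.- (+ n)) ≈ - fromℕ n
  fromℤ-neg 0             = sym -0#≈0#
  fromℤ-neg 1             = -‿cong (sym (+-identityʳ 1#))
  fromℤ-neg (suc (suc n)) = -‿cong (numeral≈fromℕ n)

  fromℕ-+ : ∀ m n → fromℕ (m ℕ.+ n) ≈ fromℕ m + fromℕ n
  fromℕ-+ = ×-homo-+ 1#

  fromℕ-* : ∀ m n → fromℕ (m ℕ.* n) ≈ fromℕ m * fromℕ n
  fromℕ-* = ×1-homo-*

  private
    -- Proved by hand because the ring solver is built on the homomorphism that rests on this
    -- identity.
    cancel-suc : ∀ x y → x - y ≈ (1# + x) - (1# + y)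
    cancel-suc x y = begin
      x - y                       ≈⟨ +-identityˡ (x - y) ⟨
      0# + (x - y)                ≈⟨ +-congʳ (-‿inverseʳ 1#) ⟨
      (1# - 1#) + (x - y)         ≈⟨ +-assoc 1# (- 1#) (x - y) ⟩
      1# + (- 1# + (x - y))       ≈⟨ +-congˡ (+-assoc (- 1#) x (- y)) ⟨
      1# + ((- 1# + x) - y)       ≈⟨ +-congˡ (+-congʳ (+-comm (- 1#) x)) ⟩
      1# + ((x - 1#) - y)         ≈⟨ +-congˡ (+-assoc x (- 1#) (- y)) ⟩
      1# + (x + (- 1# - y))       ≈⟨ +-assoc 1# x (- 1# - y) ⟨
      (1# + x) + (- 1# - y)       ≈⟨ +-congˡ (-‿+-comm 1# y) ⟩
      (1# + x) - (1# + y)         ∎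

  fromℤ-⊖ : ∀ m n → fromℤ (m ℤ.⊖ n) ≈ fromℕ m - fromℕ n
  fromℤ-⊖ m zero = begin
    fromℤ (+ m)      ≈⟨ fromℤ-pos m ⟩
    fromℕ m          ≈⟨ +-identityʳ (fromℕ m) ⟨
    fromℕ m + 0#     ≈⟨ +-congˡ -0#≈0# ⟨
    fromℕ m - 0#     ∎
  fromℤ-⊖ zero (suc n) = begin
    fromℤ (ℤ.- (+ suc n))   ≈⟨ fromℤ-neg (suc n) ⟩
    - fromℕ (suc n)         ≈⟨ +-identityˡ _ ⟨
    0# - fromℕ (suc n)      ∎
  fromℤ-⊖ (suc m) (suc n) = begin
    fromℤ (suc m ℤ.⊖ suc n)         ≡⟨ ≡.cong fromℤ (ℤₚ.[1+m]⊖[1+n]≡m⊖n m n) ⟩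
    fromℤ (m ℤ.⊖ n)                 ≈⟨ fromℤ-⊖ m n ⟩
    fromℕ m - fromℕ n               ≈⟨ cancel-suc _ _ ⟩
    fromℕ (suc m) - fromℕ (suc n)   ∎

  fromℤ-+ : ∀ i j → fromℤ (i ℤ.+ j) ≈ fromℤ i + fromℤ j
  fromℤ-+ (+ m) (+ n) = begin
    fromℤ (+ (m ℕ.+ n))         ≈⟨ fromℤ-pos (m ℕ.+ n) ⟩
    fromℕ (m ℕ.+ n)             ≈⟨ fromℕ-+ m n ⟩
    fromℕ m + fromℕ n           ≈⟨ +-cong (fromℤ-pos m) (fromℤ-pos n) ⟨
    fromℤ (+ m) + fromℤ (+ n)   ∎
  fromℤ-+ (+ m) -[1+ n ] = begin
    fromℤ (m ℤ.⊖ suc n)             ≈⟨ fromℤ-⊖ m (suc n) ⟩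
    fromℕ m - fromℕ (suc n)         ≈⟨ +-cong (fromℤ-pos m) (fromℤ-neg (suc n)) ⟨
    fromℤ (+ m) + fromℤ -[1+ n ]    ∎
  fromℤ-+ -[1+ m ] (+ n) = begin
    fromℤ (n ℤ.⊖ suc m)             ≈⟨ fromℤ-⊖ n (suc m) ⟩
    fromℕ n - fromℕ (suc m)         ≈⟨ +-comm _ _ ⟩
    - fromℕ (suc m) + fromℕ n       ≈⟨ +-cong (fromℤ-neg (suc m)) (fromℤ-pos n) ⟨
    fromℤ -[1+ m ] + fromℤ (+ n)    ∎
  fromℤ-+ -[1+ m ] -[1+ n ] = begin
    - numeral (m ℕ.+ n)                   ≈⟨ fromℤ-neg (suc (suc (m ℕ.+ n))) ⟩
    - fromℕ (suc (suc (m ℕ.+ n)))         ≡⟨ ≡.cong (λ k → - fromℕ (suc k)) (ℕₚ.+-suc m n) ⟨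
    - fromℕ (suc m ℕ.+ suc n)             ≈⟨ -‿cong (fromℕ-+ (suc m) (suc n)) ⟩
    - (fromℕ (suc m) + fromℕ (suc n))     ≈⟨ -‿+-comm _ _ ⟨
    - fromℕ (suc m) - fromℕ (suc n)       ≈⟨ +-cong (fromℤ-neg (suc m)) (fromℤ-neg (suc n)) ⟨
    fromℤ -[1+ m ] + fromℤ -[1+ n ]       ∎

  fromℤ-‿neg : ∀ i → fromℤ (ℤ.- i) ≈ - fromℤ i
  fromℤ-‿neg (+ n)     = trans (fromℤ-neg n) (-‿cong (sym (fromℤ-pos n)))
  fromℤ-‿neg -[1+ n ]  = begin
    fromℤ (+ suc n)      ≈⟨ fromℤ-pos (suc n) ⟩
    fromℕ (suc n)        ≈⟨ -‿involutive _ ⟨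
    - - fromℕ (suc n)    ≈⟨ -‿cong (fromℤ-neg (suc n)) ⟨
    - fromℤ -[1+ n ]     ∎

  fromℤ-*-pos : ∀ m n → fromℤ (+ m ℤ.* + n) ≈ fromℤ (+ m) * fromℤ (+ n)
  fromℤ-*-pos m n = begin
    fromℤ (+ m ℤ.* + n)         ≡⟨ ≡.cong fromℤ (ℤₚ.pos-* m n) ⟨
    fromℤ (+ (m ℕ.* n))         ≈⟨ fromℤ-pos (m ℕ.* n) ⟩
    fromℕ (m ℕ.* n)             ≈⟨ fromℕ-* m n ⟩
    fromℕ m * fromℕ n           ≈⟨ *-cong (fromℤ-pos m) (fromℤ-pos n) ⟨
    fromℤ (+ m) * fromℤ (+ n)   ∎

  fromℤ-*-posˡ : ∀ m j → fromℤ (+ m ℤ.* j) ≈ fromℤ (+ m) * fromℤ j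
  fromℤ-*-posˡ m (+ n)    = fromℤ-*-pos m n
  fromℤ-*-posˡ m -[1+ n ] = begin
    fromℤ (+ m ℤ.* (ℤ.- (+ suc n)))    ≡⟨ ≡.cong fromℤ (ℤₚ.neg-distribʳ-* (+ m) (+ suc n)) ⟨
    fromℤ (ℤ.- (+ m ℤ.* + suc n))      ≈⟨ fromℤ-‿neg (+ m ℤ.* + suc n) ⟩
    - fromℤ (+ m ℤ.* + suc n)          ≈⟨ -‿cong (fromℤ-*-pos m (suc n)) ⟩
    - (fromℤ (+ m) * fromℤ (+ suc n))  ≈⟨ -‿distribʳ-* _ _ ⟩
    fromℤ (+ m) * - fromℤ (+ suc n)    ≈⟨ *-congˡ (fromℤ-‿neg (+ suc n)) ⟨
    fromℤ (+ m) * fromℤ -[1+ n ]       ∎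

  fromℤ-* : ∀ i j → fromℤ (i ℤ.* j) ≈ fromℤ i * fromℤ j
  fromℤ-* (+ m)     j = fromℤ-*-posˡ m j
  fromℤ-* -[1+ m ]  j = begin
    fromℤ ((ℤ.- (+ suc m)) ℤ.* j)     ≡⟨ ≡.cong fromℤ (ℤₚ.neg-distribˡ-* (+ suc m) j) ⟨
    fromℤ (ℤ.- (+ suc m ℤ.* j))       ≈⟨ fromℤ-‿neg (+ suc m ℤ.* j) ⟩
    - fromℤ (+ suc m ℤ.* j)           ≈⟨ -‿cong (fromℤ-*-posˡ (suc m) j) ⟩
    - (fromℤ (+ suc m) * fromℤ j)     ≈⟨ -‿distribˡ-* _ _ ⟩
    - fromℤ (+ suc m) * fromℤ j       ≈⟨ *-congʳ (fromℤ-‿neg (+ suc m)) ⟨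
    fromℤ -[1+ m ] * fromℤ j          ∎

  private
    ℤ-rawRing : RawRing 0ℓ 0ℓ
    ℤ-rawRing = CommutativeRing.rawRing ℤₚ.+-*-commutativeRing

    fromℤ-morphism : ℤ-rawRing -Raw-AlmostCommutative⟶ fromCommutativeRing commutativeRing
    fromℤ-morphism = record
      { ⟦_⟧    = fromℤ
      ; +-homo = fromℤ-+
      ; *-homo = fromℤ-*
      ; -‿homo = fromℤ-‿neg
      ; 0-homo = refl
      ; 1-homo = refl
      }

    -- Comparing the integers themselves lets certificates with very long coefficients be checked by
    -- binary arithmetic.
    coefficient≟ : ∀ i j → Maybe (fromℤ i ≈ fromℤ j)
    coefficient≟ i j with i ℤₚ.≟ j
    ... | yes i≡j = just (reflexive (≡.cong fromℤ i≡j))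
    ... | no  _   = nothing

  open RingSolver ℤ-rawRing (fromCommutativeRing commutativeRing) fromℤ-morphism coefficient≟ public
    using (Polynomial; con; solve; _:+_; _:*_; _:-_; :-_; _:^_; _:=_)

-- Ordered-field arithmetic.

module Order (ℝ : RealField) where

  open OrderedField ℝ public
  open IsTotalOrder isTotalOrder public using (total; ≤-respˡ-≈; ≤-respʳ-≈)
    renaming (refl to ≤-refl; trans to ≤-trans; antisym to ≤-antisym; reflexive to ≤-reflexive)
  open Min totalOrder public using (x≤y⇒x⊓y≈x; x≤y⇒y⊓x≈x; x⊓y≤x; x⊓y≤y; ⊓-glb; ⊓-sel)
  open TotalOrderProperties totalOrder public using (≰⇒>; <-trans; <⇒≱; <-respʳ-≈)
  open SemiringExp semiring public using (^-congˡ)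
  module ≤-Reasoning = PartialOrderReasoning (TotalOrder.poset totalOrder)

  <⇒≤ : ∀ {x y} → x < y → x ≤ y
  <⇒≤ = proj₁

  <-≤-trans : ∀ {x y z} → x < y → y ≤ z → x < z
  <-≤-trans = ToStrict.<-≤-trans _≈_ _≤_ sym ≤-trans ≤-antisym ≤-respʳ-≈

  ≤-<-trans : ∀ {x y z} → x ≤ y → y < z → x < z
  ≤-<-trans = ToStrict.≤-<-trans _≈_ _≤_ ≤-trans ≤-antisym ≤-respˡ-≈

  +-mono-≤ : ∀ {x y u v} → x ≤ y → u ≤ v → x + u ≤ y + v
  +-mono-≤ {x} {y} {u} {v} x≤y u≤v = begin
    x + u   ≤⟨ +-monoʳ-≤ x u≤v ⟩
    x + v   ≈⟨ +-comm x v ⟩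
    v + x   ≤⟨ +-monoʳ-≤ v x≤y ⟩
    v + y   ≈⟨ +-comm v y ⟩
    y + v   ∎
    where open ≤-Reasoning

  x≤y⇒0≤y-x : ∀ {x y} → x ≤ y → 0# ≤ y - x
  x≤y⇒0≤y-x {x} {y} x≤y = begin
    0#        ≈⟨ -‿inverseˡ x ⟨
    - x + x   ≤⟨ +-monoʳ-≤ (- x) x≤y ⟩
    - x + y   ≈⟨ +-comm (- x) y ⟩
    y - x     ∎
    where open ≤-Reasoning

  0≤y-x⇒x≤y : ∀ {x y} → 0# ≤ y - x → x ≤ y
  0≤y-x⇒x≤y {x} {y} 0≤y-x = begin
    x             ≈⟨ +-identityʳ x ⟨
    x + 0#        ≤⟨ +-monoʳ-≤ x 0≤y-x ⟩
    x + (y - x)   ≈⟨ solve 2 (λ x y → x :+ (y :- x) := y) refl x y ⟩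
    y             ∎
    where open ≤-Reasoning

  x<y⇒0<y-x : ∀ {x y} → x < y → 0# < y - x
  x<y⇒0<y-x {x} {y} (x≤y , x≉y) = x≤y⇒0≤y-x x≤y , λ 0≈y-x → x≉y (begin
    x             ≈⟨ +-identityʳ x ⟨
    x + 0#        ≈⟨ +-congˡ 0≈y-x ⟩
    x + (y - x)   ≈⟨ solve 2 (λ x y → x :+ (y :- x) := y) refl x y ⟩
    y             ∎)
    where open SetoidReasoning setoid

  0<y-x⇒x<y : ∀ {x y} → 0# < y - x → x < y
  0<y-x⇒x<y {x} {y} (0≤y-x , 0≉y-x) = 0≤y-x⇒x≤y 0≤y-x , λ x≈y →
    0≉y-x (trans (sym (-‿inverseʳ y)) (+-congˡ (-‿cong (sym x≈y))))

  -- The pattern of nearly all inequalities below: the solver identifies the difference of the two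
  -- sides with an expression e whose sign is visible from its shape.
  ≤-by-difference : ∀ {x y e} → y - x ≈ e → 0# ≤ e → x ≤ y
  ≤-by-difference y-x≈e 0≤e = 0≤y-x⇒x≤y (≤-respʳ-≈ (sym y-x≈e) 0≤e)

  <-by-difference : ∀ {x y e} → y - x ≈ e → 0# < e → x < y
  <-by-difference y-x≈e 0<e = 0<y-x⇒x<y (<-respʳ-≈ (sym y-x≈e) 0<e)

  +-nonNegative : ∀ {x y} → 0# ≤ x → 0# ≤ y → 0# ≤ x + y
  +-nonNegative 0≤x 0≤y = ≤-respˡ-≈ (+-identityˡ 0#) (+-mono-≤ 0≤x 0≤y)

  +-pos-nonNegative : ∀ {x y} → 0# < x → 0# ≤ y → 0# < x + y
  +-pos-nonNegative {x} {y} 0<x 0≤y = <-≤-trans 0<x (≤-by-difference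
    (solve 2 (λ x y → x :+ y :- x := y) refl x y) 0≤y)

  +-nonNegative-pos : ∀ {x y} → 0# ≤ x → 0# < y → 0# < x + y
  +-nonNegative-pos 0≤x 0<y = <-respʳ-≈ (+-comm _ _) (+-pos-nonNegative 0<y 0≤x)

  +-positive : ∀ {x y} → 0# < x → 0# < y → 0# < x + y
  +-positive 0<x 0<y = +-pos-nonNegative 0<x (<⇒≤ 0<y)

  *-positive : ∀ {x y} → 0# < x → 0# < y → 0# < x * y
  *-positive {x} {y} (0≤x , 0≉x) (0≤y , 0≉y) = *-nonNegative 0≤x 0≤y , λ 0≈xy → 0≉y (begin
    0#               ≈⟨ zeroʳ (x ⁻¹) ⟨
    x ⁻¹ * 0#        ≈⟨ *-congˡ 0≈xy ⟩
    x ⁻¹ * (x * y)   ≈⟨ solve 3 (λ i x y → i :* (x :* y) := (x :* i) :* y) refl (x ⁻¹) x y ⟩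
    (x * x ⁻¹) * y   ≈⟨ *-congʳ (*-inverseʳ (0≉x ∘ sym)) ⟩
    1# * y           ≈⟨ *-identityˡ y ⟩
    y                ∎)
    where open SetoidReasoning setoid

  square-nonNegative : ∀ x → 0# ≤ x * x
  square-nonNegative x = [ (λ 0≤x → *-nonNegative 0≤x 0≤x) , nonPositive ]′ (total 0# x)
    where
    nonPositive : x ≤ 0# → 0# ≤ x * x
    nonPositive x≤0 = ≤-respʳ-≈
      (solve 1 (λ x → (con (+ 0) :- x) :* (con (+ 0) :- x) := x :* x) refl x)
      (*-nonNegative (x≤y⇒0≤y-x x≤0) (x≤y⇒0≤y-x x≤0))

  ^2-nonNegative : ∀ x → 0# ≤ x ^ 2
  ^2-nonNegative x = ≤-respʳ-≈ (solve 1 (λ x → x :* x := x :^ 2) refl x) (square-nonNegative x)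

  0<1 : 0# < 1#
  0<1 = ≤-respʳ-≈ (*-identityˡ 1#) (square-nonNegative 1#) , 0≉1

  *-monoˡ-≤ : ∀ {z x y} → 0# ≤ z → x ≤ y → z * x ≤ z * y
  *-monoˡ-≤ {z} {x} {y} 0≤z x≤y = ≤-by-difference
    (solve 3 (λ x y z → z :* y :- z :* x := z :* (y :- x)) refl x y z)
    (*-nonNegative 0≤z (x≤y⇒0≤y-x x≤y))

  *-monoʳ-≤ : ∀ {z x y} → 0# ≤ z → x ≤ y → x * z ≤ y * z
  *-monoʳ-≤ {z} {x} {y} 0≤z x≤y = ≤-by-difference
    (solve 3 (λ x y z → y :* z :- x :* z := z :* (y :- x)) refl x y z)
    (*-nonNegative 0≤z (x≤y⇒0≤y-x x≤y))

  *-mono-≤ : ∀ {x y u v} → 0# ≤ x → 0# ≤ v → x ≤ y → u ≤ v → x * u ≤ y * v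
  *-mono-≤ 0≤x 0≤v x≤y u≤v = ≤-trans (*-monoˡ-≤ 0≤x u≤v) (*-monoʳ-≤ 0≤v x≤y)

  ^2-mono-≤ : ∀ {x y} → 0# ≤ x → x ≤ y → x ^ 2 ≤ y ^ 2
  ^2-mono-≤ {x} {y} 0≤x x≤y = *-mono-≤ 0≤x (*-nonNegative (≤-trans 0≤x x≤y) (<⇒≤ 0<1)) x≤y
    (*-monoʳ-≤ (<⇒≤ 0<1) x≤y)

  ^2-positive : ∀ {x} → 0# < x → 0# < x ^ 2
  ^2-positive 0<x = *-positive 0<x (*-positive 0<x 0<1)

  ⁻¹-inverseˡ : ∀ {x} → 0# < x → x ⁻¹ * x ≈ 1#
  ⁻¹-inverseˡ (_ , 0≉x) = trans (*-comm _ _) (*-inverseʳ (0≉x ∘ sym))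

  ⁻¹-positive : ∀ {x} → 0# < x → 0# < x ⁻¹
  ⁻¹-positive {x} 0<x = ≰⇒> λ x⁻¹≤0 → <⇒≱ 0<1 (begin
    1#          ≈⟨ ⁻¹-inverseˡ 0<x ⟨
    x ⁻¹ * x    ≤⟨ *-monoʳ-≤ (<⇒≤ 0<x) x⁻¹≤0 ⟩
    0# * x      ≈⟨ zeroˡ x ⟩
    0#          ∎)
    where open ≤-Reasoning

  *-cancelˡ-≤ : ∀ {z x y} → 0# < z → z * x ≤ z * y → x ≤ y
  *-cancelˡ-≤ {z} {x} {y} 0<z zx≤zy = begin
    x                ≈⟨ cancel x ⟨
    z ⁻¹ * (z * x)   ≤⟨ *-monoˡ-≤ (<⇒≤ (⁻¹-positive 0<z)) zx≤zy ⟩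
    z ⁻¹ * (z * y)   ≈⟨ cancel y ⟩
    y                ∎
    where
    open ≤-Reasoning
    cancel : ∀ u → z ⁻¹ * (z * u) ≈ u
    cancel u = trans (sym (*-assoc _ z u)) (trans (*-congʳ (⁻¹-inverseˡ 0<z)) (*-identityˡ u))

  *-cancelʳ-≤ : ∀ {z x y} → 0# < z → x * z ≤ y * z → x ≤ y
  *-cancelʳ-≤ 0<z xz≤yz = *-cancelˡ-≤ 0<z
    (≤-respˡ-≈ (*-comm _ _) (≤-respʳ-≈ (*-comm _ _) xz≤yz))

  *-cancelʳ-< : ∀ {z x y} → 0# ≤ z → x * z < y * z → x < y
  *-cancelʳ-< 0≤z xz<yz = ≰⇒> λ y≤x → <⇒≱ xz<yz (*-monoʳ-≤ 0≤z y≤x)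

  /-cancelʳ : ∀ x {y} → 0# < y → x / y * y ≈ x
  /-cancelʳ x 0<y = trans (*-assoc x _ _) (trans (*-congˡ (⁻¹-inverseˡ 0<y)) (*-identityʳ x))

  /-positive : ∀ {x y} → 0# < x → 0# < y → 0# < x / y
  /-positive 0<x 0<y = *-positive 0<x (⁻¹-positive 0<y)

  ⁻¹-antitone : ∀ {x y} → 0# < x → x ≤ y → y ⁻¹ ≤ x ⁻¹
  ⁻¹-antitone {x} {y} 0<x x≤y = *-cancelʳ-≤ (*-positive 0<x 0<y) (begin
    y ⁻¹ * (x * y)   ≈⟨ solve 3 (λ i x y → i :* (x :* y) := (i :* y) :* x) refl (y ⁻¹) x y ⟩
    (y ⁻¹ * y) * x   ≈⟨ *-congʳ (⁻¹-inverseˡ 0<y) ⟩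
    1# * x           ≤⟨ *-monoˡ-≤ (<⇒≤ 0<1) x≤y ⟩
    1# * y           ≈⟨ *-congʳ (⁻¹-inverseˡ 0<x) ⟨
    (x ⁻¹ * x) * y   ≈⟨ *-assoc _ x y ⟩
    x ⁻¹ * (x * y)   ∎)
    where
    open ≤-Reasoning
    0<y = <-≤-trans 0<x x≤y

  ⊓-positive : ∀ {x y} → 0# < x → 0# < y → 0# < x ⊓ y
  ⊓-positive {x} {y} 0<x 0<y with ⊓-sel x y
  ... | inj₁ x⊓y≈x = <-respʳ-≈ (sym x⊓y≈x) 0<x
  ... | inj₂ x⊓y≈y = <-respʳ-≈ (sym x⊓y≈y) 0<y

  fromℕ-nonNegative : ∀ n → 0# ≤ fromℕ n
  fromℕ-nonNegative zero    = ≤-refl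
  fromℕ-nonNegative (suc n) = +-nonNegative (<⇒≤ 0<1) (fromℕ-nonNegative n)

  fromℕ-positive : ∀ {n} → 0 ℕ.< n → 0# < fromℕ n
  fromℕ-positive {suc n} _ = +-pos-nonNegative 0<1 (fromℕ-nonNegative n)

  fromℕ-∸ : ∀ {m n} → m ℕ.≤ n → fromℕ (n ∸ m) ≈ fromℕ n - fromℕ m
  fromℕ-∸ {m} {n} m≤n = begin
    fromℕ (n ∸ m)                           ≈⟨ solve 2 (λ x y → x := (y :+ x) :- y) refl (fromℕ (n ∸ m)) (fromℕ m) ⟩
    (fromℕ m + fromℕ (n ∸ m)) - fromℕ m     ≈⟨ +-congʳ (fromℕ-+ m (n ∸ m)) ⟨
    fromℕ (m ℕ.+ (n ∸ m)) - fromℕ m         ≡⟨ ≡.cong (λ k → fromℕ k - fromℕ m) (ℕₚ.m+[n∸m]≡n m≤n) ⟩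
    fromℕ n - fromℕ m                       ∎
    where open SetoidReasoning setoid

  fromℕ-mono-≤ : ∀ {m n} → m ℕ.≤ n → fromℕ m ≤ fromℕ n
  fromℕ-mono-≤ {m} {n} m≤n = ≤-by-difference (sym (fromℕ-∸ m≤n)) (fromℕ-nonNegative (n ∸ m))

  fromℤ-positive : ∀ n → 0# < fromℤ (+ suc n)
  fromℤ-positive n = <-respʳ-≈ (sym (fromℤ-pos (suc n))) (fromℕ-positive {suc n} (ℕ.s≤s ℕ.z≤n))

  fromℤ-nonNegative : ∀ n → 0# ≤ fromℤ (+ n)
  fromℤ-nonNegative n = ≤-respʳ-≈ (sym (fromℤ-pos n)) (fromℕ-nonNegative n)

-- Continuity at a point and its closure under the operations in `H`.

module Continuity (ℝ : RealField) where

  open Order ℝ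

  -- Plays the role of ∣x∣ ≤ ε; two inequalities avoid introducing an absolute value.
  Within : Carrier → Carrier → Set
  Within ε x = - ε ≤ x × x ≤ ε

  within-resp : ∀ {ε δ x y} → ε ≈ δ → x ≈ y → Within ε x → Within δ y
  within-resp ε≈δ x≈y (-ε≤x , x≤ε) =
    ≤-respˡ-≈ (-‿cong ε≈δ) (≤-respʳ-≈ x≈y -ε≤x) , ≤-respˡ-≈ x≈y (≤-respʳ-≈ ε≈δ x≤ε)

  within-mono : ∀ {ε δ x} → ε ≤ δ → Within ε x → Within δ x
  within-mono {ε} {δ} ε≤δ (-ε≤x , x≤ε) =
    ≤-trans (≤-by-difference (solve 2 (λ ε δ → :- ε :- :- δ := δ :- ε) refl ε δ) (x≤y⇒0≤y-x ε≤δ)) -ε≤x ,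
    ≤-trans x≤ε ε≤δ

  within-neg : ∀ {ε x} → Within ε x → Within ε (- x)
  within-neg {ε} {x} (-ε≤x , x≤ε) =
    ≤-by-difference (solve 2 (λ ε x → :- x :- :- ε := ε :- x) refl ε x) (x≤y⇒0≤y-x x≤ε) ,
    ≤-by-difference (solve 2 (λ ε x → ε :- :- x := x :- :- ε) refl ε x) (x≤y⇒0≤y-x -ε≤x)

  within-+ : ∀ {ε δ x y} → Within ε x → Within δ y → Within (ε + δ) (x + y)
  within-+ {ε} {δ} (-ε≤x , x≤ε) (-δ≤y , y≤δ) =
    ≤-respˡ-≈ (solve 2 (λ ε δ → :- ε :+ :- δ := :- (ε :+ δ)) refl ε δ) (+-mono-≤ -ε≤x -δ≤y) ,
    +-mono-≤ x≤ε y≤δ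

  -- 2 (ε δ - x y) = (ε - x) (δ + y) + (ε + x) (δ - y), and likewise for x y + ε δ.
  within-* : ∀ {ε δ x y} → Within ε x → Within δ y → Within (ε * δ) (x * y)
  within-* {ε} {δ} {x} {y} (-ε≤x , x≤ε) (-δ≤y , y≤δ) =
    *-cancelˡ-≤ (fromℤ-positive 1) (≤-by-difference
      (solve 4 (λ ε δ x y → con (+ 2) :* (x :* y) :- con (+ 2) :* :- (ε :* δ) :=
        (ε :- x) :* (δ :- y) :+ (x :- :- ε) :* (y :- :- δ)) refl ε δ x y)
      (+-nonNegative (*-nonNegative 0≤ε-x 0≤δ-y) (*-nonNegative 0≤ε+x 0≤δ+y))) ,
    *-cancelˡ-≤ (fromℤ-positive 1) (≤-by-difference
      (solve 4 (λ ε δ x y → con (+ 2) :* (ε :* δ) :- con (+ 2) :* (x :* y) :=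
        (ε :- x) :* (y :- :- δ) :+ (x :- :- ε) :* (δ :- y)) refl ε δ x y)
      (+-nonNegative (*-nonNegative 0≤ε-x 0≤δ+y) (*-nonNegative 0≤ε+x 0≤δ-y)))
    where
    0≤ε-x = x≤y⇒0≤y-x x≤ε
    0≤ε+x = x≤y⇒0≤y-x -ε≤x
    0≤δ-y = x≤y⇒0≤y-x y≤δ
    0≤δ+y = x≤y⇒0≤y-x -δ≤y

  within-zero : ∀ {ε} → 0# ≤ ε → Within ε 0#
  within-zero {ε} 0≤ε =
    ≤-by-difference (solve 1 (λ ε → con (+ 0) :- :- ε := ε) refl ε) 0≤ε , 0≤ε

  within-some : ∀ x → ∃[ M ] 0# ≤ M × Within M x
  within-some x with total 0# x
  ... | inj₁ 0≤x = x , 0≤x , ≤-trans (proj₁ (within-zero 0≤x)) 0≤x , ≤-refl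
  ... | inj₂ x≤0 = - x , 0≤-x ,
    ≤-by-difference (solve 1 (λ x → x :- :- :- x := con (+ 0)) refl x) ≤-refl , ≤-trans x≤0 0≤-x
    where
    0≤-x : 0# ≤ - x
    0≤-x = ≤-by-difference (solve 1 (λ x → :- x :- con (+ 0) := con (+ 0) :- x) refl x) (x≤y⇒0≤y-x x≤0)

  ContinuousAt : (Carrier → Carrier) → Carrier → Set
  ContinuousAt f x = ∀ ε → 0# < ε → ∃[ δ ] 0# < δ × (∀ y → Within δ (y - x) → Within ε (f y - f x))

  -- Choosing η = min (ε / K , 1) absorbs constant factors in the error, and the cap at 1 lets a
  -- product absorb its quadratic term η² into η.
  continuousAt-scaled : ∀ {f x} K → 0# < K →
    (∀ η → 0# < η → η ≤ 1# → ∃[ δ ] 0# < δ × (∀ y → Within δ (y - x) → Within (K * η) (f y - f x))) →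
    ContinuousAt f x
  continuousAt-scaled {f} {x} K 0<K bound ε 0<ε =
    let δ , 0<δ , near = bound η (⊓-positive (/-positive 0<ε 0<K) 0<1) (x⊓y≤y _ _)
    in δ , 0<δ , λ y y~x → within-mono Kη≤ε (near y y~x)
    where
    η = (ε / K) ⊓ 1#
    Kη≤ε : K * η ≤ ε
    Kη≤ε = ≤-trans (*-monoˡ-≤ (<⇒≤ 0<K) (x⊓y≤x _ _))
      (≤-reflexive (trans (*-comm K _) (/-cancelʳ ε 0<K)))

  continuousAt-const : ∀ {c x} → ContinuousAt (const c) x
  continuousAt-const {c} ε 0<ε = 1# , 0<1 , λ _ _ →
    within-resp refl (sym (-‿inverseʳ c)) (within-zero (<⇒≤ 0<ε))

  continuousAt-id : ∀ {x} → ContinuousAt id x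
  continuousAt-id ε 0<ε = ε , 0<ε , λ _ → id

  continuousAt-neg : ∀ {f x} → ContinuousAt f x → ContinuousAt (λ y → - f y) x
  continuousAt-neg {f} {x} cf ε 0<ε =
    let δ , 0<δ , near = cf ε 0<ε
    in δ , 0<δ , λ y y~x → within-resp refl
      (solve 2 (λ u v → :- (u :- v) := :- u :- :- v) refl (f y) (f x)) (within-neg (near y y~x))

  continuousAt-both : ∀ {f g x} → ContinuousAt f x → ContinuousAt g x → ∀ η → 0# < η →
    ∃[ δ ] 0# < δ × (∀ y → Within δ (y - x) → Within η (f y - f x) × Within η (g y - g x))
  continuousAt-both cf cg η 0<η =
    let δ , 0<δ , nearf = cf η 0<η
        δ′ , 0<δ′ , nearg = cg η 0<η
    in δ ⊓ δ′ , ⊓-positive 0<δ 0<δ′ , λ y y~x →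
      nearf y (within-mono (x⊓y≤x _ _) y~x) , nearg y (within-mono (x⊓y≤y _ _) y~x)

  continuousAt-+ : ∀ {f g x} → ContinuousAt f x → ContinuousAt g x → ContinuousAt (λ y → f y + g y) x
  continuousAt-+ {f} {g} {x} cf cg = continuousAt-scaled (fromℤ (+ 2)) (fromℤ-positive 1) λ η 0<η _ →
    let δ , 0<δ , near = continuousAt-both cf cg η 0<η
    in δ , 0<δ , λ y y~x → within-resp
      (solve 1 (λ η → η :+ η := con (+ 2) :* η) refl η)
      (solve 4 (λ a b c d → (a :- b) :+ (c :- d) := (a :+ c) :- (b :+ d)) refl (f y) (f x) (g y) (g x))
      (within-+ (proj₁ (near y y~x)) (proj₂ (near y y~x)))

  -- f g - f₀ g₀ = (f - f₀) (g - g₀) + f₀ (g - g₀) + g₀ (f - f₀)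
  continuousAt-* : ∀ {f g x} → ContinuousAt f x → ContinuousAt g x → ContinuousAt (λ y → f y * g y) x
  continuousAt-* {f} {g} {x} cf cg =
    let M , 0≤M , f~M = within-some (f x)
        N , 0≤N , g~N = within-some (g x)
    in continuousAt-scaled (1# + M + N)
      (+-pos-nonNegative (+-pos-nonNegative 0<1 0≤M) 0≤N) λ η 0<η η≤1 →
    let δ , 0<δ , near = continuousAt-both cf cg η 0<η
    in δ , 0<δ , λ y y~x →
    let f~ , g~ = near y y~x
    in within-mono
      (≤-by-difference
        (solve 3 (λ η M N → (con (+ 1) :+ M :+ N) :* η :- (η :* η :+ M :* η :+ N :* η) :=
          η :* (con (+ 1) :- η)) refl η M N)
        (*-nonNegative (<⇒≤ 0<η) (x≤y⇒0≤y-x η≤1)))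
      (within-resp refl
        (solve 4 (λ a b c d → (a :- b) :* (c :- d) :+ b :* (c :- d) :+ d :* (a :- b) := a :* c :- b :* d)
          refl (f y) (f x) (g y) (g x))
        (within-+ (within-+ (within-* f~ g~) (within-* f~M g~)) (within-* g~N f~)))

  continuousAt-^ : ∀ {f x} → ContinuousAt f x → ∀ n → ContinuousAt (λ y → f y ^ n) x
  continuousAt-^ cf zero    = continuousAt-const
  continuousAt-^ cf (suc n) = continuousAt-* cf (continuousAt-^ cf n)

  -- Once g ≥ g₀ / 2, the difference (g₀ - g) / (g g₀) is at most 2 ∣ g - g₀ ∣ / g₀².
  continuousAt-⁻¹ : ∀ {g x} → 0# < g x → ContinuousAt g x → ContinuousAt (λ y → g y ⁻¹) x
  continuousAt-⁻¹ {g} {x} 0<g cg = continuousAt-scaled K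
      (*-positive (fromℤ-positive 1) (*-positive 0<i 0<i)) λ η 0<η _ →
    let h = g₀ / fromℤ (+ 2)
        δ , 0<δ , near = cg (η ⊓ h) (⊓-positive 0<η (/-positive 0<g (fromℤ-positive 1)))
    in δ , 0<δ , λ y y~x →
    let g~ = within-mono (x⊓y≤x η h) (near y y~x)
        h≤g : h ≤ g y
        h≤g = begin
          h                     ≈⟨ solve 1 (λ h → h := con (+ 2) :* h :- h) refl h ⟩
          fromℤ (+ 2) * h - h   ≈⟨ +-congʳ (trans (*-comm _ _) (/-cancelʳ g₀ (fromℤ-positive 1))) ⟩
          g₀ - h                ≤⟨ +-monoʳ-≤ g₀ (proj₁ (within-mono (x⊓y≤y η h) (near y y~x))) ⟩
          g₀ + (g y - g₀)       ≈⟨ solve 2 (λ a b → a :+ (b :- a) := b) refl g₀ (g y) ⟩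
          g y                   ∎
        0<gy = <-≤-trans (/-positive 0<g (fromℤ-positive 1)) h≤g
        j≤ : g y ⁻¹ ≤ fromℤ (+ 2) * i
        j≤ = *-cancelʳ-≤ 0<gy (begin
          g y ⁻¹ * g y                   ≈⟨ ⁻¹-inverseˡ 0<gy ⟩
          1#                             ≈⟨ ⁻¹-inverseˡ 0<g ⟨
          i * g₀                         ≈⟨ *-congˡ (/-cancelʳ g₀ (fromℤ-positive 1)) ⟨
          i * (h * fromℤ (+ 2))          ≈⟨ solve 2 (λ i h → i :* (h :* con (+ 2)) := con (+ 2) :* i :* h) refl i h ⟩
          fromℤ (+ 2) * i * h            ≤⟨ *-monoˡ-≤ (<⇒≤ (*-positive (fromℤ-positive 1) 0<i)) h≤g ⟩
          fromℤ (+ 2) * i * g y          ∎)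
        ij~ : Within (i * (fromℤ (+ 2) * i)) (i * g y ⁻¹)
        ij~ = ≤-trans (proj₁ (within-zero (<⇒≤ (*-positive 0<i (*-positive (fromℤ-positive 1) 0<i)))))
                (<⇒≤ (*-positive 0<i (⁻¹-positive 0<gy))) ,
              *-monoˡ-≤ (<⇒≤ 0<i) j≤
    in within-resp
      (solve 2 (λ i η → i :* (con (+ 2) :* i) :* η := con (+ 2) :* (i :* i) :* η) refl i η)
      (difference 0<gy)
      (within-* ij~ (within-neg g~))
    where
    g₀ = g x
    i = g₀ ⁻¹
    0<i = ⁻¹-positive 0<g
    K = fromℤ (+ 2) * (i * i)
    difference : ∀ {u} → 0# < u → i * u ⁻¹ * - (u - g₀) ≈ u ⁻¹ - i
    difference {u} 0<u = begin-equality
      i * u ⁻¹ * - (u - g₀)                     ≈⟨ solve 4 (λ i j u v → i :* j :* :- (u :- v) :=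
                                                       (i :* v) :* j :- (j :* u) :* i) refl i (u ⁻¹) u g₀ ⟩
      (i * g₀) * u ⁻¹ - (u ⁻¹ * u) * i          ≈⟨ +-cong (*-congʳ (⁻¹-inverseˡ 0<g)) (-‿cong (*-congʳ (⁻¹-inverseˡ 0<u))) ⟩
      1# * u ⁻¹ - 1# * i                        ≈⟨ +-cong (*-identityˡ _) (-‿cong (*-identityˡ _)) ⟩
      u ⁻¹ - i                                  ∎
      where open ≤-Reasoning
    open ≤-Reasoning

  -- Both halves use only that `⊓` is a greatest lower bound: a minimum lowered by ε stays below
  -- each argument after that argument has moved by at most ε.
  continuousAt-⊓ : ∀ {f g x} → ContinuousAt f x → ContinuousAt g x → ContinuousAt (λ y → f y ⊓ g y) x
  continuousAt-⊓ {f} {g} {x} cf cg ε 0<ε =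
    let δ , 0<δ , near = continuousAt-both cf cg ε 0<ε
    in δ , 0<δ , λ y y~x →
    let (-ε≤f , f≤ε) , (-ε≤g , g≤ε) = near y y~x
    in ≤-by-difference (solve 3 (λ ε a b → (a :- b) :- :- ε := a :- (b :- ε)) refl ε _ _)
         (x≤y⇒0≤y-x (⊓-glb (lower (f y) (f x) (g x) (x⊓y≤x _ _) -ε≤f) (lower (g y) (g x) (f x) (x⊓y≤y _ _) -ε≤g))) ,
       upper (f y) (f x) (g y) (g x) f≤ε g≤ε
    where
    lower : ∀ a b c {m} → m ≤ b → - ε ≤ a - b → m - ε ≤ a
    lower a b _ {m} m≤b -ε≤a-b = ≤-by-difference
      (solve 4 (λ ε a b m → a :- (m :- ε) := (b :- m) :+ ((a :- b) :- :- ε)) refl ε a b m)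
      (+-nonNegative (x≤y⇒0≤y-x m≤b) (x≤y⇒0≤y-x -ε≤a-b))
    above : ∀ {m a b} → m ≤ a → a - b ≤ ε → m - ε ≤ b
    above {m} {a} {b} m≤a a-b≤ε = ≤-by-difference
      (solve 4 (λ ε a b m → b :- (m :- ε) := (a :- m) :+ (ε :- (a :- b))) refl ε a b m)
      (+-nonNegative (x≤y⇒0≤y-x m≤a) (x≤y⇒0≤y-x a-b≤ε))
    upper : ∀ a b c d → a - b ≤ ε → c - d ≤ ε → a ⊓ c - b ⊓ d ≤ ε
    upper a b c d a-b≤ε c-d≤ε = ≤-by-difference
      (solve 3 (λ ε m n → ε :- (m :- n) := n :- (m :- ε)) refl ε (a ⊓ c) (b ⊓ d))
      (x≤y⇒0≤y-x (⊓-glb (above (x⊓y≤x _ _) a-b≤ε) (above (x⊓y≤y _ _) c-d≤ε)))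

-- The extreme value theorem for semicontinuous functions.

module ExtremeValue (em : ExcludedMiddle 0ℓ) (ℝ : RealField) where

  open Order ℝ
  open Continuity ℝ

  -- One notion serves both functions that must attain a minimum: `H α`, which is continuous, and
  -- the negative of `cdet`, for which semicontinuity is what an infimum of continuous functions
  -- gives directly. Restricting y to [a , b] keeps `cdet` where its value is meaningful.
  LowerSemicontinuousOn : (Carrier → Carrier) → Carrier → Carrier → Set
  LowerSemicontinuousOn f a b = ∀ x → a ≤ x → x ≤ b → ∀ v → v < f x →
    ∃[ δ ] 0# < δ × (∀ y → a ≤ y → y ≤ b → Within δ (y - x) → v ≤ f y)

  continuous⇒lowerSemicontinuous : ∀ {f : Carrier → Carrier} {a b} → (∀ x → a ≤ x → x ≤ b → ContinuousAt f x) →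
    LowerSemicontinuousOn f a b
  continuous⇒lowerSemicontinuous {f} cf x a≤x x≤b v v<fx =
    let δ , 0<δ , near = cf x a≤x x≤b (f x - v) (x<y⇒0<y-x v<fx)
    in δ , 0<δ , λ y _ _ y~x → ≤-by-difference
      (solve 3 (λ v fx fy → fy :- v := fy :- fx :- :- (fx :- v)) refl v (f x) (f y))
      (x≤y⇒0≤y-x (proj₁ (near y y~x)))

  x<x+δ : ∀ x {δ} → 0# < δ → x < x + δ
  x<x+δ x {δ} = <-by-difference (solve 2 (λ x δ → x :+ δ :- x := δ) refl x δ)

  x-δ<x : ∀ x {δ} → 0# < δ → x - δ < x
  x-δ<x x {δ} = <-by-difference (solve 2 (λ x δ → x :- (x :- δ) := δ) refl x δ)

  within-between : ∀ {x s δ} → s - δ ≤ x → x ≤ s + δ → Within δ (x - s)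
  within-between {x} {s} {δ} s-δ≤x x≤s+δ =
    ≤-by-difference (solve 3 (λ x s δ → x :- s :- :- δ := x :- (s :- δ)) refl x s δ) (x≤y⇒0≤y-x s-δ≤x) ,
    ≤-by-difference (solve 3 (λ x s δ → δ :- (x :- s) := (s :+ δ) :- x) refl x s δ) (x≤y⇒0≤y-x x≤s+δ)

  halve : ∀ {x} → 0# < x → ∃[ h ] 0# < h × h + h ≈ x
  halve {x} 0<x = x / fromℤ (+ 2) , /-positive 0<x (fromℤ-positive 1) ,
    trans (solve 1 (λ h → h :+ h := h :* con (+ 2)) refl _) (/-cancelʳ x (fromℤ-positive 1))

  dense : ∀ {x y} → x < y → ∃[ z ] x < z × z < y
  dense {x} {y} x<y =
    let h , 0<h , h+h≈y-x = halve (x<y⇒0<y-x x<y)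
    in x + h , <-by-difference (solve 2 (λ x h → x :+ h :- x := h) refl x h) 0<h ,
      <-by-difference (begin
        y - (x + h)       ≈⟨ solve 3 (λ x y h → y :- (x :+ h) := (y :- x) :- h) refl x y h ⟩
        (y - x) - h       ≈⟨ +-congʳ h+h≈y-x ⟨
        (h + h) - h       ≈⟨ solve 1 (λ h → h :+ h :- h := h) refl h ⟩
        h                 ∎) 0<h
    where open SetoidReasoning setoid

  -- Compactness of [a , b], by the supremum of the points up to which a bound exists.
  local⇒global-bound : ∀ {f : Carrier → Carrier} {a b} (G : Carrier → Set) → (∀ {u v} → G u → G v → G (u ⊓ v)) → a ≤ b →
    (∀ x → a ≤ x → x ≤ b → ∃[ v ] G v × ∃[ δ ] 0# < δ ×
      (∀ y → a ≤ y → y ≤ b → Within δ (y - x) → v ≤ f y)) →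
    ∃[ v ] G v × (∀ x → a ≤ x → x ≤ b → v ≤ f x)
  local⇒global-bound {f} {a} {b} G G-⊓ a≤b local =
    let s , s-sup = complete P (a , Pa) (b , λ _ Px → proj₁ (proj₂ Px)) in extend s s-sup
    where
    P : Carrier → Set
    P z = a ≤ z × z ≤ b × ∃[ v ] G v × (∀ x → a ≤ x → x ≤ z → v ≤ f x)

    Pa : P a
    Pa with local a ≤-refl a≤b
    ... | v , Gv , δ , 0<δ , near =
      ≤-refl , a≤b , v , Gv , λ x a≤x x≤a → near x a≤x (≤-trans x≤a a≤b)
        (within-resp refl (sym (trans (+-congʳ (≤-antisym x≤a a≤x)) (-‿inverseʳ a))) (within-zero (<⇒≤ 0<δ)))

    -- Without a member of P above s - δ, that number would be an upper bound smaller than s.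
    close : ∀ s δ → IsSupremum P s → 0# < δ → ∃[ z ] P z × s - δ ≤ z
    close s δ (_ , s-least) 0<δ with em {∃[ z ] P z × s - δ ≤ z}
    ... | yes found = found
    ... | no none = contradiction
      (s-least (s - δ) λ z Pz → [ id , (λ s-δ≤z → contradiction (z , Pz , s-δ≤z) none) ]′ (total z (s - δ)))
      (<⇒≱ (x-δ<x s 0<δ))

    extend : ∀ s → IsSupremum P s → ∃[ v ] G v × (∀ x → a ≤ x → x ≤ b → v ≤ f x)
    extend s s-sup@(s-upper , s-least) with local s (s-upper a Pa) (s-least b (λ _ Px → proj₁ (proj₂ Px)))
    ... | v , Gv , δ , 0<δ , near with close s δ s-sup 0<δ
    ... | z , (a≤z , z≤b , v′ , Gv′ , bound-z) , s-δ≤z =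
      v ⊓ v′ , G-⊓ Gv Gv′ , λ x a≤x x≤b → bound-w x a≤x (≤-trans x≤b b≤w)
      where
      w = (s + δ) ⊓ b

      bound-w : ∀ x → a ≤ x → x ≤ w → v ⊓ v′ ≤ f x
      bound-w x a≤x x≤w with total x z
      ... | inj₁ x≤z = ≤-trans (x⊓y≤y v v′) (bound-z x a≤x x≤z)
      ... | inj₂ z≤x = ≤-trans (x⊓y≤x v v′) (near x a≤x (≤-trans x≤w (x⊓y≤y _ b))
        (within-between (≤-trans s-δ≤z z≤x) (≤-trans x≤w (x⊓y≤x _ b))))

      a≤w : a ≤ w
      a≤w = ⊓-glb (≤-trans (s-upper a Pa) (<⇒≤ (x<x+δ s 0<δ))) a≤b

      -- The bound reaches w = min (s + δ , b), so w belongs to P and cannot exceed s. This excludes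
      -- w = s + δ, and hence w = b.
      w≤s : w ≤ s
      w≤s = s-upper w (a≤w , x⊓y≤y _ b , v ⊓ v′ , G-⊓ Gv Gv′ , bound-w)

      b≤w : b ≤ w
      b≤w with ⊓-sel (s + δ) b
      ... | inj₁ w≈s+δ = contradiction (≤-respˡ-≈ w≈s+δ w≤s) (<⇒≱ (x<x+δ s 0<δ))
      ... | inj₂ w≈b = ≤-reflexive (sym w≈b)

  -- The infimum s of the values is the supremum of their lower bounds. If it were not attained, a
  -- number strictly between s and f x would bound f from below near each x, and compactness would
  -- give a lower bound above s.
  attains-minimum : ∀ {f : Carrier → Carrier} {a b} → a ≤ b → LowerSemicontinuousOn f a b →
    ∃[ x ] a ≤ x × x ≤ b × (∀ y → a ≤ y → y ≤ b → f x ≤ f y)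
  attains-minimum {f} {a} {b} a≤b lsc =
    let s , s-sup = complete Lower bounded (f a , λ v v≤f → v≤f a ≤-refl a≤b) in attained s s-sup
    where
    Lower : Carrier → Set
    Lower v = ∀ x → a ≤ x → x ≤ b → v ≤ f x

    bounded : ∃ Lower
    bounded =
      -- A trivial `G` yields mere boundedness; the second use, with `G` the numbers above s, keeps
      -- the bound strict.
      let v , _ , v≤f = local⇒global-bound {f} (λ _ → ⊤) (λ _ _ → tt) a≤b λ x a≤x x≤b →
            f x - 1# , tt , lsc x a≤x x≤b (f x - 1#) (x-δ<x (f x) 0<1)
      in v , v≤f

    attained : ∀ s → IsSupremum Lower s → ∃[ x ] a ≤ x × x ≤ b × (∀ y → a ≤ y → y ≤ b → f x ≤ f y)
    attained s (s-upper , s-least) with em {∃[ x ] a ≤ x × x ≤ b × f x ≤ s}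
    ... | yes (x , a≤x , x≤b , fx≤s) = x , a≤x , x≤b , λ y a≤y y≤b →
      ≤-trans fx≤s (s-least (f y) λ v v≤f → v≤f y a≤y y≤b)
    ... | no none =
      let v , s<v , v≤f = local⇒global-bound {f} (s <_) min-above a≤b above
      in contradiction (s-upper v v≤f) (<⇒≱ s<v)
      where
      min-above : ∀ {u v} → s < u → s < v → s < u ⊓ v
      min-above {u} {v} s<u s<v =
        [ (λ eq → <-respʳ-≈ (sym eq) s<u) , (λ eq → <-respʳ-≈ (sym eq) s<v) ]′ (⊓-sel u v)
      above : ∀ x → a ≤ x → x ≤ b → ∃[ v ] s < v × ∃[ δ ] 0# < δ ×
        (∀ y → a ≤ y → y ≤ b → Within δ (y - x) → v ≤ f y)
      above x a≤x x≤b =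
        let v , s<v , v<fx = dense (≰⇒> λ fx≤s → none (x , a≤x , x≤b , fx≤s))
        in v , s<v , lsc x a≤x x≤b v v<fx

-- Existence of c_det and its dependence on α.

module CompetitiveRatio (em : ExcludedMiddle 0ℓ) (ℝ : RealField) where

  open Order ℝ
  open Continuity ℝ
  open ExtremeValue em ℝ
  open OnlineAllocation ℝ using (H; IsCdet)
  open Min totalOrder using (⊓-cong)

  1≤θ⇒0<θ : ∀ {θ} → 1# ≤ θ → 0# < θ
  1≤θ⇒0<θ = <-≤-trans 0<1

  1<α⇒0<α : ∀ {α} → 1# < α → 0# < α
  1<α⇒0<α = <-trans 0<1

  H-denominator-positive : ∀ {α θ} → 0# < α → 0# < θ → 0# < (1# + α) ^ 2 * θ ^ 2
  H-denominator-positive 0<α 0<θ = *-positive (^2-positive (+-positive 0<1 0<α)) (^2-positive 0<θ)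

  H-congʳ : ∀ α {θ θ′} → θ ≈ θ′ → H α θ ≈ H α θ′
  H-congʳ α θ≈θ′ = +-cong
    (*-cong (^-congˡ 2 (+-congʳ θ≈θ′)) (⊓-cong refl (*-congˡ (⁻¹-cong (^-congˡ 2 θ≈θ′)))))
    (*-cong (+-congˡ (-‿cong (^-congˡ 2 (+-congʳ θ≈θ′)))) (⁻¹-cong (*-congˡ (^-congˡ 2 θ≈θ′))))

  -- Both arguments may move: θ varies at fixed α for the existence of the minimum, and both vary
  -- along the line θ = 1 + t α for the dependence on α.
  H-continuous : ∀ {f g x} → ContinuousAt f x → ContinuousAt g x → 0# < f x → 0# < g x →
    ContinuousAt (λ y → H (f y) (g y)) x
  H-continuous {f} {g} {x} cf cg 0<f 0<g = continuousAt-+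
    (continuousAt-* c[θ-1]²
      (continuousAt-⊓ (c[1/f²] cf 0<f) (c[1/f²] cg 0<g)))
    (continuousAt-* (continuousAt-+ (continuousAt-^ cf 2) (continuousAt-neg c[θ-1]²))
      (continuousAt-⁻¹ (H-denominator-positive 0<f 0<g)
        (continuousAt-* (continuousAt-^ (continuousAt-+ continuousAt-const cf) 2) (continuousAt-^ cg 2))))
    where
    c[θ-1]² : ContinuousAt (λ y → (g y - 1#) ^ 2) x
    c[θ-1]² = continuousAt-^ (continuousAt-+ cg continuousAt-const) 2
    c[1/f²] : ∀ {f} → ContinuousAt f x → 0# < f x → ContinuousAt (λ y → 1# / f y ^ 2) x
    c[1/f²] cf 0<f = continuousAt-* continuousAt-const (continuousAt-⁻¹ (^2-positive 0<f) (continuousAt-^ cf 2))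

  1≤1+α : ∀ {α} → 1# < α → 1# ≤ 1# + α
  1≤1+α {α} 1<α = ≤-by-difference (solve 1 (λ α → con (+ 1) :+ α :- con (+ 1) := α) refl α) (<⇒≤ (1<α⇒0<α 1<α))

  cdet-exists : ∀ {α} → 1# < α → ∃[ c ] IsCdet α c
  cdet-exists {α} 1<α =
    let θ , 1≤θ , θ≤1+α , minimal = attains-minimum (1≤1+α 1<α) (continuous⇒lowerSemicontinuous λ θ 1≤θ _ →
          H-continuous continuousAt-const continuousAt-id (1<α⇒0<α 1<α) (1≤θ⇒0<θ 1≤θ))
    in H α θ , (θ , 1≤θ , θ≤1+α , refl) , minimal

  cdet-unique : ∀ {α c c′} → IsCdet α c → IsCdet α c′ → c ≤ c′
  cdet-unique (_ , c-min) ((θ , 1≤θ , θ≤1+α , c′≈H) , _) = ≤-respʳ-≈ (sym c′≈H) (c-min θ 1≤θ θ≤1+α)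

  -- Deciding `1# < α` makes this a total function of α, independent of any particular proof of that
  -- inequality; the value 0 elsewhere is a placeholder.
  cdet : Carrier → Carrier
  cdet α with em {1# < α}
  ... | yes 1<α = proj₁ (cdet-exists 1<α)
  ... | no  _   = 0#

  cdet-isCdet : ∀ {α} → 1# < α → IsCdet α (cdet α)
  cdet-isCdet {α} 1<α with em {1# < α}
  ... | yes 1<α′ = proj₂ (cdet-exists 1<α′)
  ... | no  1≮α  = contradiction 1<α 1≮α

  private
    shifted-bound : ∀ v h h′ c → c ≈ h′ → h - h′ ≤ - v - c → h ≤ - v
    shifted-bound v h h′ c c≈h′ h-h′≤-v-c = begin
      h                      ≈⟨ solve 2 (λ h h′ → h := (h :- h′) :+ h′) refl h h′ ⟩
      (h - h′) + h′          ≤⟨ +-mono-≤ h-h′≤-v-c (≤-reflexive (sym c≈h′)) ⟩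
      (- v - c) + c          ≈⟨ solve 2 (λ v c → :- v :- c :+ c := :- v) refl v c ⟩
      - v                    ∎
      where open ≤-Reasoning

  -- The substitution θ = 1 + t α makes the range 0 ≤ t ≤ 1 independent of α, so that cdet is
  -- an infimum of continuous functions of α.
  cdet-upperSemicontinuous : ∀ {a b} → 1# < a → LowerSemicontinuousOn (λ α → - cdet α) a b
  cdet-upperSemicontinuous {a} {b} 1<a α a≤α _ v v<-c with cdet-isCdet (<-≤-trans 1<a a≤α)
  ... | (θ , 1≤θ , θ≤1+α , c≈H) , _ =
    let δ , 0<δ , near = H-continuous {id} {λ β → 1# + t * β} {α} continuousAt-id
          (continuousAt-+ continuousAt-const (continuousAt-* continuousAt-const continuousAt-id))
          0<α (<-respʳ-≈ (sym 1+tα≈θ) (1≤θ⇒0<θ 1≤θ)) (- v - cdet α) 0<-v-c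
    in δ , 0<δ , λ β a≤β _ β~α →
    let 1<β = <-≤-trans 1<a a≤β
        0≤β = <⇒≤ (1<α⇒0<α 1<β)
        H≤-v : H β (1# + t * β) ≤ - v
        H≤-v = shifted-bound v (H β (1# + t * β)) (H α (1# + t * α)) (cdet α)
          (trans c≈H (H-congʳ α (sym 1+tα≈θ))) (proj₂ (near β β~α))
        c≤-v : cdet β ≤ - v
        c≤-v = ≤-trans (proj₂ (cdet-isCdet 1<β) (1# + t * β)
          (≤-by-difference (solve 1 (λ u → con (+ 1) :+ u :- con (+ 1) := u) refl (t * β)) (*-nonNegative 0≤t 0≤β))
          (+-monoʳ-≤ 1# (≤-respʳ-≈ (*-identityˡ β) (*-monoʳ-≤ 0≤β t≤1)))) H≤-v
    in ≤-by-difference (solve 2 (λ c v → :- c :- v := :- v :- c) refl (cdet β) v) (x≤y⇒0≤y-x c≤-v)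
    where
    0<α = 1<α⇒0<α (<-≤-trans 1<a a≤α)
    -- The minimiser for α in the rescaled coordinate. Frozen while α moves to β, it gives a point
    -- admissible for β, whose value bounds `cdet β` from above.
    t = (θ - 1#) / α
    1+tα≈θ : 1# + t * α ≈ θ
    1+tα≈θ = trans (+-congˡ (/-cancelʳ (θ - 1#) 0<α)) (solve 1 (λ θ → con (+ 1) :+ (θ :- con (+ 1)) := θ) refl θ)
    0≤t : 0# ≤ t
    0≤t = *-nonNegative (x≤y⇒0≤y-x 1≤θ) (<⇒≤ (⁻¹-positive 0<α))
    t≤1 : t ≤ 1#
    t≤1 = *-cancelʳ-≤ 0<α (≤-respˡ-≈ (sym (/-cancelʳ (θ - 1#) 0<α)) (≤-by-difference
      (solve 2 (λ α θ → con (+ 1) :* α :- (θ :- con (+ 1)) := con (+ 1) :+ α :- θ) refl α θ) (x≤y⇒0≤y-x θ≤1+α)))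
    0<-v-c : 0# < - v - cdet α
    0<-v-c = <-respʳ-≈ (solve 2 (λ c v → :- c :- v := :- v :- c) refl (cdet α) v) (x<y⇒0<y-x v<-c)

  cdet-attains-maximum : ∀ {a b} → 1# < a → a ≤ b →
    ∃[ α ] a ≤ α × α ≤ b × (∀ β → a ≤ β → β ≤ b → cdet β ≤ cdet α)
  cdet-attains-maximum 1<a a≤b =
    let α , a≤α , α≤b , minimal = attains-minimum a≤b (cdet-upperSemicontinuous 1<a)
    in α , a≤α , α≤b , λ β a≤β β≤b → ≤-by-difference
      (solve 2 (λ x y → x :- y := :- y :- :- x) refl (cdet α) (cdet β)) (x≤y⇒0≤y-x (minimal β a≤β β≤b))

-- Reducing bounds on `H` to signs of polynomials.

module Certificates (ℝ : RealField) where

  open Order ℝ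
  open OnlineAllocation ℝ using (H)

  -- A fraction in cleared form, with numerator and denominator exposed to the solver while x keeps
  -- its original expression, be it a decimal, a difference of decimals or a quotient affine in α.
  record Ratio (x a n : Carrier) : Set where
    constructor ratio
    field
      denominator-positive : 0# < n
      cleared              : n * x ≈ a

  ratio-/ : ∀ a {n} → 0# < n → Ratio (a / n) a n
  ratio-/ a 0<n = ratio 0<n (trans (*-comm _ _) (/-cancelʳ a 0<n))

  ratio-1 : ∀ {x} → Ratio x x 1#
  ratio-1 = ratio 0<1 (*-identityˡ _)

  ratio-cross-≤ : ∀ {x y a n b m} → Ratio x a n → Ratio y b m → a * m ≤ b * n → x ≤ y
  ratio-cross-≤ {x} {y} {a} {n} {b} {m} (ratio 0<n nx≈a) (ratio 0<m my≈b) am≤bn =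
    *-cancelˡ-≤ (*-positive 0<n 0<m) (begin
      n * m * x     ≈⟨ solve 3 (λ n m x → n :* m :* x := n :* x :* m) refl n m x ⟩
      n * x * m     ≈⟨ *-congʳ nx≈a ⟩
      a * m         ≤⟨ am≤bn ⟩
      b * n         ≈⟨ *-congʳ my≈b ⟨
      m * y * n     ≈⟨ solve 3 (λ n m y → m :* y :* n := n :* m :* y) refl n m y ⟩
      n * m * y     ∎)
    where open ≤-Reasoning

  -- Natural coefficients make nonnegativity for u ≥ 0 automatic, so a certificate amounts to
  -- rewriting a polynomial in this form with u the distance to an end of the range. `hornerᴾ`
  -- evaluates to it by definition.
  horner : List ℕ → Carrier → Carrier
  horner []       u = 0#
  horner (c ∷ cs) u = fromℤ (+ c) + u * horner cs u

  hornerᴾ : ∀ {n} → List ℕ → Polynomial n → Polynomial n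
  hornerᴾ []       u = con (+ 0)
  hornerᴾ (c ∷ cs) u = con (+ c) :+ u :* hornerᴾ cs u

  horner-nonNegative : ∀ cs {u} → 0# ≤ u → 0# ≤ horner cs u
  horner-nonNegative []       0≤u = ≤-refl
  horner-nonNegative (c ∷ cs) 0≤u = +-nonNegative (fromℤ-nonNegative c) (*-nonNegative 0≤u (horner-nonNegative cs 0≤u))

  horner-positive : ∀ c cs {u} → 0# ≤ u → 0# < horner (suc c ∷ cs) u
  horner-positive c cs 0≤u = +-pos-nonNegative (fromℤ-positive c) (*-nonNegative 0≤u (horner-nonNegative cs 0≤u))

  -- H with the minimum replaced by 1 / α², its value for θ ≤ α.
  H₁ : Carrier → Carrier → Carrier
  H₁ α θ = (θ - 1#) ^ 2 * (1# / α ^ 2) + (α ^ 2 - (θ - 1#) ^ 2) / ((1# + α) ^ 2 * θ ^ 2)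

  -- H with the minimum replaced by 1 / θ², its value for θ ≥ α.
  H₂ : Carrier → Carrier → Carrier
  H₂ α θ = (θ - 1#) ^ 2 * (1# / θ ^ 2) + (α ^ 2 - (θ - 1#) ^ 2) / ((1# + α) ^ 2 * θ ^ 2)

  1/^2-antitone : ∀ {x y} → 0# < x → x ≤ y → 1# / y ^ 2 ≤ 1# / x ^ 2
  1/^2-antitone 0<x x≤y = *-monoˡ-≤ (<⇒≤ 0<1) (⁻¹-antitone (^2-positive 0<x) (^2-mono-≤ (<⇒≤ 0<x) x≤y))

  -- Holds on both sides of θ = α, so upper bounds on `H` require no case distinction; only lower
  -- bounds compare θ with α.
  H≤H₁ : ∀ α θ → H α θ ≤ H₁ α θ
  H≤H₁ α θ = +-mono-≤ (*-monoˡ-≤ (^2-nonNegative (θ - 1#)) (x⊓y≤x _ _)) ≤-refl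

  H≈H₁ : ∀ {α θ} → 0# < θ → θ ≤ α → H α θ ≈ H₁ α θ
  H≈H₁ 0<θ θ≤α = +-congʳ (*-congˡ (x≤y⇒x⊓y≈x (1/^2-antitone 0<θ θ≤α)))

  H≈H₂ : ∀ {α θ} → 0# < α → α ≤ θ → H α θ ≈ H₂ α θ
  H≈H₂ 0<α α≤θ = +-congʳ (*-congˡ (x≤y⇒y⊓x≈x (1/^2-antitone 0<α α≤θ)))

  -- (H₁ α θ - v) α² (1 + α)² θ² · z n⁴ k⁴ for α = a / n, θ = t / k and v = w / z.
  gap₁ᴾ : ∀ {m} → (a n t k w z : Polynomial m) → Polynomial m
  gap₁ᴾ a n t k w z =
    z :* ((t :- k) :^ 2 :* (n :^ 2 :* ((n :+ a) :^ 2 :* t :^ 2))) :+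
    z :* (k :^ 2 :* (a :^ 2 :* (k :^ 2 :* a :^ 2 :- n :^ 2 :* (t :- k) :^ 2))) :-
    w :* (a :^ 2 :* ((n :+ a) :^ 2 :* (t :^ 2 :* k :^ 2)))

  gap₁ : (a n t k w z : Carrier) → Carrier
  gap₁ a n t k w z =
    z * ((t - k) ^ 2 * (n ^ 2 * ((n + a) ^ 2 * t ^ 2))) +
    z * (k ^ 2 * (a ^ 2 * (k ^ 2 * a ^ 2 - n ^ 2 * (t - k) ^ 2))) -
    w * (a ^ 2 * ((n + a) ^ 2 * (t ^ 2 * k ^ 2)))

  gap₁-cong : ∀ {a a′ t t′ w w′} n k z → a ≈ a′ → t ≈ t′ → w ≈ w′ → gap₁ a n t k w z ≈ gap₁ a′ n t′ k w′ z
  gap₁-cong n k z a≈ t≈ w≈ = +-cong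
    (+-cong
      (*-congˡ (*-cong [t-k]² (*-congˡ (*-cong [n+a]² (^-congˡ 2 t≈)))))
      (*-congˡ (*-congˡ (*-cong (^-congˡ 2 a≈) (+-cong (*-congˡ (^-congˡ 2 a≈)) (-‿cong (*-congˡ [t-k]²)))))))
    (-‿cong (*-cong w≈ (*-cong (^-congˡ 2 a≈) (*-cong [n+a]² (*-congʳ (^-congˡ 2 t≈))))))
    where
    [t-k]² = ^-congˡ 2 (+-congʳ { - k} t≈)
    [n+a]² = ^-congˡ 2 (+-congˡ {n} a≈)

  -- (H₂ α θ - v) (1 + α)² θ² · z n² for α = a / n and v = w / z.
  gap₂ᴾ : ∀ {m} → (a n θ w z : Polynomial m) → Polynomial m
  gap₂ᴾ a n θ w z = z :* ((θ :- con (+ 1)) :^ 2 :* ((n :+ a) :^ 2 :- n :^ 2)) :+ z :* a :^ 2 :- w :* ((n :+ a) :^ 2 :* θ :^ 2)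

  gap₂ : (a n θ w z : Carrier) → Carrier
  gap₂ a n θ w z = z * ((θ - 1#) ^ 2 * ((n + a) ^ 2 - n ^ 2)) + z * a ^ 2 - w * ((n + a) ^ 2 * θ ^ 2)

  gap₂-cong : ∀ {a a′ w w′} n θ z → a ≈ a′ → w ≈ w′ → gap₂ a n θ w z ≈ gap₂ a′ n θ w′ z
  gap₂-cong n θ z a≈ w≈ = +-cong
    (+-cong (*-congˡ (*-congˡ (+-congʳ [n+a]²))) (*-congˡ (^-congˡ 2 a≈)))
    (-‿cong (*-cong w≈ (*-congʳ [n+a]²)))
    where [n+a]² = ^-congˡ 2 (+-congˡ {n} a≈)

  module _ {α θ : Carrier} (0<α : 0# < α) (0<θ : 0# < θ) where

    private
      A = α ^ 2
      B = θ ^ 2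
      E = (1# + α) ^ 2
      0<A = ^2-positive 0<α
      0<B = ^2-positive 0<θ
      0<EB : 0# < E * B
      0<EB = *-positive (^2-positive (+-positive 0<1 0<α)) 0<B

      -- Clears both denominators at once: s is (1 + α)² θ² and x is the denominator of the first
      -- summand, α² for `H₁` and θ² for `H₂`; y and e are the inverses of x and s.
      clear : ∀ q x y s e → x * y ≈ 1# → s * e ≈ 1# →
        (q * (1# * y) + (A - q) * e) * (x * s) ≈ q * s + (A - q) * x
      clear q x y s e xy≈1 se≈1 = begin
        (q * (1# * y) + (A - q) * e) * (x * s)
          ≈⟨ solve 6 (λ q x y s e A → (q :* (con (+ 1) :* y) :+ (A :- q) :* e) :* (x :* s) :=
               q :* s :* (x :* y) :+ (A :- q) :* x :* (s :* e)) refl q x y s e A ⟩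
        q * s * (x * y) + (A - q) * x * (s * e)
          ≈⟨ +-cong (*-congˡ xy≈1) (*-congˡ se≈1) ⟩
        q * s * 1# + (A - q) * x * 1#
          ≈⟨ +-cong (*-identityʳ _) (*-identityʳ _) ⟩
        q * s + (A - q) * x ∎
        where open SetoidReasoning setoid

      inverse : ∀ {x} → 0# < x → x * x ⁻¹ ≈ 1#
      inverse 0<x = *-inverseʳ (proj₂ 0<x ∘ sym)

    module _ {v a n t k w z : Carrier} (α-ratio : Ratio α a n) (θ-ratio : Ratio θ t k) (v-ratio : Ratio v w z) where

      private
        open Ratio

        -- The cleared gap has degree 4 in each of α and θ; the powers n⁴ and k⁴ make them appear
        -- only through n α and k θ.
        scale : Carrier
        scale = A * (E * B) * (z * (n ^ 2 * n ^ 2 * (k ^ 2 * k ^ 2)))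

        0<scale : 0# < scale
        0<scale = *-positive (*-positive 0<A 0<EB) (*-positive (denominator-positive v-ratio)
          (*-positive (*-positive 0<n² 0<n²) (*-positive 0<k² 0<k²)))
          where
          0<n² = ^2-positive (denominator-positive α-ratio)
          0<k² = ^2-positive (denominator-positive θ-ratio)

        scaled-gap : H₁ α θ * scale - v * scale ≈ gap₁ a n t k w z
        scaled-gap = begin
          H₁ α θ * scale - v * scale
            ≈⟨ +-congʳ (*-assoc _ _ _) ⟨
          H₁ α θ * (A * (E * B)) * (z * (n ^ 2 * n ^ 2 * (k ^ 2 * k ^ 2))) - v * scale
            ≈⟨ +-congʳ (*-congʳ (clear ((θ - 1#) ^ 2) A (A ⁻¹) (E * B) ((E * B) ⁻¹) (inverse 0<A) (inverse 0<EB))) ⟩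
          ((θ - 1#) ^ 2 * (E * B) + (A - (θ - 1#) ^ 2) * A) * (z * (n ^ 2 * n ^ 2 * (k ^ 2 * k ^ 2))) - v * scale
            ≈⟨ solve 6 (λ α θ v n k z →
                 ((θ :- con (+ 1)) :^ 2 :* ((con (+ 1) :+ α) :^ 2 :* θ :^ 2) :+ (α :^ 2 :- (θ :- con (+ 1)) :^ 2) :* α :^ 2)
                   :* (z :* (n :^ 2 :* n :^ 2 :* (k :^ 2 :* k :^ 2)))
                   :- v :* (α :^ 2 :* ((con (+ 1) :+ α) :^ 2 :* θ :^ 2) :* (z :* (n :^ 2 :* n :^ 2 :* (k :^ 2 :* k :^ 2))))
                 := gap₁ᴾ (n :* α) n (k :* θ) k (z :* v) z) refl α θ v n k z ⟩
          gap₁ (n * α) n (k * θ) k (z * v) z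
            ≈⟨ gap₁-cong n k z (cleared α-ratio) (cleared θ-ratio) (cleared v-ratio) ⟩
          gap₁ a n t k w z ∎
          where open SetoidReasoning setoid

        scaled-gap′ : v * scale - H₁ α θ * scale ≈ - gap₁ a n t k w z
        scaled-gap′ = trans (solve 2 (λ x y → x :- y := :- (y :- x)) refl (v * scale) (H₁ α θ * scale)) (-‿cong scaled-gap)

      0≤gap₁⇒≤H : θ ≤ α → 0# ≤ gap₁ a n t k w z → v ≤ H α θ
      0≤gap₁⇒≤H θ≤α 0≤gap = ≤-respʳ-≈ (sym (H≈H₁ 0<θ θ≤α)) (*-cancelʳ-≤ 0<scale (≤-by-difference scaled-gap 0≤gap))

      0≤-gap₁⇒H≤ : 0# ≤ - gap₁ a n t k w z → H α θ ≤ v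
      0≤-gap₁⇒H≤ 0≤-gap = ≤-trans (H≤H₁ α θ) (*-cancelʳ-≤ 0<scale (≤-by-difference scaled-gap′ 0≤-gap))

      0<-gap₁⇒H< : 0# < - gap₁ a n t k w z → H α θ < v
      0<-gap₁⇒H< 0<-gap = ≤-<-trans (H≤H₁ α θ) (*-cancelʳ-< (<⇒≤ 0<scale) (<-by-difference scaled-gap′ 0<-gap))

    module _ {v a n w z : Carrier} (α-ratio : Ratio α a n) (v-ratio : Ratio v w z) where

      private
        open Ratio

        scale : Carrier
        scale = B * (E * B) * (z * n ^ 2)

        0<scale : 0# < scale
        0<scale = *-positive (*-positive 0<B 0<EB) (*-positive (denominator-positive v-ratio)
          (^2-positive (denominator-positive α-ratio)))

        -- For `H₂` the two denominators share θ², so clearing both leaves the common factor `B` in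
        -- front of the gap.
        scaled-gap : H₂ α θ * scale - v * scale ≈ B * gap₂ a n θ w z
        scaled-gap = begin
          H₂ α θ * scale - v * scale
            ≈⟨ +-congʳ (*-assoc _ _ _) ⟨
          H₂ α θ * (B * (E * B)) * (z * n ^ 2) - v * scale
            ≈⟨ +-congʳ (*-congʳ (clear ((θ - 1#) ^ 2) B (B ⁻¹) (E * B) ((E * B) ⁻¹) (inverse 0<B) (inverse 0<EB))) ⟩
          ((θ - 1#) ^ 2 * (E * B) + (A - (θ - 1#) ^ 2) * B) * (z * n ^ 2) - v * scale
            ≈⟨ solve 5 (λ α θ v n z →
                 ((θ :- con (+ 1)) :^ 2 :* ((con (+ 1) :+ α) :^ 2 :* θ :^ 2) :+ (α :^ 2 :- (θ :- con (+ 1)) :^ 2) :* θ :^ 2)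
                   :* (z :* n :^ 2)
                   :- v :* (θ :^ 2 :* ((con (+ 1) :+ α) :^ 2 :* θ :^ 2) :* (z :* n :^ 2))
                 := θ :^ 2 :* gap₂ᴾ (n :* α) n θ (z :* v) z) refl α θ v n z ⟩
          B * gap₂ (n * α) n θ (z * v) z
            ≈⟨ *-congˡ (gap₂-cong n θ z (cleared α-ratio) (cleared v-ratio)) ⟩
          B * gap₂ a n θ w z ∎
          where open SetoidReasoning setoid

      0≤gap₂⇒≤H : α ≤ θ → 0# ≤ gap₂ a n θ w z → v ≤ H α θ
      0≤gap₂⇒≤H α≤θ 0≤gap = ≤-respʳ-≈ (sym (H≈H₂ 0<α α≤θ))
        (*-cancelʳ-≤ 0<scale (≤-by-difference scaled-gap (*-nonNegative (<⇒≤ 0<B) 0≤gap)))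

-- Numerical certificates for c_det.

module Numerics (ℝ : RealField) where

  open Order ℝ
  open Certificates ℝ
  open OnlineAllocation ℝ using (H)

  10^-numeral : ∀ k → fromℕ 10 ^ k ≈ fromℤ (+ (10 ℕ.^ k))
  10^-numeral zero    = refl
  10^-numeral (suc k) = begin
    fromℕ 10 * fromℕ 10 ^ k             ≈⟨ *-cong (sym (fromℤ-pos 10)) (10^-numeral k) ⟩
    fromℤ (+ 10) * fromℤ (+ (10 ℕ.^ k))  ≈⟨ fromℤ-*-pos 10 (10 ℕ.^ k) ⟨
    fromℤ (+ 10 ℤ.* + (10 ℕ.^ k))        ≡⟨ ≡.cong fromℤ (ℤₚ.pos-* 10 (10 ℕ.^ k)) ⟨
    fromℤ (+ (10 ℕ.* 10 ℕ.^ k))          ∎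
    where open SetoidReasoning setoid

  10^-positive : ∀ k → 0# < fromℕ 10 ^ k
  10^-positive zero    = 0<1
  10^-positive (suc k) = *-positive (fromℕ-positive {10} (ℕ.s≤s ℕ.z≤n)) (10^-positive k)

  ratio-decimal : ∀ n k → Ratio (decimal n k) (fromℤ (+ n)) (fromℤ (+ (10 ℕ.^ k)))
  ratio-decimal n k = ratio (<-respʳ-≈ (10^-numeral k) (10^-positive k)) (begin
    fromℤ (+ (10 ℕ.^ k)) * decimal n k    ≈⟨ *-congʳ (10^-numeral k) ⟨
    fromℕ 10 ^ k * decimal n k            ≈⟨ *-comm _ _ ⟩
    decimal n k * fromℕ 10 ^ k            ≈⟨ /-cancelʳ (fromℕ n) (10^-positive k) ⟩
    fromℕ n                               ≈⟨ fromℤ-pos n ⟨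
    fromℤ (+ n)                           ∎)
    where open SetoidReasoning setoid

  ratio-2 : Ratio (fromℕ 2) (fromℤ (+ 2)) 1#
  ratio-2 = ratio 0<1 (trans (*-identityˡ _) (sym (fromℤ-pos 2)))

  1<2 : 1# < fromℕ 2
  1<2 = <-by-difference (solve 0 (con (+ 1) :+ (con (+ 1) :+ con (+ 0)) :- con (+ 1) := con (+ 1)) refl) 0<1

  private
    0<2 : 0# < fromℕ 2
    0<2 = <-trans 0<1 1<2

    θ-1 : ∀ {θ} → 1# ≤ θ → 0# ≤ θ - 1#
    θ-1 = x≤y⇒0≤y-x

  -- The certificates below divide a gap by a quadratic that is nonnegative where needed: the
  -- square of θ minus a rounding of the minimiser, or the product of the distances to two ends.
  -- Quotient and remainder then have nonnegative coefficients in powers of θ - 1 (or α - 1).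
  module _ (θ : Carrier) (1≤θ : 1# ≤ θ) where

    private
      gap₁-at-2 : 0# ≤ gap₁ (fromℤ (+ 2)) 1# θ 1# (fromℤ (+ 2466)) (fromℤ (+ 10000))
      -- 1933 / 1250 = 1.5464 is the rounded minimiser, and 5¹² = 244140625 clears the denominators
      -- from dividing by the square. `fromℤ-positive n` concerns n + 1.
      gap₁-at-2 = *-cancelˡ-≤ (fromℤ-positive 244140624) (≤-by-difference
        (solve 1 (λ θ → con (+ 244140625) :* gap₁ᴾ (con (+ 2)) (con (+ 1)) θ (con (+ 1)) (con (+ 2466)) (con (+ 10000))
            :- con (+ 244140625) :* con (+ 0) :=
          (con (+ 1250) :* θ :- con (+ 1933)) :* (con (+ 1250) :* θ :- con (+ 1933))
            :* hornerᴾ (37271453 ∷ 43492500 ∷ 14062500 ∷ []) (θ :- con (+ 1))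
            :+ hornerᴾ (1949036483 ∷ 4576915000 ∷ []) (θ :- con (+ 1))) refl θ)
        (+-nonNegative
          (*-nonNegative (square-nonNegative _) (horner-nonNegative (37271453 ∷ 43492500 ∷ 14062500 ∷ []) (θ-1 1≤θ)))
          (horner-nonNegative (1949036483 ∷ 4576915000 ∷ []) (θ-1 1≤θ))))

      gap₂-at-2 : fromℕ 2 ≤ θ → 0# ≤ gap₂ (fromℤ (+ 2)) 1# θ (fromℤ (+ 2466)) (fromℤ (+ 10000))
      gap₂-at-2 2≤θ = ≤-by-difference
        (solve 1 (λ θ → gap₂ᴾ (con (+ 2)) (con (+ 1)) θ (con (+ 2466)) (con (+ 10000)) :- con (+ 0) :=
          hornerᴾ (31224 ∷ 71224 ∷ 57806 ∷ []) (θ :- con (+ 2))) refl θ)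
        (horner-nonNegative (31224 ∷ 71224 ∷ 57806 ∷ []) (x≤y⇒0≤y-x (≤-respˡ-≈ (sym (fromℤ-pos 2)) 2≤θ)))

    H-at-2-≥ : decimal 2466 4 ≤ H (fromℕ 2) θ
    H-at-2-≥ with total θ (fromℕ 2)
    ... | inj₁ θ≤2 = 0≤gap₁⇒≤H 0<2 (<-≤-trans 0<1 1≤θ) ratio-2 ratio-1 (ratio-decimal 2466 4) θ≤2 gap₁-at-2
    ... | inj₂ 2≤θ = 0≤gap₂⇒≤H 0<2 (<-≤-trans 0<1 1≤θ) ratio-2 (ratio-decimal 2466 4) 2≤θ (gap₂-at-2 2≤θ)

  -- The minimiser at α = 2 is θ ≈ 1.546.
  θ₂ : Carrier
  θ₂ = fromℤ (+ 31) / fromℤ (+ 20)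

  ratio-θ₂ : Ratio θ₂ (fromℤ (+ 31)) (fromℤ (+ 20))
  ratio-θ₂ = ratio-/ (fromℤ (+ 31)) (fromℤ-positive 19)

  1≤θ₂ : 1# ≤ θ₂
  1≤θ₂ = ratio-cross-≤ ratio-1 ratio-θ₂ (≤-by-difference
    (solve 0 (con (+ 31) :* con (+ 1) :- con (+ 1) :* con (+ 20) := con (+ 11)) refl) (fromℤ-nonNegative 11))

  θ₂≤1+2 : θ₂ ≤ 1# + fromℕ 2
  θ₂≤1+2 = ratio-cross-≤ ratio-θ₂ ratio-1 (≤-by-difference
    (solve 0 ((con (+ 1) :+ (con (+ 1) :+ (con (+ 1) :+ con (+ 0)))) :* con (+ 20) :- con (+ 31) :* con (+ 1) := con (+ 29)) refl)
    (fromℤ-nonNegative 29))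

  H-at-2-< : H (fromℕ 2) θ₂ < decimal 2467 4
  H-at-2-< = 0<-gap₁⇒H< 0<2 (<-≤-trans 0<1 1≤θ₂) ratio-2 ratio-θ₂ (ratio-decimal 2467 4) (<-by-difference
    (solve 0 (:- gap₁ᴾ (con (+ 2)) (con (+ 1)) (con (+ 31)) (con (+ 20)) (con (+ 2467)) (con (+ 10000)) :- con (+ 0) :=
      con (+ 10042800)) refl) (fromℤ-positive 10042799))

  -- α₀ is the maximiser of c_det to five decimals; v₀ lies between the values of c_det at α₀
  -- and at the ends of the interval around it.
  α₀ : Carrier
  α₀ = fromℤ (+ 192317) / fromℤ (+ 100000)

  v₀ : Carrier
  v₀ = fromℤ (+ 24675663087) / fromℤ (+ 100000000000)

  ratio-α₀ : Ratio α₀ (fromℤ (+ 192317)) (fromℤ (+ 100000))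
  ratio-α₀ = ratio-/ (fromℤ (+ 192317)) (fromℤ-positive 99999)

  ratio-v₀ : Ratio v₀ (fromℤ (+ 24675663087)) (fromℤ (+ 100000000000))
  ratio-v₀ = ratio-/ (fromℤ (+ 24675663087)) (fromℤ-positive 99999999999)

  1<α₀ : 1# < α₀
  1<α₀ = *-cancelʳ-< (<⇒≤ (fromℤ-positive 99999)) (<-respʳ-≈ (sym (/-cancelʳ _ (fromℤ-positive 99999)))
    (<-by-difference (solve 0 (con (+ 192317) :- con (+ 1) :* con (+ 100000) := con (+ 92317)) refl) (fromℤ-positive 92316)))

  2467≤v₀ : decimal 2467 4 ≤ v₀
  2467≤v₀ = ratio-cross-≤ (ratio-decimal 2467 4) ratio-v₀ (≤-by-difference
    (solve 0 (con (+ 24675663087) :* con (+ 10000) :- con (+ 2467) :* con (+ 100000000000) := con (+ 56630870000)) refl)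
    (fromℤ-nonNegative 56630870000))

  module _ (θ : Carrier) (1≤θ : 1# ≤ θ) where

    private
      0<α₀ : 0# < α₀
      0<α₀ = <-trans 0<1 1<α₀

      gap₁-at-α₀ : 0# ≤ gap₁ (fromℤ (+ 192317)) (fromℤ (+ 100000)) θ 1# (fromℤ (+ 24675663087)) (fromℤ (+ 100000000000))
      -- 151997463273 / 10¹¹ rounds the minimiser at `α₀` to as many decimals as `v₀` carries.
      gap₁-at-α₀ = *-cancelˡ-≤ (fromℤ-positive 99999999999999999999999) (≤-by-difference
        (solve 1 (λ θ → con (+ 100000000000000000000000)
            :* gap₁ᴾ (con (+ 192317)) (con (+ 100000)) θ (con (+ 1)) (con (+ 24675663087)) (con (+ 100000000000))
            :- con (+ 100000000000000000000000) :* con (+ 0) :=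
          (con (+ 100000000000) :* θ :- con (+ 151997463273)) :* (con (+ 100000000000) :* θ :- con (+ 151997463273))
            :* hornerᴾ (2175135512163125988437499509490773 ∷ 2597613193792592556899400000000000 ∷ 854492284890000000000000000000000 ∷ []) (θ :- con (+ 1))
            :+ hornerᴾ (4064013624041221903682384548004555666325083 ∷ 693215663259022914407269210899423200000000000 ∷ []) (θ :- con (+ 1))) refl θ)
        (+-nonNegative
          (*-nonNegative (square-nonNegative _) (horner-nonNegative
            (2175135512163125988437499509490773 ∷ 2597613193792592556899400000000000 ∷ 854492284890000000000000000000000 ∷ []) (θ-1 1≤θ)))
          (horner-nonNegative (4064013624041221903682384548004555666325083 ∷ 693215663259022914407269210899423200000000000 ∷ []) (θ-1 1≤θ))))

      gap₂-at-α₀ : α₀ ≤ θ → 0# ≤ gap₂ (fromℤ (+ 192317)) (fromℤ (+ 100000)) θ (fromℤ (+ 24675663087)) (fromℤ (+ 100000000000))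
      gap₂-at-α₀ α₀≤θ = *-cancelˡ-≤ (fromℤ-positive 9999999999) (≤-by-difference
        (solve 1 (λ θ → con (+ 10000000000)
            :* gap₂ᴾ (con (+ 192317)) (con (+ 100000)) θ (con (+ 24675663087)) (con (+ 100000000000))
            :- con (+ 10000000000) :* con (+ 0) :=
          hornerᴾ (23301668976919528725635379565473 ∷ 582042198579529201533253738 ∷ 5436406475661353914457 ∷ [])
            (con (+ 100000) :* θ :- con (+ 192317))) refl θ)
        (horner-nonNegative (23301668976919528725635379565473 ∷ 582042198579529201533253738 ∷ 5436406475661353914457 ∷ [])
          (x≤y⇒0≤y-x (≤-respˡ-≈ (Ratio.cleared ratio-α₀) (*-monoˡ-≤ (fromℤ-nonNegative 100000) α₀≤θ)))))

    H-at-α₀-≥ : v₀ ≤ H α₀ θ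
    H-at-α₀-≥ with total θ α₀
    ... | inj₁ θ≤α₀ = 0≤gap₁⇒≤H 0<α₀ (<-≤-trans 0<1 1≤θ) ratio-α₀ ratio-1 ratio-v₀ θ≤α₀ gap₁-at-α₀
    ... | inj₂ α₀≤θ = 0≤gap₂⇒≤H 0<α₀ (<-≤-trans 0<1 1≤θ) ratio-α₀ ratio-v₀ α₀≤θ (gap₂-at-α₀ α₀≤θ)

  -- The ends of the interval of numbers that agree with 1.9232 up to half a unit of its last
  -- decimal.
  lo hi : Carrier
  lo = decimal 19232 4 - decimal 5 5
  hi = decimal 19232 4 + decimal 5 5

  private
    10⁵·decimal : fromℤ (+ 100000) * decimal 19232 4 ≈ fromℤ (+ 192320)
    10⁵·decimal = begin
      fromℤ (+ 100000) * x                    ≈⟨ solve 1 (λ x → con (+ 100000) :* x := con (+ 10) :* (con (+ 10000) :* x)) refl x ⟩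
      fromℤ (+ 10) * (fromℤ (+ 10000) * x)    ≈⟨ *-congˡ (Ratio.cleared (ratio-decimal 19232 4)) ⟩
      fromℤ (+ 10) * fromℤ (+ 19232)          ≈⟨ solve 0 (con (+ 10) :* con (+ 19232) := con (+ 192320)) refl ⟩
      fromℤ (+ 192320)                        ∎
      where
      open SetoidReasoning setoid
      x = decimal 19232 4

  ratio-lo : Ratio lo (fromℤ (+ 192315)) (fromℤ (+ 100000))
  ratio-lo = ratio (fromℤ-positive 99999) (begin
    fromℤ (+ 100000) * (x - y)
      ≈⟨ solve 2 (λ x y → con (+ 100000) :* (x :- y) := con (+ 100000) :* x :- con (+ 100000) :* y) refl x y ⟩
    fromℤ (+ 100000) * x - fromℤ (+ 100000) * y
      ≈⟨ +-cong 10⁵·decimal (-‿cong (Ratio.cleared (ratio-decimal 5 5))) ⟩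
    fromℤ (+ 192320) - fromℤ (+ 5)
      ≈⟨ solve 0 (con (+ 192320) :- con (+ 5) := con (+ 192315)) refl ⟩
    fromℤ (+ 192315) ∎)
    where
    open SetoidReasoning setoid
    x = decimal 19232 4
    y = decimal 5 5

  ratio-hi : Ratio hi (fromℤ (+ 192325)) (fromℤ (+ 100000))
  ratio-hi = ratio (fromℤ-positive 99999) (begin
    fromℤ (+ 100000) * (x + y)
      ≈⟨ solve 2 (λ x y → con (+ 100000) :* (x :+ y) := con (+ 100000) :* x :+ con (+ 100000) :* y) refl x y ⟩
    fromℤ (+ 100000) * x + fromℤ (+ 100000) * y
      ≈⟨ +-cong 10⁵·decimal (Ratio.cleared (ratio-decimal 5 5)) ⟩
    fromℤ (+ 192320) + fromℤ (+ 5)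
      ≈⟨ solve 0 (con (+ 192320) :+ con (+ 5) := con (+ 192325)) refl ⟩
    fromℤ (+ 192325) ∎)
    where
    open SetoidReasoning setoid
    x = decimal 19232 4
    y = decimal 5 5

  lo≤α₀ : lo ≤ α₀
  lo≤α₀ = ratio-cross-≤ ratio-lo ratio-α₀ (≤-by-difference
    (solve 0 (con (+ 192317) :* con (+ 100000) :- con (+ 192315) :* con (+ 100000) := con (+ 200000)) refl) (fromℤ-nonNegative 200000))

  α₀≤hi : α₀ ≤ hi
  α₀≤hi = ratio-cross-≤ ratio-α₀ ratio-hi (≤-by-difference
    (solve 0 (con (+ 192325) :* con (+ 100000) :- con (+ 192317) :* con (+ 100000) := con (+ 800000)) refl) (fromℤ-nonNegative 800000))

  1<lo : 1# < lo
  1<lo = *-cancelʳ-< (fromℤ-nonNegative 100000) (<-respʳ-≈ (trans (sym (Ratio.cleared ratio-lo)) (*-comm _ _))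
    (<-by-difference (solve 0 (con (+ 192315) :- con (+ 1) :* con (+ 100000) := con (+ 92315)) refl) (fromℤ-positive 92314)))

  module _ (α : Carrier) (1≤α : 1# ≤ α) where

    private
      0<α : 0# < α
      0<α = <-≤-trans 0<1 1≤α

    -- The affine approximation of the minimiser of H α near α₀.
    θ₀ : Carrier
    θ₀ = (fromℤ (+ 346334) * α + fromℤ (+ 853915)) / fromℤ (+ 1000000)

    ratio-θ₀ : Ratio θ₀ (fromℤ (+ 346334) * α + fromℤ (+ 853915)) (fromℤ (+ 1000000))
    ratio-θ₀ = ratio-/ _ (fromℤ-positive 999999)

    1≤θ₀ : 1# ≤ θ₀
    1≤θ₀ = ratio-cross-≤ ratio-1 ratio-θ₀ (≤-by-difference
      (solve 1 (λ α → (con (+ 346334) :* α :+ con (+ 853915)) :* con (+ 1) :- con (+ 1) :* con (+ 1000000) :=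
        hornerᴾ (200249 ∷ 346334 ∷ []) (α :- con (+ 1))) refl α)
      (horner-nonNegative (200249 ∷ 346334 ∷ []) (θ-1 1≤α)))

    θ₀≤1+α : θ₀ ≤ 1# + α
    θ₀≤1+α = ratio-cross-≤ ratio-θ₀ ratio-1 (≤-by-difference
      (solve 1 (λ α → (con (+ 1) :+ α) :* con (+ 1000000) :- (con (+ 346334) :* α :+ con (+ 853915)) :* con (+ 1) :=
        hornerᴾ (799751 ∷ 653666 ∷ []) (α :- con (+ 1))) refl α)
      (horner-nonNegative (799751 ∷ 653666 ∷ []) (θ-1 1≤α)))

    private
      -- A quadratic with roots `lo` and 1.9231906501, the latter between `α₀` and `hi`. It is
      -- negative only between them, which leaves room for `H` to exceed `v₀` near `α₀`.
      ends : Carrier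
      ends = (fromℤ (+ 100000) * α - fromℤ (+ 192315)) * (fromℤ (+ 10000000000) * α - fromℤ (+ 19231906501))

      quotient remainder : List ℕ
      quotient = 338720477836069326144770861126173728698102903017087583286650073 ∷
        941387254336042695913095917899355068937932696917255730000000000 ∷
        874531556919365080165736809824716703105107300000000000000000000 ∷
        296136969846378634482190179626573000000000000000000000000000000 ∷
        19013045547363629520730000000000000000000000000000000000000000 ∷ []
      remainder = 289786462427004238236583969895869386646930966207920277316480279543505 ∷
        165275739393522627536327674731279017548042337423040375544082457300000 ∷ []

      gap₁-at-θ₀ : 0# ≤ ends →
        0# ≤ - gap₁ α 1# (fromℤ (+ 346334) * α + fromℤ (+ 853915)) (fromℤ (+ 1000000)) (fromℤ (+ 24675663087)) (fromℤ (+ 100000000000))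
      gap₁-at-θ₀ 0≤ends = *-cancelˡ-≤ (fromℤ-positive 12499999999999999999999999999999999999999999) (≤-by-difference
        (solve 1 (λ α → con (+ 12500000000000000000000000000000000000000000) :*
            :- gap₁ᴾ α (con (+ 1)) (con (+ 346334) :* α :+ con (+ 853915)) (con (+ 1000000)) (con (+ 24675663087)) (con (+ 100000000000))
            :- con (+ 12500000000000000000000000000000000000000000) :* con (+ 0) :=
          (con (+ 100000) :* α :- con (+ 192315)) :* (con (+ 10000000000) :* α :- con (+ 19231906501))
            :* hornerᴾ quotient (α :- con (+ 1)) :+ hornerᴾ remainder (α :- con (+ 1))) refl α)
        (+-nonNegative (*-nonNegative 0≤ends (horner-nonNegative quotient (θ-1 1≤α))) (horner-nonNegative remainder (θ-1 1≤α))))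

      -- In units of 10⁻¹⁰ the second root lies 406501 above `lo` and 593499 below `hi`; these are
      -- the constants in the two factorisations.
      0≤ends-below : α ≤ lo → 0# ≤ ends
      0≤ends-below α≤lo = ≤-respʳ-≈
        (solve 1 (λ α → (con (+ 192315) :- con (+ 100000) :* α) :* (con (+ 100000) :* (con (+ 192315) :- con (+ 100000) :* α) :+ con (+ 406501)) :=
          (con (+ 100000) :* α :- con (+ 192315)) :* (con (+ 10000000000) :* α :- con (+ 19231906501))) refl α)
        (*-nonNegative 0≤gap (+-nonNegative (*-nonNegative (fromℤ-nonNegative 100000) 0≤gap) (fromℤ-nonNegative 406501)))
        where
        0≤gap : 0# ≤ fromℤ (+ 192315) - fromℤ (+ 100000) * α
        0≤gap = x≤y⇒0≤y-x (≤-respʳ-≈ (Ratio.cleared ratio-lo) (*-monoˡ-≤ (fromℤ-nonNegative 100000) α≤lo))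

      0≤ends-above : hi ≤ α → 0# ≤ ends
      0≤ends-above hi≤α = ≤-respʳ-≈
        (solve 1 (λ α → (con (+ 10) :+ (con (+ 100000) :* α :- con (+ 192325))) :* (con (+ 100000) :* (con (+ 100000) :* α :- con (+ 192325)) :+ con (+ 593499)) :=
          (con (+ 100000) :* α :- con (+ 192315)) :* (con (+ 10000000000) :* α :- con (+ 19231906501))) refl α)
        (*-nonNegative (+-nonNegative (fromℤ-nonNegative 10) 0≤gap)
          (+-nonNegative (*-nonNegative (fromℤ-nonNegative 100000) 0≤gap) (fromℤ-nonNegative 593499)))
        where
        0≤gap : 0# ≤ fromℤ (+ 100000) * α - fromℤ (+ 192325)
        0≤gap = x≤y⇒0≤y-x (≤-respˡ-≈ (Ratio.cleared ratio-hi) (*-monoˡ-≤ (fromℤ-nonNegative 100000) hi≤α))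

    H-outside-≤ : α ≤ lo ⊎ hi ≤ α → H α θ₀ ≤ v₀
    H-outside-≤ outside = 0≤-gap₁⇒H≤ 0<α (<-≤-trans 0<1 1≤θ₀) ratio-1 ratio-θ₀ ratio-v₀
      (gap₁-at-θ₀ ([ 0≤ends-below , 0≤ends-above ]′ outside))

    -- Coarser than θ₀, but sharp enough for the bound 0.2468 at every α.
    θ₁ : Carrier
    θ₁ = (fromℤ (+ 4) * α + fromℤ (+ 9)) / fromℤ (+ 11)

    ratio-θ₁ : Ratio θ₁ (fromℤ (+ 4) * α + fromℤ (+ 9)) (fromℤ (+ 11))
    ratio-θ₁ = ratio-/ _ (fromℤ-positive 10)

    1≤θ₁ : 1# ≤ θ₁
    1≤θ₁ = ratio-cross-≤ ratio-1 ratio-θ₁ (≤-by-difference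
      (solve 1 (λ α → (con (+ 4) :* α :+ con (+ 9)) :* con (+ 1) :- con (+ 1) :* con (+ 11) :=
        hornerᴾ (2 ∷ 4 ∷ []) (α :- con (+ 1))) refl α)
      (horner-nonNegative (2 ∷ 4 ∷ []) (θ-1 1≤α)))

    θ₁≤1+α : θ₁ ≤ 1# + α
    θ₁≤1+α = ratio-cross-≤ ratio-θ₁ ratio-1 (≤-by-difference
      (solve 1 (λ α → (con (+ 1) :+ α) :* con (+ 11) :- (con (+ 4) :* α :+ con (+ 9)) :* con (+ 1) :=
        hornerᴾ (9 ∷ 7 ∷ []) (α :- con (+ 1))) refl α)
      (horner-nonNegative (9 ∷ 7 ∷ []) (θ-1 1≤α)))

    private
      gap₁-at-θ₁ : 0# < - gap₁ α 1# (fromℤ (+ 4) * α + fromℤ (+ 9)) (fromℤ (+ 11)) (fromℤ (+ 2468)) (fromℤ (+ 10000))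
      -- Here the square is in α, centred at 1.921, close to the maximiser of c_det.
      gap₁-at-θ₁ = *-cancelʳ-< (fromℤ-nonNegative 3125000000000000) (<-by-difference
        (solve 1 (λ α →
            :- gap₁ᴾ α (con (+ 1)) (con (+ 4) :* α :+ con (+ 9)) (con (+ 11)) (con (+ 2468)) (con (+ 10000)) :* con (+ 3125000000000000)
            :- con (+ 0) :* con (+ 3125000000000000) :=
          (con (+ 1000) :* α :- con (+ 1921)) :* (con (+ 1000) :* α :- con (+ 1921))
            :* hornerᴾ (122074281746622717 ∷ 342755430859201600 ∷ 318584440502200000 ∷ 107410138800000000 ∷ 6931400000000000 ∷ []) (α :- con (+ 1))
            :+ hornerᴾ (396989176962999909203 ∷ 1017967549839020328400 ∷ []) (α :- con (+ 1))) refl α)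
        (+-nonNegative-pos
          (*-nonNegative (square-nonNegative _) (horner-nonNegative
            (122074281746622717 ∷ 342755430859201600 ∷ 318584440502200000 ∷ 107410138800000000 ∷ 6931400000000000 ∷ []) (θ-1 1≤α)))
          (horner-positive 396989176962999909202 (1017967549839020328400 ∷ []) (θ-1 1≤α))))

    H-at-θ₁-< : H α θ₁ < decimal 2468 4
    H-at-θ₁-< = 0<-gap₁⇒H< 0<α (<-≤-trans 0<1 1≤θ₁) ratio-1 ratio-θ₁ (ratio-decimal 2468 4) gap₁-at-θ₁

-- The values c_det(2) and sup c_det.

module OptimalRatio (em : ExcludedMiddle 0ℓ) (ℝ : RealField) where

  open Order ℝ
  open CompetitiveRatio em ℝ
  open Numerics ℝ
  open OnlineAllocation ℝ using (H; IsCdet)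

  H-lower⇒cdet-lower : ∀ {α v c} → (∀ θ → 1# ≤ θ → v ≤ H α θ) → IsCdet α c → v ≤ c
  H-lower⇒cdet-lower v≤H ((θ , 1≤θ , _ , c≈H) , _) = ≤-respʳ-≈ (sym c≈H) (v≤H θ 1≤θ)

  cdet-2-lower : ∀ {c} → IsCdet (fromℕ 2) c → decimal 2466 4 ≤ c
  cdet-2-lower = H-lower⇒cdet-lower H-at-2-≥

  cdet-2 : ∃[ c ] IsCdet (fromℕ 2) c × decimal 2466 4 ≤ c × c < decimal 2467 4
  cdet-2 =
    let c , isCdet = cdet-exists 1<2
    in c , isCdet , cdet-2-lower isCdet , ≤-<-trans (proj₂ isCdet θ₂ 1≤θ₂ θ₂≤1+2) H-at-2-<

  v₀≤cdet-α₀ : v₀ ≤ cdet α₀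
  v₀≤cdet-α₀ = H-lower⇒cdet-lower H-at-α₀-≥ (cdet-isCdet 1<α₀)

  cdet-outside-≤ : ∀ {α} → 1# < α → α ≤ lo ⊎ hi ≤ α → cdet α ≤ v₀
  cdet-outside-≤ {α} 1<α outside = ≤-trans
    (proj₂ (cdet-isCdet 1<α) (θ₀ α 1≤α) (1≤θ₀ α 1≤α) (θ₀≤1+α α 1≤α)) (H-outside-≤ α 1≤α outside)
    where 1≤α = <⇒≤ 1<α

  cdet-<-2468 : ∀ {α} → 1# < α → cdet α < decimal 2468 4
  cdet-<-2468 {α} 1<α = ≤-<-trans
    (proj₂ (cdet-isCdet 1<α) (θ₁ α 1≤α) (1≤θ₁ α 1≤α) (θ₁≤1+α α 1≤α)) (H-at-θ₁-< α 1≤α)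
    where 1≤α = <⇒≤ 1<α

  -- The maximum over [`lo` , `hi`] is at least `cdet α₀`, hence at least `v₀`, which dominates all
  -- values outside; so it is global, without the maximiser being computed.
  cdet-supremum : ∃[ s ] IsSupremum (λ c → ∃[ α ] 1# < α × IsCdet α c) s ×
    decimal 2467 4 ≤ s × s < decimal 2468 4 ×
    (∃[ α ] 1# < α × IsCdet α s × lo ≤ α × α ≤ hi)
  cdet-supremum =
    let α , lo≤α , α≤hi , maximal = cdet-attains-maximum 1<lo (≤-trans lo≤α₀ α₀≤hi)
        1<α = <-≤-trans 1<lo lo≤α
        v₀≤s = ≤-trans v₀≤cdet-α₀ (maximal α₀ lo≤α₀ α₀≤hi)
    in cdet α ,
      ( (λ { c (β , 1<β , c-cdet) → ≤-trans (cdet-unique c-cdet (cdet-isCdet 1<β)) (everywhere v₀≤s maximal 1<β) })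
      , λ u upper → upper (cdet α) (α , 1<α , cdet-isCdet 1<α)) ,
      ≤-trans 2467≤v₀ v₀≤s , cdet-<-2468 1<α , α , 1<α , cdet-isCdet 1<α , lo≤α , α≤hi
    where
    everywhere : ∀ {s} → v₀ ≤ s → (∀ β → lo ≤ β → β ≤ hi → cdet β ≤ s) → ∀ {β} → 1# < β → cdet β ≤ s
    everywhere v₀≤s inside {β} 1<β =
      [ (λ β≤lo → ≤-trans (cdet-outside-≤ 1<β (inj₁ β≤lo)) v₀≤s)
      , (λ lo≤β → [ (λ hi≤β → ≤-trans (cdet-outside-≤ 1<β (inj₂ hi≤β)) v₀≤s) , inside β lo≤β ]′ (total hi β)) ]′ (total β lo)

-- Combinatorics of integer allocations.

module Allocations (ℝ : RealField) where

  open OnlineAllocation ℝ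
  open CommutativeMonoidSum ℕₚ.+-0-commutativeMonoid using ()
    renaming (sum-cong-≗ to ∥∥-cong; ∑-distrib-+ to ∥∥-⊕; sum-replicate-zero to ∥∥-zero) public
  open ≡ using (_≗_)

  infix 4 _≼_
  _≼_ : ∀ {m} → Allocation m → Allocation m → Set
  x ≼ y = ∀ i → x i ℕ.≤ y i

  ∥∥-mono : ∀ {m} {x y : Allocation m} → x ≼ y → ∥ x ∥₁ ℕ.≤ ∥ y ∥₁
  ∥∥-mono {zero}  x≼y = ℕ.z≤n
  ∥∥-mono {suc m} x≼y = ℕₚ.+-mono-≤ (x≼y zero) (∥∥-mono (x≼y ∘ suc))

  x≤∥x∥ : ∀ {m} (x : Allocation m) i → x i ℕ.≤ ∥ x ∥₁
  x≤∥x∥ x zero    = ℕₚ.m≤m+n (x zero) _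
  x≤∥x∥ x (suc i) = ℕₚ.≤-trans (x≤∥x∥ (x ∘ suc) i) (ℕₚ.m≤n+m _ (x zero))

  -- A feasible allocation of size C is thereby the full one, which settles arrivals after capacity
  -- is exhausted.
  ≼∧∥∥≥⇒≽ : ∀ {m} {x y : Allocation m} → x ≼ y → ∥ y ∥₁ ℕ.≤ ∥ x ∥₁ → y ≼ x
  ≼∧∥∥≥⇒≽ {suc m} {x} {y} x≼y ∥y∥≤∥x∥ zero = ℕₚ.+-cancelʳ-≤ ∥ y ∘ suc ∥₁ (y zero) (x zero)
    (ℕₚ.≤-trans ∥y∥≤∥x∥ (ℕₚ.+-monoʳ-≤ (x zero) (∥∥-mono (x≼y ∘ suc))))
  ≼∧∥∥≥⇒≽ {suc m} {x} {y} x≼y ∥y∥≤∥x∥ (suc i) = ≼∧∥∥≥⇒≽ (x≼y ∘ suc)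
    (ℕₚ.+-cancelˡ-≤ (y zero) _ _ (ℕₚ.≤-trans ∥y∥≤∥x∥ (ℕₚ.+-monoˡ-≤ _ (x≼y zero)))) i

  count-∷ : ∀ {m} (j : Fin m) η i → count (j ∷ η) i ≡ count [ j ] i ℕ.+ count η i
  count-∷ j η i with i Finₚ.≟ j
  ... | yes _ = ≡.refl
  ... | no  _ = ≡.refl

  count-++ : ∀ {m} (η ζ : List (Fin m)) i → count (η ++ ζ) i ≡ count η i ℕ.+ count ζ i
  count-++ η ζ i = ≡.trans (≡.cong length (Listₚ.filter-++ (i Finₚ.≟_) η ζ)) (Listₚ.length-++ (filter (i Finₚ.≟_) η))

  count-≡ : ∀ {m} (i : Fin m) → count [ i ] i ≡ 1
  count-≡ i with i Finₚ.≟ i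
  ... | yes _   = ≡.refl
  ... | no  i≢i = contradiction ≡.refl i≢i

  count-suc : ∀ {m} (i j : Fin m) → count [ suc j ] (suc i) ≡ count [ j ] i
  count-suc i j with i Finₚ.≟ j
  ... | yes _ = ≡.refl
  ... | no  _ = ≡.refl

  ∥count-[]∥ : ∀ {m} (j : Fin m) → ∥ count [ j ] ∥₁ ≡ 1
  ∥count-[]∥ {suc m} zero    = ≡.cong suc (∥∥-zero m)
  ∥count-[]∥ {suc m} (suc j) = ≡.trans (∥∥-cong (λ i → count-suc i j)) (∥count-[]∥ j)

  ∥count∥ : ∀ {m} (η : List (Fin m)) → ∥ count η ∥₁ ≡ length η
  ∥count∥ {m} []      = ∥∥-zero m
  ∥count∥ (j ∷ η) = begin
    ∥ count (j ∷ η) ∥₁                     ≡⟨ ∥∥-cong (count-∷ j η) ⟩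
    ∥ count [ j ] ⊕ count η ∥₁             ≡⟨ ∥∥-⊕ (count [ j ]) (count η) ⟩
    ∥ count [ j ] ∥₁ ℕ.+ ∥ count η ∥₁      ≡⟨ ≡.cong₂ ℕ._+_ (∥count-[]∥ j) (∥count∥ η) ⟩
    suc (length η)                         ∎
    where open ≡.≡-Reasoning

  -- Greedy: the head takes as many units as its capacity permits while leaving room for those
  -- already in the tail.
  extend : ∀ {m} (x b : Allocation m) K → x ≼ b → ∥ x ∥₁ ℕ.≤ K → K ℕ.≤ ∥ b ∥₁ →
    ∃[ y ] x ≼ y × y ≼ b × ∥ y ∥₁ ≡ K
  extend {zero} x b K x≼b x≤K K≤b = x , (λ ()) , (λ ()) , ≡.sym (ℕₚ.n≤0⇒n≡0 K≤b)
  extend {suc m} x b K x≼b x≤K K≤b =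
    let y , x≼y , y≼b , ∥y∥≡ = extend (x ∘ suc) (b ∘ suc) (K ∸ y₀) (x≼b ∘ suc) lower upper
    in y₀ Vector.∷ y ,
      (λ { zero → ℕₚ.⊓-glb (x≼b zero) (ℕₚ.m+n≤o⇒m≤o∸n (x zero) x≤K) ; (suc i) → x≼y i }) ,
      (λ { zero → ℕₚ.m⊓n≤m _ _ ; (suc i) → y≼b i }) ,
      ≡.trans (≡.cong (y₀ ℕ.+_) ∥y∥≡) (ℕₚ.m+[n∸m]≡n (ℕₚ.≤-trans y₀≤ (ℕₚ.m∸n≤m K tail)))
    where
    tail = ∥ x ∘ suc ∥₁
    y₀ = b zero ℕ.⊓ (K ∸ tail)
    y₀≤ : y₀ ℕ.≤ K ∸ tail
    y₀≤ = ℕₚ.m⊓n≤n (b zero) (K ∸ tail)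
    tail≤K : tail ℕ.≤ K
    tail≤K = ℕₚ.≤-trans (ℕₚ.m≤n+m tail (x zero)) x≤K
    lower : tail ℕ.≤ K ∸ y₀
    lower = ≡.subst (ℕ._≤ K ∸ y₀) (ℕₚ.m∸[m∸n]≡n tail≤K) (ℕₚ.∸-monoʳ-≤ K y₀≤)
    upper : K ∸ y₀ ℕ.≤ ∥ b ∘ suc ∥₁
    upper with ℕₚ.⊓-sel (b zero) (K ∸ tail)
    ... | inj₁ y₀≡b = ≡.subst (λ y → K ∸ y ℕ.≤ ∥ b ∘ suc ∥₁) (≡.sym y₀≡b) (ℕₚ.m≤n+o⇒m∸n≤o K (b zero) K≤b)
    ... | inj₂ y₀≡K∸ = ≡.subst (λ y → K ∸ y ℕ.≤ ∥ b ∘ suc ∥₁) (≡.sym y₀≡K∸)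
      (ℕₚ.≤-trans (ℕₚ.≤-reflexive (ℕₚ.m∸[m∸n]≡n tail≤K)) (∥∥-mono (x≼b ∘ suc)))

  -- Recursion on the index, instead of a pointwise test, matches the recursion of `sum` and `∥_∥₁`.
  decrement : ∀ {m} → Fin m → Allocation m → Allocation m
  decrement zero    x zero    = ℕ.pred (x zero)
  decrement zero    x (suc j) = x (suc j)
  decrement (suc i) x zero    = x zero
  decrement (suc i) x (suc j) = decrement i (x ∘ suc) j

  decrement-≼ : ∀ {m} (i : Fin m) x → decrement i x ≼ x
  decrement-≼ zero    x zero    = ℕₚ.pred[n]≤n
  decrement-≼ zero    x (suc j) = ℕₚ.≤-refl
  decrement-≼ (suc i) x zero    = ℕₚ.≤-refl
  decrement-≼ (suc i) x (suc j) = decrement-≼ i (x ∘ suc) j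

  ∥decrement∥ : ∀ {m} (i : Fin m) x → 0 ℕ.< x i → ∥ x ∥₁ ≡ suc ∥ decrement i x ∥₁
  ∥decrement∥ zero    x 0<x = ≡.cong (ℕ._+ ∥ x ∘ suc ∥₁) (≡.sym (ℕₚ.suc-pred (x zero) {{ℕ.>-nonZero 0<x}}))
  ∥decrement∥ (suc i) x 0<x = ≡.trans (≡.cong (x zero ℕ.+_) (∥decrement∥ i (x ∘ suc) 0<x)) (ℕₚ.+-suc (x zero) _)

  -- Allocations are functions, so list membership can be had only up to pointwise equality.
  grid-complete : ∀ {m} {x b : Allocation m} → x ≼ b → ∃[ y ] y ∈ grid b × y ≗ x
  grid-complete {zero}  x≼b = Vector.[] , here ≡.refl , λ ()
  grid-complete {suc m} {x} x≼b =
    let y , y∈grid , y≗x = grid-complete (x≼b ∘ suc)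
    in x zero Vector.∷ y , ∈-cartesianProductWith⁺ Vector._∷_ (∈-upTo⁺ (ℕ.s≤s (x≼b zero))) y∈grid ,
      λ { zero → ≡.refl ; (suc i) → y≗x i }

  grid-sound : ∀ {m} (b : Allocation m) {x} → x ∈ grid b → x ≼ b
  grid-sound {suc m} b x∈grid i
    with ∈-cartesianProductWith⁻ Vector._∷_ (upTo (suc (b zero))) (grid (b ∘ suc)) x∈grid
  grid-sound {suc m} b _ zero    | n , y , n∈ , y∈ , ≡.refl = ℕ.s≤s⁻¹ (∈-upTo⁻ n∈)
  grid-sound {suc m} b _ (suc i) | n , y , n∈ , y∈ , ≡.refl = grid-sound (b ∘ suc) y∈ i

-- The offline benchmark U and its quadratic scaling.

module Benchmark (ℝ : RealField) where

  open Order ℝ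
  open Allocations ℝ
  open OnlineAllocation ℝ
  open SemiringSum semiring using (sum-cong-≋; ∑-distrib-+; *-distribˡ-sum; sum-init-last)
  open SemiringMult semiring using (×-assoc-*)
  open Extrema totalOrder using (argmax-sel; xs≤max; ⊥≤max)

  sum-mono : ∀ {n} {u v : Fin n → Carrier} → (∀ i → u i ≤ v i) → sum u ≤ sum v
  sum-mono {zero}  u≤v = ≤-refl
  sum-mono {suc n} u≤v = +-mono-≤ (u≤v zero) (sum-mono (u≤v ∘ suc))

  sum-nonNegative : ∀ {n} {u : Fin n → Carrier} → (∀ i → 0# ≤ u i) → 0# ≤ sum u
  sum-nonNegative {zero}  0≤u = ≤-refl
  sum-nonNegative {suc n} 0≤u = +-nonNegative (0≤u zero) (sum-nonNegative (0≤u ∘ suc))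

  sum-decrement : ∀ {m} (h : Fin m → ℕ → Carrier) (x : Allocation m) i {k g} →
    x i ≡ suc k → h i (suc k) ≈ h i k + g →
    sum (λ j → h j (x j)) ≈ sum (λ j → h j (decrement i x j)) + g
  sum-decrement {suc m} h x zero {k} {g} xi≡ step rewrite xi≡ = begin
    h zero (suc k) + s     ≈⟨ +-congʳ step ⟩
    (h zero k + g) + s     ≈⟨ solve 3 (λ a g s → (a :+ g) :+ s := (a :+ s) :+ g) refl (h zero k) g s ⟩
    (h zero k + s) + g     ∎
    where
    open SetoidReasoning setoid
    s = sum (λ j → h (suc j) (x (suc j)))
  sum-decrement {suc m} h x (suc i) xi≡ step =
    trans (+-congˡ (sum-decrement (h ∘ suc) (x ∘ suc) i xi≡ step)) (sym (+-assoc _ _ _))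

  -- Counts product j with x j units of price a j: some unit costs at most the average. Requiring
  -- `0 < x i` guarantees that this unit is present and can be removed, hence the cases of an empty
  -- head or tail.
  below-weighted-mean : ∀ {m} (x : Allocation m) (a : Fin m → Carrier) → 0 ℕ.< ∥ x ∥₁ →
    ∃[ i ] 0 ℕ.< x i × fromℕ ∥ x ∥₁ * a i ≤ sum (λ j → fromℕ (x j) * a j)
  below-weighted-mean {suc m} x a 0<∥x∥ = by-cases (x zero) ≡.refl ∥ x ∘ suc ∥₁ ≡.refl
    where
    open ≤-Reasoning
    rest = sum (λ j → fromℕ (x (suc j)) * a (suc j))
    tail = ∥ x ∘ suc ∥₁
    Goal = ∃[ i ] 0 ℕ.< x i × fromℕ ∥ x ∥₁ * a i ≤ fromℕ (x zero) * a zero + rest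

    pick : ∀ i → 0 ℕ.< x i → fromℕ (x zero) * a i ≤ fromℕ (x zero) * a zero → fromℕ tail * a i ≤ rest → Goal
    pick i 0<xi head≤ tail≤ = i , 0<xi , (begin
      fromℕ (x zero ℕ.+ tail) * a i                   ≈⟨ *-congʳ (fromℕ-+ (x zero) tail) ⟩
      (fromℕ (x zero) + fromℕ tail) * a i             ≈⟨ distribʳ _ _ _ ⟩
      fromℕ (x zero) * a i + fromℕ tail * a i         ≤⟨ +-mono-≤ head≤ tail≤ ⟩
      fromℕ (x zero) * a zero + rest                  ∎)

    zero-weight : ∀ {n} u v → n ≡ 0 → fromℕ n * u ≤ fromℕ n * v
    zero-weight u v ≡.refl = ≤-reflexive (trans (zeroˡ u) (sym (zeroˡ v)))

    zero-sum : tail ≡ 0 → 0# ≤ rest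
    zero-sum tail≡0 = sum-nonNegative λ j → ≤-reflexive (sym (trans
      (*-congʳ (reflexive (≡.cong fromℕ (ℕₚ.n≤0⇒n≡0 (≡.subst (x (suc j) ℕ.≤_) tail≡0 (x≤∥x∥ (x ∘ suc) j)))))) (zeroˡ _)))

    by-cases : ∀ p → x zero ≡ p → ∀ q → tail ≡ q → Goal
    by-cases zero x₀≡ q tail≡ =
      let i , 0<xi , bound = below-weighted-mean (x ∘ suc) (a ∘ suc)
            (≡.subst (λ k → 0 ℕ.< k ℕ.+ tail) x₀≡ 0<∥x∥)
      in pick (suc i) 0<xi (zero-weight _ _ x₀≡) bound
    by-cases (suc p) x₀≡ zero tail≡ = pick zero (≡.subst (0 ℕ.<_) (≡.sym x₀≡) (ℕ.s≤s ℕ.z≤n)) ≤-refl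
      (≤-trans (≤-trans (zero-weight (a zero) 0# tail≡) (≤-reflexive (zeroʳ _))) (zero-sum tail≡))
    by-cases (suc p) x₀≡ (suc q) tail≡ =
      let i , 0<xi , bound = below-weighted-mean (x ∘ suc) (a ∘ suc) (≡.subst (0 ℕ.<_) (≡.sym tail≡) (ℕ.s≤s ℕ.z≤n))
      in [ (λ a₀≤ai → pick zero (≡.subst (0 ℕ.<_) (≡.sym x₀≡) (ℕ.s≤s ℕ.z≤n)) ≤-refl
             (≤-trans (*-monoˡ-≤ (fromℕ-nonNegative tail) a₀≤ai) bound))
         , (λ ai≤a₀ → pick (suc i) 0<xi (*-monoˡ-≤ (fromℕ-nonNegative (x zero)) ai≤a₀) bound)
         ]′ (total (a zero) (a (suc i)))

  module InstanceProperties (I : Instance) where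

    open Instance I

    F : Fin m → ℕ → Carrier
    F i n = sum {n} (λ k → f i (suc (toℕ k)))

    F-suc : ∀ i n → F i (suc n) ≈ F i n + f i (suc n)
    F-suc i n = trans (sum-init-last {n} (λ k → f i (suc (toℕ k)))) (+-cong
      (sum-cong-≋ {n} (λ k → reflexive (≡.cong (f i ∘ suc) (Finₚ.toℕ-inject₁ k))))
      (reflexive (≡.cong (f i ∘ suc) (Finₚ.toℕ-fromℕ n))))

    R≈ : ∀ i n → R i n ≈ fromℕ n * r i + F i n
    R≈ i n = +-congʳ (sym (trans (×-assoc-* n 1# (r i)) (SemiringMult.×-congʳ semiring n (*-identityˡ (r i)))))

    marginal : Fin m → ℕ → Carrier
    marginal i k = r i + f i k

    R-suc : ∀ i n → R i (suc n) ≈ R i n + marginal i (suc n)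
    R-suc i n = begin
      (r i + n · r i) + F i (suc n)                 ≈⟨ +-congˡ (F-suc i n) ⟩
      (r i + n · r i) + (F i n + f i (suc n))       ≈⟨ solve 4 (λ r nr F f → (r :+ nr) :+ (F :+ f) := (nr :+ F) :+ (r :+ f))
                                                         refl (r i) (n · r i) (F i n) (f i (suc n)) ⟩
      (n · r i + F i n) + (r i + f i (suc n))       ∎
      where open SetoidReasoning setoid

    marginal-nonNegative : ∀ i k → 0# ≤ marginal i k
    marginal-nonNegative i k = +-nonNegative (r-nonneg i) (f-nonneg i k)

    R-step-≤ : ∀ i n → R i n ≤ R i (suc n)
    R-step-≤ i n = ≤-respʳ-≈ (sym (R-suc i n)) (≤-by-difference
      (solve 2 (λ x y → x :+ y :- x := y) refl (R i n) (marginal i (suc n))) (marginal-nonNegative i (suc n)))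

    R-mono : ∀ i {k n} → k ℕ.≤ n → R i k ≤ R i n
    R-mono i {k} k≤n = ≡.subst (λ n → R i k ≤ R i n) (ℕₚ.m∸n+n≡m k≤n) (grow (_ ∸ k))
      where
      grow : ∀ d → R i k ≤ R i (d ℕ.+ k)
      grow zero    = ≤-refl
      grow (suc d) = ≤-trans (grow d) (R-step-≤ i (d ℕ.+ k))

    R-nonNegative : ∀ i n → 0# ≤ R i n
    R-nonNegative i n = ≤-trans (≤-reflexive (sym (+-identityˡ 0#))) (R-mono i {0} {n} ℕ.z≤n)

    V-mono : ∀ {x y : Allocation m} → x ≼ y → V x ≤ V y
    V-mono x≼y = sum-mono (λ i → R-mono i (x≼y i))

    V-cong : ∀ {x y : Allocation m} → (∀ i → x i ≡ y i) → V x ≈ V y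
    V-cong x≗y = sum-cong-≋ (λ i → reflexive (≡.cong (R i) (x≗y i)))

    V-decrement : ∀ {x} i → 0 ℕ.< x i → V x ≈ V (decrement i x) + marginal i (x i)
    V-decrement {x} i 0<xi with ℕₚ.suc-pred (x i) {{ℕ.>-nonZero 0<xi}}
    ... | suc-pred≡ = ≡.subst (λ k → V x ≈ V (decrement i x) + marginal i k) suc-pred≡
      (sum-decrement R x i (≡.sym suc-pred≡) (R-suc i (ℕ.pred (x i))))

    V-nonNegative : ∀ x → 0# ≤ V x
    V-nonNegative x = sum-nonNegative (λ i → R-nonNegative i (x i))

    ∥∥≤C : ∀ {x} → Feasible x → ∥ x ∥₁ ℕ.≤ C
    ∥∥≤C = ∥∥-mono

    private
      candidates : ℕ → List (Allocation m)
      candidates ℓ = filter (λ x → ∥ x ∥₁ ℕₚ.≤? ℓ) (grid b)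

    V≤U : ∀ {x ℓ} → Feasible x → ∥ x ∥₁ ℕ.≤ ℓ → V x ≤ U ℓ
    V≤U {x} {ℓ} feasible ∥x∥≤ℓ =
      let y , y∈grid , y≗x = grid-complete feasible
      in ≤-respˡ-≈ (V-cong y≗x) (All.lookup (xs≤max (V (λ _ → 0)) (List.map V (candidates ℓ)))
        (∈-map⁺ V (∈-filter⁺ (λ x → ∥ x ∥₁ ℕₚ.≤? ℓ) y∈grid (≡.subst (ℕ._≤ ℓ) (≡.sym (∥∥-cong y≗x)) ∥x∥≤ℓ))))

    U-attained : ∀ ℓ → ∃[ x ] Feasible x × ∥ x ∥₁ ℕ.≤ ℓ × U ℓ ≡ V x
    U-attained ℓ with argmax-sel id (V (λ _ → 0)) (List.map V (candidates ℓ))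
    ... | inj₁ U≡V0 = (λ _ → 0) , (λ _ → ℕ.z≤n) , ≡.subst (ℕ._≤ ℓ) (≡.sym (∥∥-zero m)) ℕ.z≤n , U≡V0
    ... | inj₂ U∈ =
      let x , x∈ , U≡Vx = ∈-map⁻ V U∈
          x∈grid , ∥x∥≤ℓ = ∈-filter⁻ (λ x → ∥ x ∥₁ ℕₚ.≤? ℓ) {xs = grid b} x∈
      in x , grid-sound b x∈grid , ∥x∥≤ℓ , U≡Vx

    U≤-by : ∀ {ℓ v} → (∀ x → Feasible x → ∥ x ∥₁ ℕ.≤ ℓ → V x ≤ v) → U ℓ ≤ v
    U≤-by {ℓ} V≤v =
      let x , feasible , ∥x∥≤ℓ , U≡Vx = U-attained ℓ
      in ≤-trans (≤-reflexive (reflexive U≡Vx)) (V≤v x feasible ∥x∥≤ℓ)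

    U-mono : ∀ {k n} → k ℕ.≤ n → U k ≤ U n
    U-mono k≤n = U≤-by λ x feasible ∥x∥≤k → V≤U feasible (ℕₚ.≤-trans ∥x∥≤k k≤n)

    U-nonNegative : ∀ ℓ → 0# ≤ U ℓ
    U-nonNegative ℓ = ≤-trans (V-nonNegative (λ _ → 0)) (⊥≤max (V (λ _ → 0)) (List.map V (candidates ℓ)))

    U≤UC : ∀ ℓ → U ℓ ≤ U C
    U≤UC ℓ = U≤-by λ x feasible _ → V≤U feasible (∥∥≤C feasible)

    -- A target is optimal among allocations of size exactly K, whereas U also admits smaller ones.
    -- As K ≤ C, a smaller one can be filled up without losing value.
    U≤V-target : ∀ {K x} → IsTarget I K x → K ℕ.≤ C → U K ≤ V x
    U≤V-target {K} (_ , _ , maximal) K≤C = U≤-by λ y feasible ∥y∥≤K →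
      let z , y≼z , z≼b , ∥z∥≡K = extend y b K feasible ∥y∥≤K K≤C
      in ≤-trans (V-mono y≼z) (maximal z z≼b ∥z∥≡K)

    module Concave (concave : DiscreteConcave) where

      -- Concavity together with f(0) ≥ 0 makes f(k) / k nonincreasing; this is that fact with
      -- denominators cleared.
      f-star : ∀ i k → suc k ℕ.≤ b i → fromℕ k * f i (suc k) ≤ fromℕ (suc k) * f i k
      f-star i zero    _ = ≤-trans (≤-reflexive (zeroˡ _))
        (*-nonNegative (fromℕ-nonNegative 1) (f-nonneg i 0))
      f-star i (suc k) 2+k≤b = ≤-by-difference
        -- `fromℕ (suc (suc k))` unfolds to `1# + (1# + fromℕ k)`; the polynomial repeats this
        -- nesting so that both sides match definitionally.
        (solve 4 (λ κ f₀ f₁ f₂ → (con (+ 1) :+ (con (+ 1) :+ κ)) :* f₁ :- (con (+ 1) :+ κ) :* f₂ :=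
          (con (+ 1) :+ κ) :* ((f₁ :- f₀) :- (f₂ :- f₁)) :+ ((con (+ 1) :+ κ) :* f₀ :- κ :* f₁))
          refl (fromℕ k) (f i k) (f i (suc k)) (f i (suc (suc k))))
        (+-nonNegative (*-nonNegative (fromℕ-nonNegative (suc k)) (x≤y⇒0≤y-x (concave i k 2+k≤b)))
          (x≤y⇒0≤y-x (f-star i k (ℕₚ.<⇒≤ 2+k≤b))))

      -- By `f-star` the graph lies above the chord from the origin to (k , f(k)); the sum is at
      -- least that of the discrete triangle under the chord.
      f-area : ∀ i k → k ℕ.≤ b i → fromℕ (suc k) * f i k ≤ fromℤ (+ 2) * F i k
      f-area i zero    _ = ≤-reflexive (trans (*-congˡ (f-zero i)) (trans (zeroʳ _) (sym (zeroʳ _))))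
      f-area i (suc k) 1+k≤b = begin
        fromℕ (suc (suc k)) * f i (suc k)
          ≤⟨ ≤-by-difference
            (solve 4 (λ κ f₀ f₁ F → con (+ 2) :* (F :+ f₁) :- (con (+ 1) :+ (con (+ 1) :+ κ)) :* f₁ :=
              (con (+ 2) :* F :- (con (+ 1) :+ κ) :* f₀) :+ ((con (+ 1) :+ κ) :* f₀ :- κ :* f₁))
              refl (fromℕ k) (f i k) (f i (suc k)) (F i k))
            (+-nonNegative (x≤y⇒0≤y-x (f-area i k (ℕₚ.<⇒≤ 1+k≤b))) (x≤y⇒0≤y-x (f-star i k 1+k≤b))) ⟩
        fromℤ (+ 2) * (F i k + f i (suc k))   ≈⟨ *-congˡ (F-suc i k) ⟨
        fromℤ (+ 2) * F i (suc k)             ∎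
        where open ≤-Reasoning

      marginal-bound : ∀ i k → suc k ℕ.≤ b i →
        fromℕ (suc (suc k)) * marginal i (suc k) ≤ fromℤ (+ 2) * R i (suc k)
      marginal-bound i k 1+k≤b = begin
        fromℕ (suc (suc k)) * marginal i (suc k)
          ≤⟨ ≤-by-difference
            (solve 4 (λ κ r f F → con (+ 2) :* ((con (+ 1) :+ κ) :* r :+ F) :- (con (+ 1) :+ (con (+ 1) :+ κ)) :* (r :+ f) :=
              κ :* r :+ (con (+ 2) :* F :- (con (+ 1) :+ (con (+ 1) :+ κ)) :* f))
              refl (fromℕ k) (r i) (f i (suc k)) (F i (suc k)))
            (+-nonNegative (*-nonNegative (fromℕ-nonNegative k) (r-nonneg i)) (x≤y⇒0≤y-x (f-area i (suc k) 1+k≤b))) ⟩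
        fromℤ (+ 2) * (fromℕ (suc k) * r i + F i (suc k))   ≈⟨ *-congˡ (R≈ i (suc k)) ⟨
        fromℤ (+ 2) * R i (suc k)                           ∎
        where open ≤-Reasoning

      -- Since k / (k + 1) ≤ n / (n + 1) for k ≤ n, the bound of each product holds with a factor
      -- depending only on the total size, so it can be summed over products.
      weighted-marginal-bound : ∀ i k n → k ℕ.≤ b i → k ℕ.≤ n →
        fromℕ (suc n) * (fromℕ k * marginal i k) ≤ fromℕ n * (fromℤ (+ 2) * R i k)
      weighted-marginal-bound i zero n _ _ = ≤-trans
        (≤-reflexive (trans (*-congˡ (zeroˡ _)) (zeroʳ _)))
        (*-nonNegative (fromℕ-nonNegative n) (*-nonNegative (fromℤ-nonNegative 2) (R-nonNegative i 0)))
      weighted-marginal-bound i (suc k) n 1+k≤b 1+k≤n = ≤-by-difference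
        (solve 4 (λ κ ν g R → ν :* (con (+ 2) :* R) :- (con (+ 1) :+ ν) :* ((con (+ 1) :+ κ) :* g) :=
          ν :* (con (+ 2) :* R :- (con (+ 1) :+ (con (+ 1) :+ κ)) :* g) :+ (ν :- (con (+ 1) :+ κ)) :* g)
          refl (fromℕ k) (fromℕ n) (marginal i (suc k)) (R i (suc k)))
        (+-nonNegative
          (*-nonNegative (fromℕ-nonNegative n) (x≤y⇒0≤y-x (marginal-bound i k 1+k≤b)))
          (*-nonNegative (x≤y⇒0≤y-x (fromℕ-mono-≤ 1+k≤n)) (marginal-nonNegative i (suc k))))

      -- Removing the cheapest unit of an allocation of size n + 1 loses at most the fraction
      -- 2 / (n + 2) of its value, hence keeps the fraction n / (n + 2) ≥ n² / (n + 1)².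
      remove-cheapest : ∀ {x n} → Feasible x → ∥ x ∥₁ ≡ suc n →
        ∃[ y ] Feasible y × ∥ y ∥₁ ≡ n × fromℕ n ^ 2 * V x ≤ fromℕ (suc n) ^ 2 * V y
      remove-cheapest {x} {n} feasible ∥x∥≡ =
        let i , 0<xi , mean = below-weighted-mean x (λ j → marginal j (x j)) (≡.subst (0 ℕ.<_) (≡.sym ∥x∥≡) (ℕ.s≤s ℕ.z≤n))
            y = decrement i x
        in y , (λ j → ℕₚ.≤-trans (decrement-≼ i x j) (feasible j)) ,
          ℕₚ.suc-injective (≡.trans (≡.sym (∥decrement∥ i x 0<xi)) ∥x∥≡) ,
          value (V y) (marginal i (x i)) (V-decrement i 0<xi)
            (loss (marginal i (x i)) (≡.subst (λ k → fromℕ k * marginal i (x i) ≤ sum (λ j → fromℕ (x j) * marginal j (x j))) ∥x∥≡ mean))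
        where
        ν = fromℕ n

        sum-bound : fromℕ (suc (suc n)) * sum (λ j → fromℕ (x j) * marginal j (x j)) ≤ fromℕ (suc n) * (fromℤ (+ 2) * V x)
        sum-bound = begin
          fromℕ (suc (suc n)) * sum (λ j → fromℕ (x j) * marginal j (x j))
            ≈⟨ *-distribˡ-sum (fromℕ (suc (suc n))) (λ j → fromℕ (x j) * marginal j (x j)) ⟩
          sum (λ j → fromℕ (suc (suc n)) * (fromℕ (x j) * marginal j (x j)))
            ≤⟨ sum-mono (λ j → weighted-marginal-bound j (x j) (suc n) (feasible j) (≡.subst (x j ℕ.≤_) ∥x∥≡ (x≤∥x∥ x j))) ⟩
          sum (λ j → fromℕ (suc n) * (fromℤ (+ 2) * R j (x j)))
            ≈⟨ *-distribˡ-sum (fromℕ (suc n)) (λ j → fromℤ (+ 2) * R j (x j)) ⟨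
          fromℕ (suc n) * sum (λ j → fromℤ (+ 2) * R j (x j))
            ≈⟨ *-congˡ (*-distribˡ-sum (fromℤ (+ 2)) (λ j → R j (x j))) ⟨
          fromℕ (suc n) * (fromℤ (+ 2) * V x) ∎
          where open ≤-Reasoning

        loss : ∀ g → fromℕ (suc n) * g ≤ sum (λ j → fromℕ (x j) * marginal j (x j)) →
          fromℕ (suc (suc n)) * g ≤ fromℤ (+ 2) * V x
        loss g g≤mean = *-cancelˡ-≤ (fromℕ-positive {suc n} (ℕ.s≤s ℕ.z≤n)) (begin
          fromℕ (suc n) * (fromℕ (suc (suc n)) * g)     ≈⟨ solve 3 (λ a b g → a :* (b :* g) := b :* (a :* g)) refl _ _ g ⟩
          fromℕ (suc (suc n)) * (fromℕ (suc n) * g)     ≤⟨ *-monoˡ-≤ (fromℕ-nonNegative (suc (suc n))) g≤mean ⟩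
          fromℕ (suc (suc n)) * sum (λ j → fromℕ (x j) * marginal j (x j))   ≤⟨ sum-bound ⟩
          fromℕ (suc n) * (fromℤ (+ 2) * V x)           ∎)
          where open ≤-Reasoning

        value : ∀ v g → V x ≈ v + g → fromℕ (suc (suc n)) * g ≤ fromℤ (+ 2) * V x →
          ν ^ 2 * V x ≤ fromℕ (suc n) ^ 2 * v
        value v g Vx≈v+g g≤ = *-cancelˡ-≤ (fromℕ-positive {suc (suc n)} (ℕ.s≤s ℕ.z≤n)) (begin
          fromℕ (suc (suc n)) * (ν ^ 2 * V x)
            -- The surplus n V(x) arises from (n + 1)² - n (n + 2) = 1.
            ≤⟨ ≤-by-difference
              (solve 3 (λ ν Vx g →
                (con (+ 1) :+ (con (+ 1) :+ ν)) :* ((con (+ 1) :+ ν) :^ 2 :* (Vx :- g)) :- (con (+ 1) :+ (con (+ 1) :+ ν)) :* (ν :^ 2 :* Vx) :=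
                ν :* Vx :+ (con (+ 1) :+ ν) :^ 2 :* (con (+ 2) :* Vx :- (con (+ 1) :+ (con (+ 1) :+ ν)) :* g)) refl ν (V x) g)
              (+-nonNegative (*-nonNegative (fromℕ-nonNegative n) (V-nonNegative x))
                (*-nonNegative (^2-nonNegative (fromℕ (suc n))) (x≤y⇒0≤y-x g≤))) ⟩
          fromℕ (suc (suc n)) * (fromℕ (suc n) ^ 2 * (V x - g))
            ≈⟨ *-congˡ (*-congˡ (trans (+-congʳ Vx≈v+g) (solve 2 (λ v g → v :+ g :- g := v) refl v g))) ⟩
          fromℕ (suc (suc n)) * (fromℕ (suc n) ^ 2 * v) ∎)
          where open ≤-Reasoning

      U-step : ∀ n → fromℕ n ^ 2 * U (suc n) ≤ fromℕ (suc n) ^ 2 * U n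
      U-step n =
        let x , feasible , ∥x∥≤ , U≡Vx = U-attained (suc n)
        in ≤-respˡ-≈ (*-congˡ (sym (reflexive U≡Vx))) ([ smaller feasible , larger feasible ]′ (ℕₚ.m≤n⇒m<n∨m≡n ∥x∥≤))
        where
        smaller : ∀ {x} → Feasible x → ∥ x ∥₁ ℕ.< suc n → fromℕ n ^ 2 * V x ≤ fromℕ (suc n) ^ 2 * U n
        smaller feasible ∥x∥<1+n = *-mono-≤ (^2-nonNegative (fromℕ n)) (U-nonNegative n)
          (^2-mono-≤ (fromℕ-nonNegative n) (fromℕ-mono-≤ (ℕₚ.n≤1+n n))) (V≤U feasible (ℕ.s≤s⁻¹ ∥x∥<1+n))
        larger : ∀ {x} → Feasible x → ∥ x ∥₁ ≡ suc n → fromℕ n ^ 2 * V x ≤ fromℕ (suc n) ^ 2 * U n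
        larger feasible ∥x∥≡1+n =
          let y , y-feasible , ∥y∥≡n , bound = remove-cheapest feasible ∥x∥≡1+n
          in ≤-trans bound (*-monoˡ-≤ (^2-nonNegative (fromℕ (suc n))) (V≤U y-feasible (ℕₚ.≤-reflexive ∥y∥≡n)))

      U-scaling : ∀ {k n} → k ℕ.≤ n → fromℕ k ^ 2 * U n ≤ fromℕ n ^ 2 * U k
      U-scaling {k} {n} k≤n = ≡.subst (λ n → fromℕ k ^ 2 * U n ≤ fromℕ n ^ 2 * U k) (ℕₚ.m∸n+n≡m k≤n) (go (n ∸ k))
        where
        go : ∀ d → fromℕ k ^ 2 * U (d ℕ.+ k) ≤ fromℕ (d ℕ.+ k) ^ 2 * U k
        go zero    = ≤-refl
        -- The telescoping cancels (d + k)². If that is 0 then k = 0, and the left side vanishes.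
        go (suc d) = [ positive , (λ d+k≡0 → trivial (ℕₚ.m+n≡0⇒n≡0 d (≡.sym d+k≡0))) ]′ (ℕₚ.m≤n⇒m<n∨m≡n ℕ.z≤n)
          where
          q = d ℕ.+ k
          trivial : k ≡ 0 → fromℕ k ^ 2 * U (suc q) ≤ fromℕ (suc q) ^ 2 * U k
          trivial k≡0 = ≤-trans
            (≤-reflexive (trans (*-congʳ (trans (^-congˡ 2 (reflexive (≡.cong fromℕ k≡0))) (zeroˡ _))) (zeroˡ _)))
            (*-nonNegative (^2-nonNegative (fromℕ (suc q))) (U-nonNegative k))
          positive : 0 ℕ.< q → fromℕ k ^ 2 * U (suc q) ≤ fromℕ (suc q) ^ 2 * U k
          positive 0<q = *-cancelˡ-≤ (*-positive (fromℕ-positive 0<q) (*-positive (fromℕ-positive 0<q) 0<1)) (begin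
            fromℕ q ^ 2 * (fromℕ k ^ 2 * U (suc q))      ≈⟨ swap _ _ _ ⟩
            fromℕ k ^ 2 * (fromℕ q ^ 2 * U (suc q))      ≤⟨ *-monoˡ-≤ (^2-nonNegative (fromℕ k)) (U-step q) ⟩
            fromℕ k ^ 2 * (fromℕ (suc q) ^ 2 * U q)      ≈⟨ swap _ _ _ ⟩
            fromℕ (suc q) ^ 2 * (fromℕ k ^ 2 * U q)      ≤⟨ *-monoˡ-≤ (^2-nonNegative (fromℕ (suc q))) (go d) ⟩
            fromℕ (suc q) ^ 2 * (fromℕ q ^ 2 * U k)      ≈⟨ swap _ _ _ ⟩
            fromℕ q ^ 2 * (fromℕ (suc q) ^ 2 * U k)      ∎)
            where
            open ≤-Reasoning
            swap : ∀ x y z → x * (y * z) ≈ y * (x * z)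
            swap = solve 3 (λ x y z → x :* (y :* z) := y :* (x :* z)) refl

-- Analysis of Intermediate Target Repair.

module TargetRepair (ℝ : RealField) where

  open Order ℝ
  open Certificates ℝ
  open Allocations ℝ
  open Benchmark ℝ
  open OnlineAllocation ℝ

  take-++-≤ : ∀ {X : Set} h (xs ys : List X) → h ℕ.≤ length xs → take h (xs ++ ys) ≡ take h xs
  take-++-≤ zero    xs       ys h≤       = ≡.refl
  take-++-≤ (suc h) (x ∷ xs) ys (ℕ.s≤s h≤) = ≡.cong (x ∷_) (take-++-≤ h xs ys h≤)

  take-++-≥ : ∀ {X : Set} (xs ys : List X) k → take (length xs ℕ.+ k) (xs ++ ys) ≡ xs ++ take k ys
  take-++-≥ []       ys k = ≡.refl
  take-++-≥ (x ∷ xs) ys k = ≡.cong (x ∷_) (take-++-≥ xs ys k)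

  -- With λ = (θ - 1)² / α², this bounds H α θ times the benchmark u by (1 - λ) v + λ g, where v and g
  -- are the values of the allocation before and after the repair.
  H-bound : ∀ {α θ u v g} → 0# < α → 1# ≤ θ → θ ≤ 1# + α → 0# ≤ u → 0# ≤ g →
    α ^ 2 * u ≤ (1# + α) ^ 2 * θ ^ 2 * v → u ≤ g ⊎ α ^ 2 * u ≤ θ ^ 2 * g →
    H α θ * u ≤ v + (θ - 1#) ^ 2 * (1# / α ^ 2) * (g - v)
  H-bound {α} {θ} {u} {v} {g} 0<α 1≤θ θ≤1+α 0≤u 0≤g before after = begin
    H α θ * u
      ≈⟨ solve 5 (λ q μ w e u → (q :* μ :+ w :* e) :* u := q :* (μ :* u) :+ w :* (e :* u)) refl q (ia ⊓ ib) (A - q) e u ⟩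
    q * ((ia ⊓ ib) * u) + (A - q) * (e * u)
      ≤⟨ +-mono-≤ (*-monoˡ-≤ (^2-nonNegative (θ - 1#)) repaired) (*-monoˡ-≤ 0≤A-q unrepaired) ⟩
    q * (ia * g) + (A - q) * (ia * v)
      ≈⟨ solve 5 (λ q i g A v → q :* (i :* g) :+ (A :- q) :* (i :* v) := (i :* A) :* v :+ q :* i :* (g :- v)) refl q ia g A v ⟩
    (ia * A) * v + q * ia * (g - v)
      ≈⟨ +-congʳ (trans (*-congʳ iaA≈1) (*-identityˡ v)) ⟩
    v + q * ia * (g - v) ∎
    where
    open ≤-Reasoning
    A = α ^ 2
    B = θ ^ 2
    E = (1# + α) ^ 2
    q = (θ - 1#) ^ 2
    ia = 1# / A
    ib = 1# / B
    e = (E * B) ⁻¹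
    0<A = ^2-positive 0<α
    0<B = ^2-positive (<-≤-trans 0<1 1≤θ)
    0<EB : 0# < E * B
    0<EB = *-positive (^2-positive (+-positive 0<1 0<α)) 0<B
    iaA≈1 : ia * A ≈ 1#
    iaA≈1 = /-cancelʳ 1# 0<A
    ibB≈1 : ib * B ≈ 1#
    ibB≈1 = /-cancelʳ 1# 0<B
    0≤ia : 0# ≤ ia
    0≤ia = <⇒≤ (/-positive 0<1 0<A)
    0≤ib : 0# ≤ ib
    0≤ib = <⇒≤ (/-positive 0<1 0<B)

    0≤A-q : 0# ≤ A - q
    0≤A-q = x≤y⇒0≤y-x (^2-mono-≤ (x≤y⇒0≤y-x 1≤θ) (≤-by-difference
      (solve 2 (λ α θ → α :- (θ :- con (+ 1)) := con (+ 1) :+ α :- θ) refl α θ) (x≤y⇒0≤y-x θ≤1+α)))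

    -- The alternative selects the side of the minimum: 1 / α² if g already dominates u, 1 / θ² if
    -- only the scaled comparison is available.
    repaired : (ia ⊓ ib) * u ≤ ia * g
    repaired = [ (λ u≤g → ≤-trans (*-monoʳ-≤ 0≤u (x⊓y≤x ia ib)) (*-monoˡ-≤ 0≤ia u≤g))
      , (λ Au≤Bg → begin
          (ia ⊓ ib) * u        ≤⟨ *-monoʳ-≤ 0≤u (x⊓y≤y ia ib) ⟩
          ib * u               ≈⟨ *-congˡ (trans (*-congʳ iaA≈1) (*-identityˡ u)) ⟨
          ib * (ia * A * u)    ≈⟨ solve 4 (λ a b A u → b :* (a :* A :* u) := b :* a :* (A :* u)) refl ia ib A u ⟩
          ib * ia * (A * u)    ≤⟨ *-monoˡ-≤ (*-nonNegative 0≤ib 0≤ia) Au≤Bg ⟩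
          ib * ia * (B * g)    ≈⟨ solve 4 (λ a b B g → b :* a :* (B :* g) := a :* (b :* B :* g)) refl ia ib B g ⟩
          ia * (ib * B * g)    ≈⟨ *-congˡ (trans (*-congʳ ibB≈1) (*-identityˡ g)) ⟩
          ia * g               ∎) ]′ after

    unrepaired : e * u ≤ ia * v
    unrepaired = begin
      e * u                    ≈⟨ *-congˡ (trans (*-congʳ iaA≈1) (*-identityˡ u)) ⟨
      e * (ia * A * u)         ≈⟨ solve 4 (λ e a A u → e :* (a :* A :* u) := e :* a :* (A :* u)) refl e ia A u ⟩
      e * ia * (A * u)         ≤⟨ *-monoˡ-≤ (*-nonNegative (<⇒≤ (⁻¹-positive 0<EB)) 0≤ia) before ⟩
      e * ia * (E * B * v)     ≈⟨ solve 4 (λ e a D v → e :* a :* (D :* v) := a :* (e :* D :* v)) refl e ia (E * B) v ⟩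
      ia * (e * (E * B) * v)   ≈⟨ *-congˡ (trans (*-congʳ (⁻¹-inverseˡ 0<EB)) (*-identityˡ v)) ⟩
      ia * v                   ∎

  H-at-1≤1 : ∀ {α} → 0# < α → H α 1# ≤ 1#
  H-at-1≤1 {α} 0<α = 0≤-gap₁⇒H≤ 0<α 0<1 ratio-1 ratio-1 ratio-1 (≤-by-difference
    (solve 1 (λ α → :- gap₁ᴾ α (con (+ 1)) (con (+ 1)) (con (+ 1)) (con (+ 1)) (con (+ 1)) :- con (+ 0) :=
      α :^ 2 :* (con (+ 1) :+ con (+ 2) :* α)) refl α)
    (*-nonNegative (^2-nonNegative α) (+-nonNegative (<⇒≤ 0<1) (*-nonNegative (fromℤ-nonNegative 2) (<⇒≤ 0<α)))))

  module Analysis (I : Instance) (concave : Instance.DiscreteConcave I)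
    {α c : Carrier} (1<α : 1# < α) (c≤H : ∀ θ → 1# ≤ θ → θ ≤ 1# + α → c ≤ H α θ) where

    open Instance I
    open InstanceProperties I
    open Concave concave

    private
      0<α : 0# < α
      0<α = <-trans 0<1 1<α

    -- Wherever the algorithm matches the benchmark exactly, with no arrivals, no capacity or
    -- everything sold, this suffices for the competitive bound.
    c≤1 : c ≤ 1#
    c≤1 = ≤-trans (c≤H 1# ≤-refl (≤-by-difference
      (solve 1 (λ α → con (+ 1) :+ α :- con (+ 1) := α) refl α) (<⇒≤ 0<α))) (H-at-1≤1 0<α)

    cU≤U : ∀ ℓ → c * U ℓ ≤ U ℓ
    cU≤U ℓ = ≤-respʳ-≈ (*-identityˡ _) (*-monoʳ-≤ (U-nonNegative ℓ) c≤1)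

    -- Sizes are measured in units of σ, later the size at the phase start, so that the real ratios
    -- 1, α, 1 + α and θ replace natural numbers and σ² cancels.
    U-scaling-real : ∀ {k n σ x y} → 0# < σ → fromℕ k ≈ x * σ → fromℕ n ≈ y * σ → k ℕ.≤ n →
      x ^ 2 * U n ≤ y ^ 2 * U k
    U-scaling-real {k} {n} {σ} {x} {y} 0<σ k≈ n≈ k≤n = *-cancelˡ-≤ (^2-positive 0<σ) (begin
      σ ^ 2 * (x ^ 2 * U n)    ≈⟨ solve 3 (λ s x u → s :^ 2 :* (x :^ 2 :* u) := (x :* s) :^ 2 :* u) refl σ x (U n) ⟩
      (x * σ) ^ 2 * U n        ≈⟨ *-congʳ (^-congˡ 2 k≈) ⟨
      fromℕ k ^ 2 * U n        ≤⟨ U-scaling k≤n ⟩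
      fromℕ n ^ 2 * U k        ≈⟨ *-congʳ (^-congˡ 2 n≈) ⟩
      (y * σ) ^ 2 * U k        ≈⟨ solve 3 (λ s y u → (y :* s) :^ 2 :* u := s :^ 2 :* (y :^ 2 :* u)) refl σ y (U k) ⟩
      σ ^ 2 * (y ^ 2 * U k)    ∎)
      where open ≤-Reasoning

    -- Three regimes: a target of size C attains the largest benchmark, a size up to α S is covered
    -- by monotonicity, and beyond α S the quadratic scaling applies.
    target-bound : ∀ {αS n σ θ} → 0# < σ → fromℕ αS ≈ α * σ → fromℕ n ≈ θ * σ →
      U n ≤ U (αS ℕ.⊓ C) ⊎ α ^ 2 * U n ≤ θ ^ 2 * U (αS ℕ.⊓ C)
    target-bound {αS} {n} 0<σ αS≈ n≈ with ℕₚ.⊓-sel αS C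
    ... | inj₂ K≡C = inj₁ (≡.subst (λ K → U n ≤ U K) (≡.sym K≡C) (U≤UC n))
    ... | inj₁ K≡αS = ≡.subst (λ K → U n ≤ U K ⊎ _ * U n ≤ _ * U K) (≡.sym K≡αS)
      ([ (λ n≤αS → inj₁ (U-mono n≤αS)) , (λ αS≤n → inj₂ (U-scaling-real 0<σ αS≈ n≈ αS≤n)) ]′ (ℕₚ.≤-total n αS))

    -- Invariant at phase starts.
    Balanced : Allocation m → Set
    Balanced s = ∥ s ∥₁ ℕ.< C → α ^ 2 * U ∥ s ∥₁ ≤ (1# + α) ^ 2 * V s

    module Phase {s xᴷ : Allocation m} {αS : ℕ} {η : List (Fin m)} (balanced : α ^ 2 * U ∥ s ∥₁ ≤ (1# + α) ^ 2 * V s)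
      (1≤S : 1 ℕ.≤ ∥ s ∥₁) (αS≈ : fromℕ αS ≈ α * fromℕ ∥ s ∥₁) (target : IsTarget I (αS ℕ.⊓ C) xᴷ)
      (repair : PrefixRobust I s (λ i → xᴷ i ∸ s i) η) where

      open PrefixRobust repair

      private
        S = ∥ s ∥₁
        σ = fromℕ S
        d : Allocation m
        d i = xᴷ i ∸ s i
        g = V (s ⊕ d)
        0<σ : 0# < σ
        0<σ = fromℕ-positive 1≤S

      length-η : length η ≡ D
      length-η = ≡.trans (≡.sym (∥count∥ η)) (∥∥-cong copies)

      V≤g : V s ≤ g
      V≤g = V-mono (λ i → ℕₚ.m≤m+n (s i) (d i))

      U-target≤g : U (αS ℕ.⊓ C) ≤ g
      U-target≤g = ≤-trans (U≤V-target target (ℕₚ.m⊓n≤n αS C)) (V-mono (λ i → ℕₚ.m≤n+m∸n (xᴷ i) (s i)))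

      -- What makes the completed fraction h / D at least h / (α S) = (θ - 1) / α.
      D≤αS : D ℕ.≤ αS
      D≤αS = ℕₚ.≤-trans (∥∥-mono (λ i → ℕₚ.m∸n≤m (xᴷ i) (s i)))
        (ℕₚ.≤-trans (ℕₚ.≤-reflexive (proj₁ (proj₂ target))) (ℕₚ.m⊓n≤m αS C))

      after-repair : ∀ ρ k → g ≤ V (s ⊕ count (take (length η ℕ.+ k) (η ++ ρ)))
      after-repair ρ k = V-mono λ i → ℕₚ.+-monoʳ-≤ (s i) (begin
        d i                                           ≡⟨ copies i ⟨
        count η i                                     ≤⟨ ℕₚ.m≤m+n _ _ ⟩
        count η i ℕ.+ count (take k ρ) i              ≡⟨ count-++ η (take k ρ) i ⟨
        count (η ++ take k ρ) i                       ≡⟨ ≡.cong (λ τ → count τ i) (take-++-≥ η ρ k) ⟨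
        count (take (length η ℕ.+ k) (η ++ ρ)) i      ∎)
        where open ℕₚ.≤-Reasoning

      module _ (h : ℕ) (within : fromℕ (S ℕ.+ h) ≤ (1# + α) * σ) where

        private
          θ λ² : Carrier
          θ = fromℕ (S ℕ.+ h) / σ
          λ² = (θ - 1#) ^ 2 * (1# / α ^ 2)
          θσ≈ : θ * σ ≈ fromℕ (S ℕ.+ h)
          θσ≈ = /-cancelʳ _ 0<σ
          1≤θ : 1# ≤ θ
          1≤θ = *-cancelʳ-≤ 0<σ (≤-respˡ-≈ (sym (*-identityˡ σ)) (≤-respʳ-≈ (sym θσ≈) (fromℕ-mono-≤ (ℕₚ.m≤m+n S h))))
          θ≤1+α : θ ≤ 1# + α
          θ≤1+α = *-cancelʳ-≤ 0<σ (≤-respˡ-≈ (sym θσ≈) within)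
          [θ-1]σ≈h : (θ - 1#) * σ ≈ fromℕ h
          [θ-1]σ≈h = begin
            (θ - 1#) * σ              ≈⟨ solve 2 (λ θ σ → (θ :- con (+ 1)) :* σ := θ :* σ :- σ) refl θ σ ⟩
            θ * σ - σ                 ≈⟨ +-congʳ (trans θσ≈ (fromℕ-+ S h)) ⟩
            σ + fromℕ h - σ           ≈⟨ solve 2 (λ σ h → σ :+ h :- σ := h) refl σ (fromℕ h) ⟩
            fromℕ h                   ∎
            where open SetoidReasoning setoid

        λ²α²≈ : λ² * α ^ 2 ≈ (θ - 1#) ^ 2
        λ²α²≈ = trans (*-assoc _ _ _) (trans (*-congˡ (/-cancelʳ 1# (^2-positive 0<α))) (*-identityʳ _))

        λ²≤1 : λ² ≤ 1#
        λ²≤1 = *-cancelʳ-≤ (^2-positive 0<α) (≤-respˡ-≈ (sym λ²α²≈) (≤-respʳ-≈ (sym (*-identityˡ _))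
          (^2-mono-≤ (x≤y⇒0≤y-x 1≤θ) (≤-by-difference
            (solve 2 (λ α θ → α :- (θ :- con (+ 1)) := con (+ 1) :+ α :- θ) refl α θ) (x≤y⇒0≤y-x θ≤1+α)))))

        cU≤mixture : c * U (S ℕ.+ h) ≤ V s + λ² * (g - V s)
        cU≤mixture = ≤-trans (*-monoʳ-≤ (U-nonNegative _) (c≤H θ 1≤θ θ≤1+α))
          (H-bound 0<α 1≤θ θ≤1+α (U-nonNegative (S ℕ.+ h)) (V-nonNegative (s ⊕ d)) before after)
          where
          before : α ^ 2 * U (S ℕ.+ h) ≤ (1# + α) ^ 2 * θ ^ 2 * V s
          before = begin
            α ^ 2 * U (S ℕ.+ h)                  ≈⟨ *-congˡ (trans (*-congʳ (solve 0 (con (+ 1) :^ 2 := con (+ 1)) refl)) (*-identityˡ _)) ⟨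
            α ^ 2 * (1# ^ 2 * U (S ℕ.+ h))       ≤⟨ *-monoˡ-≤ (^2-nonNegative α)
                                                      (U-scaling-real 0<σ (sym (*-identityˡ σ)) (sym θσ≈) (ℕₚ.m≤m+n S h)) ⟩
            α ^ 2 * (θ ^ 2 * U S)                ≈⟨ solve 3 (λ α θ u → α :^ 2 :* (θ :^ 2 :* u) := θ :^ 2 :* (α :^ 2 :* u)) refl α θ (U S) ⟩
            θ ^ 2 * (α ^ 2 * U S)                ≤⟨ *-monoˡ-≤ (^2-nonNegative θ) balanced ⟩
            θ ^ 2 * ((1# + α) ^ 2 * V s)         ≈⟨ solve 3 (λ α θ v → θ :^ 2 :* ((con (+ 1) :+ α) :^ 2 :* v) :=
                                                      (con (+ 1) :+ α) :^ 2 :* θ :^ 2 :* v) refl α θ (V s) ⟩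
            (1# + α) ^ 2 * θ ^ 2 * V s           ∎
            where open ≤-Reasoning
          after : U (S ℕ.+ h) ≤ g ⊎ α ^ 2 * U (S ℕ.+ h) ≤ θ ^ 2 * g
          after = [ (λ U≤ → inj₁ (≤-trans U≤ U-target≤g))
            , (λ AU≤ → inj₂ (≤-trans AU≤ (*-monoˡ-≤ (^2-nonNegative θ) U-target≤g))) ]′ (target-bound 0<σ αS≈ (sym θσ≈))

        mixture≤g : V s + λ² * (g - V s) ≤ g
        mixture≤g = ≤-by-difference
          (solve 3 (λ v g l → g :- (v :+ l :* (g :- v)) := (con (+ 1) :- l) :* (g :- v)) refl (V s) g λ²)
          (*-nonNegative (x≤y⇒0≤y-x λ²≤1) (x≤y⇒0≤y-x V≤g))

        -- The case h = 0 is separate because D may then be 0, where the inverse has an unspecified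
        -- value; both sides are squares or zero there.
        λ²≤prefix : h ℕ.≤ D → λ² ≤ (fromℕ h / fromℕ D) ^ 2
        λ²≤prefix h≤D = [ positive , none ]′ (ℕₚ.m≤n⇒m<n∨m≡n {0} {h} ℕ.z≤n)
          where
          none : 0 ≡ h → λ² ≤ (fromℕ h / fromℕ D) ^ 2
          none 0≡h = ≤-respˡ-≈ (sym (trans (*-congʳ (trans (^-congˡ 2 θ-1≈0) (zeroˡ _))) (zeroˡ _))) (^2-nonNegative _)
            where
            θ-1≈0 : θ - 1# ≈ 0#
            θ-1≈0 = ≤-antisym
              (*-cancelʳ-≤ 0<σ (≤-reflexive (trans [θ-1]σ≈h (trans (reflexive (≡.cong fromℕ (≡.sym 0≡h))) (sym (zeroˡ σ))))))
              (x≤y⇒0≤y-x 1≤θ)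
          positive : 0 ℕ.< h → λ² ≤ (fromℕ h / fromℕ D) ^ 2
          positive 0<h = *-cancelʳ-≤ (^2-positive 0<α) (begin
            λ² * α ^ 2              ≈⟨ λ²α²≈ ⟩
            (θ - 1#) ^ 2            ≤⟨ ^2-mono-≤ (x≤y⇒0≤y-x 1≤θ) θ-1≤ ⟩
            (p′ * α) ^ 2            ≈⟨ solve 2 (λ x a → (x :* a) :^ 2 := x :^ 2 :* a :^ 2) refl p′ α ⟩
            p′ ^ 2 * α ^ 2          ∎)
            where
            open ≤-Reasoning
            p′ = fromℕ h / fromℕ D
            0<D : 0# < fromℕ D
            0<D = fromℕ-positive (ℕₚ.<-≤-trans 0<h h≤D)
            θ-1≤ : θ - 1# ≤ p′ * α
            θ-1≤ = *-cancelʳ-≤ 0<D (begin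
              (θ - 1#) * fromℕ D       ≤⟨ *-monoˡ-≤ (x≤y⇒0≤y-x 1≤θ) (fromℕ-mono-≤ D≤αS) ⟩
              (θ - 1#) * fromℕ αS      ≈⟨ *-congˡ αS≈ ⟩
              (θ - 1#) * (α * σ)       ≈⟨ solve 3 (λ t a s → t :* (a :* s) := t :* s :* a) refl (θ - 1#) α σ ⟩
              (θ - 1#) * σ * α         ≈⟨ *-congʳ [θ-1]σ≈h ⟩
              fromℕ h * α              ≈⟨ *-congʳ (/-cancelʳ (fromℕ h) 0<D) ⟨
              p′ * fromℕ D * α         ≈⟨ solve 3 (λ x d a → x :* d :* a := x :* a :* d) refl p′ (fromℕ D) α ⟩
              p′ * α * fromℕ D         ∎)

        -- ρ stands for everything after η, filler and later phases alike. Once η is complete the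
        -- value is at least g, which already exceeds the mixture, so only prefixes of η call on
        -- robustness.
        within-phase : ∀ ρ → c * U (S ℕ.+ h) ≤ V (s ⊕ count (take h (η ++ ρ)))
        within-phase ρ = ≤-trans cU≤mixture ([ during , finished ]′ (ℕₚ.≤-total h (length η)))
          where
          during : h ℕ.≤ length η → V s + λ² * (g - V s) ≤ V (s ⊕ count (take h (η ++ ρ)))
          during h≤ = ≡.subst (λ τ → V s + λ² * (g - V s) ≤ V (s ⊕ count τ)) (≡.sym (take-++-≤ h η ρ h≤)) (begin
            V s + λ² * (g - V s)
              ≤⟨ +-monoʳ-≤ (V s) (*-monoʳ-≤ (x≤y⇒0≤y-x V≤g) (λ²≤prefix h≤D)) ⟩
            V s + (fromℕ h / fromℕ D) ^ 2 * (g - V s)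
              ≤⟨ +-monoʳ-≤ (V s) (robust h h≤D) ⟩
            V s + (V (s ⊕ count (take h η)) - V s)
              ≈⟨ solve 2 (λ v w → v :+ (w :- v) := w) refl (V s) (V (s ⊕ count (take h η))) ⟩
            V (s ⊕ count (take h η)) ∎)
            where
            open ≤-Reasoning
            h≤D = ≡.subst (h ℕ.≤_) length-η h≤
          finished : length η ℕ.≤ h → V s + λ² * (g - V s) ≤ V (s ⊕ count (take h (η ++ ρ)))
          finished η≤h = ≤-trans mixture≤g (≡.subst (λ k → g ≤ V (s ⊕ count (take k (η ++ ρ))))
            (ℕₚ.m+[n∸m]≡n η≤h) (after-repair ρ (h ∸ length η)))

      -- A phase that ends below C has size exactly (1 + α) S, and η is complete by then;
      -- `target-bound` at θ = 1 + α is the invariant, or else U is dominated outright and α² ≤ (1 +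
      -- α)² suffices.
      next-balanced : ∀ {[1+α]S} → fromℕ [1+α]S ≈ (1# + α) * σ → ∀ ζ →
        ∥ s ⊕ count (η ++ ζ) ∥₁ ≡ [1+α]S ℕ.⊓ C → Balanced (s ⊕ count (η ++ ζ))
      next-balanced {[1+α]S} [1+α]S≈ ζ ∥s′∥≡ ∥s′∥<C =
        [ (λ U≤ → *-mono-≤ (^2-nonNegative α) (V-nonNegative s′) A≤E (≤-trans U≤ U-target≤V))
        , (λ AU≤ → ≤-trans AU≤ (*-monoˡ-≤ (^2-nonNegative (1# + α)) U-target≤V)) ]′
        (target-bound 0<σ αS≈ (trans (reflexive (≡.cong fromℕ ∥s′∥≡[1+α]S)) [1+α]S≈))
        where
        s′ = s ⊕ count (η ++ ζ)
        A≤E : α ^ 2 ≤ (1# + α) ^ 2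
        A≤E = ^2-mono-≤ (<⇒≤ 0<α) (≤-by-difference
          (solve 1 (λ α → con (+ 1) :+ α :- α := con (+ 1)) refl α) (<⇒≤ 0<1))
        ∥s′∥≡[1+α]S : ∥ s′ ∥₁ ≡ [1+α]S
        ∥s′∥≡[1+α]S = [ ≡.trans ∥s′∥≡ , (λ ≡C → contradiction (≡.trans ∥s′∥≡ ≡C) (ℕₚ.<⇒≢ ∥s′∥<C)) ]′ (ℕₚ.⊓-sel [1+α]S C)
        U-target≤V : U (αS ℕ.⊓ C) ≤ V s′
        U-target≤V = ≤-trans U-target≤g (V-mono λ i → ℕₚ.+-monoʳ-≤ (s i)
          (≡.subst₂ ℕ._≤_ (copies i) (≡.sym (count-++ η ζ i)) (ℕₚ.m≤m+n (count η i) (count ζ i))))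

    -- Induction over the phases for every stopping time h: past the end of a phase, `take` peels
    -- off its assignments and the remaining arrivals are counted from the next start.
    from-phase-start : ∀ {s σ} → Phases I α s σ → Feasible s → 1 ℕ.≤ ∥ s ∥₁ → Balanced s →
      ∀ h → c * U (∥ s ∥₁ ℕ.+ h) ≤ V (s ⊕ count (take h σ))
    from-phase-start {s} (full ∥s∥≡C) feasible _ _ h = begin
      c * U (∥ s ∥₁ ℕ.+ h)             ≤⟨ cU≤U _ ⟩
      U (∥ s ∥₁ ℕ.+ h)                 ≤⟨ U≤-by (λ x x-feasible _ → V-mono λ i → ℕₚ.≤-trans (x-feasible i)
                                            (ℕₚ.≤-trans (≼∧∥∥≥⇒≽ feasible (ℕₚ.≤-reflexive (≡.sym ∥s∥≡C)) i) (ℕₚ.m≤m+n (s i) _))) ⟩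
      V (s ⊕ count (take h []))        ∎
      where open ≤-Reasoning
    from-phase-start {s} (phase S<C αS [1+α]S αS≈ [1+α]S≈ xᴷ target η repair ζ ∥s′∥≡ s′-feasible σ phases)
      feasible 1≤S balanced h = [ inside , beyond ]′ (ℕₚ.≤-total h len)
      where
      open Phase (balanced S<C) 1≤S αS≈ target repair
      s′ = s ⊕ count (η ++ ζ)
      len = length (η ++ ζ)
      ∥s′∥≡S+len : ∥ s′ ∥₁ ≡ ∥ s ∥₁ ℕ.+ len
      ∥s′∥≡S+len = ≡.trans (∥∥-⊕ s (count (η ++ ζ))) (≡.cong (∥ s ∥₁ ℕ.+_) (∥count∥ (η ++ ζ)))

      inside : h ℕ.≤ len → c * U (∥ s ∥₁ ℕ.+ h) ≤ V (s ⊕ count (take h ((η ++ ζ) ++ σ)))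
      inside h≤len = ≡.subst (λ τ → c * U (∥ s ∥₁ ℕ.+ h) ≤ V (s ⊕ count (take h τ)))
        (≡.sym (Listₚ.++-assoc η ζ σ)) (within-phase h within (ζ ++ σ))
        where
        within : fromℕ (∥ s ∥₁ ℕ.+ h) ≤ (1# + α) * fromℕ ∥ s ∥₁
        within = ≤-respʳ-≈ [1+α]S≈ (fromℕ-mono-≤ (ℕₚ.≤-trans (ℕₚ.+-monoʳ-≤ ∥ s ∥₁ h≤len)
          (ℕₚ.≤-trans (ℕₚ.≤-reflexive (≡.trans (≡.sym ∥s′∥≡S+len) ∥s′∥≡)) (ℕₚ.m⊓n≤m [1+α]S C))))

      beyond : len ℕ.≤ h → c * U (∥ s ∥₁ ℕ.+ h) ≤ V (s ⊕ count (take h ((η ++ ζ) ++ σ)))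
      beyond len≤h = ≡.subst (λ h → c * U (∥ s ∥₁ ℕ.+ h) ≤ V (s ⊕ count (take h ((η ++ ζ) ++ σ)))) (ℕₚ.m+[n∸m]≡n len≤h)
        (later (h ∸ len) (from-phase-start phases s′-feasible
          (ℕₚ.≤-trans 1≤S (≡.subst (∥ s ∥₁ ℕ.≤_) (≡.sym ∥s′∥≡S+len) (ℕₚ.m≤m+n ∥ s ∥₁ len)))
          (next-balanced [1+α]S≈ ζ ∥s′∥≡) (h ∸ len)))
        where
        later : ∀ k → c * U (∥ s′ ∥₁ ℕ.+ k) ≤ V (s′ ⊕ count (take k σ)) →
          c * U (∥ s ∥₁ ℕ.+ (len ℕ.+ k)) ≤ V (s ⊕ count (take (len ℕ.+ k) ((η ++ ζ) ++ σ)))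
        later k bound = begin
          c * U (∥ s ∥₁ ℕ.+ (len ℕ.+ k))
            ≡⟨ ≡.cong (λ n → c * U n) (≡.trans (≡.cong (ℕ._+ k) ∥s′∥≡S+len) (ℕₚ.+-assoc ∥ s ∥₁ len k)) ⟨
          c * U (∥ s′ ∥₁ ℕ.+ k)
            ≤⟨ bound ⟩
          V (s′ ⊕ count (take k σ))
            ≈⟨ V-cong (λ i → ≡.trans (ℕₚ.+-assoc (s i) _ _) (≡.cong (s i ℕ.+_)
                 (≡.trans (≡.sym (count-++ (η ++ ζ) (take k σ) i)) (≡.cong (λ τ → count τ i) (≡.sym (take-++-≥ (η ++ ζ) σ k)))))) ⟩
          V (s ⊕ count (take (len ℕ.+ k) ((η ++ ζ) ++ σ))) ∎
          where open ≤-Reasoning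

    ∥x∥≤0⇒V≤ : ∀ {x} y → ∥ x ∥₁ ℕ.≤ 0 → V x ≤ V y
    ∥x∥≤0⇒V≤ {x} y ∥x∥≤0 = V-mono {x} {y} λ i → ℕₚ.≤-trans (ℕₚ.≤-trans (x≤∥x∥ x i) ∥x∥≤0) ℕ.z≤n

    U1≤first : ∀ i⋆ → (∀ i → 0 ℕ.< b i → R i 1 ≤ R i⋆ 1) → U 1 ≤ V (count [ i⋆ ])
    U1≤first i⋆ best = U≤-by λ x feasible ∥x∥≤1 →
      [ (λ ∥x∥<1 → ∥x∥≤0⇒V≤ (count [ i⋆ ]) (ℕ.s≤s⁻¹ ∥x∥<1)) , single feasible ]′ (ℕₚ.m≤n⇒m<n∨m≡n ∥x∥≤1)
      where
      open ≤-Reasoning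
      0<count : 0 ℕ.< count [ i⋆ ] i⋆
      0<count = ≡.subst (0 ℕ.<_) (≡.sym (count-≡ i⋆)) (ℕ.s≤s ℕ.z≤n)

      marginal-best : ∀ i → 0 ℕ.< b i → marginal i 1 ≤ marginal i⋆ 1
      marginal-best i 0<b = begin
        marginal i 1             ≈⟨ first i ⟨
        R i 1                    ≤⟨ best i 0<b ⟩
        R i⋆ 1                   ≈⟨ first i⋆ ⟩
        marginal i⋆ 1            ∎
        where
        first : ∀ i → R i 1 ≈ marginal i 1
        first i = trans (R-suc i 0) (trans (+-congʳ (+-identityˡ 0#)) (+-identityˡ _))

      single : ∀ {x} → Feasible x → ∥ x ∥₁ ≡ 1 → V x ≤ V (count [ i⋆ ])
      single {x} feasible ∥x∥≡1 =
        -- Zero prices: only a product with a positive entry is wanted. Both allocations are then a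
        -- zero allocation plus one sale, and the first marginals are compared.
        let i , 0<xi , _ = below-weighted-mean x (λ _ → 0#) (≡.subst (0 ℕ.<_) (≡.sym ∥x∥≡1) (ℕ.s≤s ℕ.z≤n))
            xi≡1 = ℕₚ.≤-antisym (≡.subst (x i ℕ.≤_) ∥x∥≡1 (x≤∥x∥ x i)) 0<xi
            ∥rest∥≡0 = ℕₚ.suc-injective (≡.trans (≡.sym (∥decrement∥ i x 0<xi)) ∥x∥≡1)
        in begin
          V x
            ≈⟨ V-decrement i 0<xi ⟩
          V (decrement i x) + marginal i (x i)
            ≡⟨ ≡.cong (λ k → V (decrement i x) + marginal i k) xi≡1 ⟩
          V (decrement i x) + marginal i 1
            ≤⟨ +-mono-≤ (∥x∥≤0⇒V≤ (decrement i⋆ (count [ i⋆ ])) (ℕₚ.≤-reflexive ∥rest∥≡0))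
                 (marginal-best i (ℕₚ.≤-trans 0<xi (feasible i))) ⟩
          V (decrement i⋆ (count [ i⋆ ])) + marginal i⋆ 1
            ≡⟨ ≡.cong (λ k → V (decrement i⋆ (count [ i⋆ ])) + marginal i⋆ k) (count-≡ i⋆) ⟨
          V (decrement i⋆ (count [ i⋆ ])) + marginal i⋆ (count [ i⋆ ] i⋆)
            ≈⟨ V-decrement i⋆ 0<count ⟨
          V (count [ i⋆ ]) ∎

    count-[]-feasible : ∀ {i⋆} → 0 ℕ.< b i⋆ → Feasible (count [ i⋆ ])
    count-[]-feasible {i⋆} 0<b i with i Finₚ.≟ i⋆
    ... | yes ≡.refl = 0<b
    ... | no  _      = ℕ.z≤n

    competitive : ∀ σ → IntermediateTargetRepair I α σ → ∀ ℓ → c * U ℓ ≤ Rev I σ ℓ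
    competitive [] (no-capacity C≡0) ℓ = ≤-trans (cU≤U ℓ) (≤-trans (U≤UC ℓ)
      (U≤-by λ x _ ∥x∥≤C → ∥x∥≤0⇒V≤ (count (take ℓ [])) (≡.subst (∥ x ∥₁ ℕ.≤_) C≡0 ∥x∥≤C)))
    competitive (i⋆ ∷ σ) (first-arrival .i⋆ 0<b best .σ phases) zero =
      ≤-trans (cU≤U 0) (U≤-by λ x _ → ∥x∥≤0⇒V≤ (count []))
    competitive (i⋆ ∷ σ) (first-arrival .i⋆ 0<b best .σ phases) (suc h) = begin
      c * U (suc h)                             ≡⟨ ≡.cong (λ k → c * U (k ℕ.+ h)) (∥count-[]∥ i⋆) ⟨
      c * U (∥ count [ i⋆ ] ∥₁ ℕ.+ h)           ≤⟨ from-phase-start phases (count-[]-feasible 0<b)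
                                                     (ℕₚ.≤-reflexive (≡.sym (∥count-[]∥ i⋆))) balanced h ⟩
      V (count [ i⋆ ] ⊕ count (take h σ))       ≈⟨ V-cong (λ i → ≡.sym (count-∷ i⋆ (take h σ) i)) ⟩
      V (count (i⋆ ∷ take h σ))                 ∎
      where
      open ≤-Reasoning
      balanced : Balanced (count [ i⋆ ])
      balanced _ = *-mono-≤ (^2-nonNegative α) (V-nonNegative (count [ i⋆ ]))
        (^2-mono-≤ (<⇒≤ 0<α) (≤-by-difference (solve 1 (λ α → con (+ 1) :+ α :- α := con (+ 1)) refl α) (<⇒≤ 0<1)))
        (≡.subst (λ k → U k ≤ V (count [ i⋆ ])) (≡.sym (∥count-[]∥ i⋆)) (U1≤first i⋆ best))

-- Expectations and the bound on online algorithms.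

module OnlineBound (ℝ : RealField) where

  open Order ℝ
  open Allocations ℝ
  open Benchmark ℝ
  open OnlineAllocation ℝ
  open SemiringSum semiring using (*-distribʳ-sum)

  Probabilities : ∀ {n} → Vec Carrier n → Set
  Probabilities p = ∀ t → 0# ≤ Vec.lookup p t × Vec.lookup p t ≤ 1#

  𝔼-mono : ∀ {n} (p : Vec Carrier n) {X Y : Vec Bool n → Carrier} → Probabilities p →
    (∀ ω → X ω ≤ Y ω) → 𝔼 p X ≤ 𝔼 p Y
  𝔼-mono []       prob X≤Y = X≤Y []
  𝔼-mono (q ∷ ps) prob X≤Y = +-mono-≤
    (*-monoˡ-≤ (proj₁ (prob zero)) (𝔼-mono ps (prob ∘ suc) (X≤Y ∘ (true ∷_))))
    (*-monoˡ-≤ (x≤y⇒0≤y-x (proj₂ (prob zero))) (𝔼-mono ps (prob ∘ suc) (X≤Y ∘ (false ∷_))))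

  𝔼-scale : ∀ {n} (p : Vec Carrier n) c (X : Vec Bool n → Carrier) → c * 𝔼 p X ≈ 𝔼 p (λ ω → c * X ω)
  𝔼-scale []       c X = refl
  𝔼-scale (q ∷ ps) c X = trans
    (solve 4 (λ c q x y → c :* (q :* x :+ (con (+ 1) :- q) :* y) := q :* (c :* x) :+ (con (+ 1) :- q) :* (c :* y))
      refl c q (𝔼 ps (X ∘ (true ∷_))) (𝔼 ps (X ∘ (false ∷_))))
    (+-cong (*-congˡ (𝔼-scale ps c (X ∘ (true ∷_)))) (*-congˡ (𝔼-scale ps c (X ∘ (false ∷_)))))

  module OnlineProperties (I : Instance) where

    open Instance I
    open InstanceProperties I

    probabilities : Probabilities p
    probabilities t = p-nonneg t , p-≤1 t

    sale-feasible : ∀ h {i} → Feasible (sales I h) → sales I h i ℕ.< b i → Feasible (sales I h ⊕ count [ i ])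
    sale-feasible h {i} feasible available j with j Finₚ.≟ i
    ... | yes ≡.refl = ≡.subst (ℕ._≤ b j) (ℕₚ.+-comm 1 (sales I h j)) available
    ... | no  _      = ≡.subst (ℕ._≤ b j) (≡.sym (ℕₚ.+-identityʳ (sales I h j))) (feasible j)

    module _ (π : OnlineAlgorithm I) where

      open OnlineAlgorithm π renaming (total to weights-total)

      -- Current sales plus remaining arrivals bound the final number of sales. A sale keeps this
      -- budget, a rejection lowers it, and averaging over decisions preserves the bound since the
      -- weights sum to 1.
      revenue≤U : ∀ {n} h (ω : Vec Bool n) → Feasible (sales I h) → revenue h ω ≤ U (∥ sales I h ∥₁ ℕ.+ arrivals ω)
      revenue≤U h [] feasible = V≤U feasible (ℕₚ.m≤m+n _ 0)
      revenue≤U h (false ∷ ω) feasible = revenue≤U (noArrival ∷ h) ω feasible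
      revenue≤U h (true ∷ ω) feasible = begin
        reject h * revenue (rejected ∷ h) ω + sum (λ i → sell h i * revenue (sold i ∷ h) ω)
          ≤⟨ +-mono-≤
            (*-monoˡ-≤ (reject-nonneg h) (≤-trans (revenue≤U (rejected ∷ h) ω feasible)
              (U-mono (ℕₚ.+-monoʳ-≤ ∥ sales I h ∥₁ (ℕₚ.n≤1+n (arrivals ω))))))
            (sum-mono sale) ⟩
        reject h * M + sum (λ i → sell h i * M)
          ≈⟨ +-congˡ (*-distribʳ-sum M (sell h)) ⟨
        reject h * M + sum (sell h) * M
          ≈⟨ distribʳ M _ _ ⟨
        (reject h + sum (sell h)) * M
          ≈⟨ *-congʳ (weights-total h) ⟩
        1# * M
          ≈⟨ *-identityˡ M ⟩
        M ∎
        where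
        open ≤-Reasoning
        M = U (∥ sales I h ∥₁ ℕ.+ suc (arrivals ω))

        ∥sold∥ : ∀ i → ∥ sales I h ⊕ count [ i ] ∥₁ ℕ.+ arrivals ω ≡ ∥ sales I h ∥₁ ℕ.+ suc (arrivals ω)
        ∥sold∥ i = ≡.trans (≡.cong (ℕ._+ arrivals ω)
            (≡.trans (∥∥-⊕ (sales I h) (count [ i ])) (≡.cong (∥ sales I h ∥₁ ℕ.+_) (∥count-[]∥ i))))
          (ℕₚ.+-assoc ∥ sales I h ∥₁ 1 (arrivals ω))

        sale : ∀ i → sell h i * revenue (sold i ∷ h) ω ≤ sell h i * M
        sale i = [ sold-out , available ]′ (ℕₚ.≤-<-connex (b i) (sales I h i))
          where
          -- The successor history is infeasible here, so the induction hypothesis does not apply;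
          -- its weight is 0.
          sold-out : b i ℕ.≤ sales I h i → sell h i * revenue (sold i ∷ h) ω ≤ sell h i * M
          sold-out b≤ = ≤-reflexive (trans (*-congʳ (capacity h i b≤)) (trans (zeroˡ _)
            (sym (trans (*-congʳ (capacity h i b≤)) (zeroˡ M)))))
          available : sales I h i ℕ.< b i → sell h i * revenue (sold i ∷ h) ω ≤ sell h i * M
          available <b = *-monoˡ-≤ (sell-nonneg h i) (≡.subst (λ n → revenue (sold i ∷ h) ω ≤ U n) (∥sold∥ i)
            (revenue≤U (sold i ∷ h) ω (sale-feasible h feasible <b)))

    -- Completeness asks for a nonempty set of expected revenues; this algorithm exists for every
    -- instance.
    rejectAll : OnlineAlgorithm I
    rejectAll = record
      { reject        = λ _ → 1#
      ; sell          = λ _ _ → 0#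
      ; reject-nonneg = λ _ → <⇒≤ 0<1
      ; sell-nonneg   = λ _ _ → ≤-refl
      ; total         = λ _ → trans (+-congˡ (sum-zero m)) (+-identityʳ 1#)
      ; capacity      = λ _ _ _ → refl
      }
      where open SemiringSum semiring using () renaming (sum-replicate-zero to sum-zero)

    𝔼U : Carrier
    𝔼U = 𝔼 p (λ ω → U (arrivals ω))

    𝔼revenue≤𝔼U : ∀ π → 𝔼 p (OnlineAlgorithm.revenue {I} π []) ≤ 𝔼U
    𝔼revenue≤𝔼U π = 𝔼-mono p probabilities λ ω →
      ≡.subst (λ n → OnlineAlgorithm.revenue {I} π [] ω ≤ U (n ℕ.+ arrivals ω)) (∥∥-zero m)
        (revenue≤U π [] ω (λ _ → ℕ.z≤n))

    OPTon-exists : ∃[ opt ] IsOPTon I opt × opt ≤ 𝔼U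
    OPTon-exists =
      let opt , supremum = complete _ (_ , rejectAll , refl) (𝔼U , upper)
      in opt , supremum , proj₂ supremum 𝔼U upper
      where
      upper : UpperBound (λ v → ∃[ π ] v ≈ 𝔼 p (OnlineAlgorithm.revenue {I} π [])) 𝔼U
      upper v (π , v≈) = ≤-respˡ-≈ (sym v≈) (𝔼revenue≤𝔼U π)

theorem4 : ExcludedMiddle 0ℓ → (ℝ : RealField) →
    let open RealField ℝ
        open OnlineAllocation ℝ
        open Instance
    in
    (∀ α → 1# < α → ∃[ c ] IsCdet α c ×
      (∀ I → DiscreteConcave I → ∀ σ → IntermediateTargetRepair I α σ →
        ∀ ℓ → c * U I ℓ ≤ Rev I σ ℓ)) ×
    (∃[ c ] IsCdet (fromℕ 2) c × decimal 2466 4 ≤ c × c < decimal 2467 4) ×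
    (∃[ s ] IsSupremum (λ c → ∃[ α ] 1# < α × IsCdet α c) s ×
      decimal 2467 4 ≤ s × s < decimal 2468 4 ×
      (∃[ α ] 1# < α × IsCdet α s ×
        decimal 19232 4 - decimal 5 5 ≤ α × α ≤ decimal 19232 4 + decimal 5 5)) ×
    (∀ I → DiscreteConcave I →
      (∀ σ → IntermediateTargetRepair I (fromℕ 2) σ →
        decimal 2466 4 * 𝔼 (p I) (λ ω → U I (arrivals ω)) ≤ 𝔼 (p I) (λ ω → Rev I σ (arrivals ω))) ×
      (∃[ opt ] IsOPTon I opt ×
        decimal 2466 4 * opt ≤ decimal 2466 4 * 𝔼 (p I) (λ ω → U I (arrivals ω))))
theorem4 em ℝ =
  (λ α 1<α →
    let c , isCdet = cdet-exists 1<α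
    in c , isCdet , λ I concave → Analysis.competitive I concave 1<α (proj₂ isCdet)) ,
  cdet-2 ,
  cdet-supremum ,
  λ I concave →
    (λ σ execution →
      let c , isCdet , 2466≤c , _ = cdet-2
          open Instance I using (p; U)
      -- The guarantee holds for each arrival pattern separately, so monotonicity of the expectation
      -- is enough.
      in ≤-trans (≤-reflexive (𝔼-scale p (decimal 2466 4) (λ ω → U (arrivals ω))))
        (𝔼-mono p (OnlineProperties.probabilities I) λ ω →
          ≤-trans (*-monoʳ-≤ (InstanceProperties.U-nonNegative I (arrivals ω)) 2466≤c)
            (Analysis.competitive I concave 1<2 (proj₂ isCdet) σ execution (arrivals ω)))) ,
    (let opt , isOPT , opt≤ = OnlineProperties.OPTon-exists I
     in opt , isOPT , *-monoˡ-≤ 0≤decimal opt≤)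
  where
  open Order ℝ
  open OnlineAllocation ℝ using (arrivals; module Instance)
  open Benchmark ℝ
  open CompetitiveRatio em ℝ
  open OptimalRatio em ℝ
  open Numerics ℝ
  open TargetRepair ℝ
  open OnlineBound ℝ
  0≤decimal : 0# ≤ decimal 2466 4
  0≤decimal = *-nonNegative (fromℕ-nonNegative 2466) (<⇒≤ (⁻¹-positive (10^-positive 4)))
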